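{- Let $p>3$ be a prime. Then $$\sum_{n=0}^{p-1}\frac{G_n^{(3)}}{(-27)^n}\equiv\begin{cases}2u\pmod p&\text{if }p=u^2+3v^2\equiv1\pmod3\text{ with }3\mid u-1,\\0\pmod p&\text{if }p\equiv2\pmod3,\end{cases}$$ $$\sum_{n=0}^{p-1}\frac{G_n^{(3)}}{3^n}\equiv\sum_{n=0}^{p-1}\frac{G_n^{(3)}}{243^n}\equiv\begin{cases}-L\pmod p&\text{if }3\mid p-1,\ 4p=L^2+27M^2\text{ and }3\mid L-1,\\0\pmod p&\text{if }p\equiv2\pmod3,\end{cases}$$ where $u,v,L,M$ are integers.
   Context: $G_n^{(3)}=\sum_{k=0}^n\binom nk(-1)^k\binom{2k}k\binom{3k}k27^{n-k}$. Congruences are in the ring of rationals with denominator prime to $p$. -}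

module Defs where

open import Data.Nat as ℕ using (ℕ; zero; suc; _∸_)
open import Data.Nat.Properties using (m^n≢0)
open import Data.Nat.Combinatorics using (_C_)
open import Data.Integer as ℤ using (ℤ; +_)
open import Data.Integer.Divisibility as ℤd using ()
open import Data.Rational as ℚ using (ℚ; ↥_)

sumℤ : ℕ → (ℕ → ℤ) → ℤ
sumℤ zero    f = f zero
sumℤ (suc n) f = sumℤ n f ℤ.+ f (suc n)

sumℚ : ℕ → (ℕ → ℚ) → ℚ
sumℚ zero    f = f zero
sumℚ (suc n) f = sumℚ n f ℚ.+ f (suc n)

sgn : ℕ → ℤ
sgn k = (ℤ.- ℤ.1ℤ) ℤ.^ k

G3 : ℕ → ℤ
G3 n = sumℤ n (λ k → + (n C k) ℤ.* sgn k ℤ.* + ((2 ℕ.* k) C k)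
                         ℤ.* + ((3 ℕ.* k) C k) ℤ.* + (27 ℕ.^ (n ∸ k)))

divPow : ℤ → (b : ℕ) → .{{ℕ.NonZero b}} → ℕ → ℚ
divPow x b n = ℚ._/_ x (b ℕ.^ n) {{m^n≢0 b n}}

divNegPow : ℤ → (b : ℕ) → .{{ℕ.NonZero b}} → ℕ → ℚ
divNegPow x b n = divPow (sgn n ℤ.* x) b n

-- Congruence mod p in the ring of rationals with denominator prime to p:
-- a ≡ b (mod p) iff a - b = x/y with p ∣ x, p ∤ y; for the reduced form of
-- a - b this is exactly p ∣ numerator (then p ∤ denominator automatically).
_≡_[modℚ_] : ℚ → ℚ → ℕ → Set
a ≡ b [modℚ p ] = (+ p) ℤd.∣ (↥ (a ℚ.- b))

S-27 S3 S243 : ℕ → ℚ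
S-27 p = sumℚ (p ∸ 1) (λ n → divNegPow (G3 n) 27 n)
S3   p = sumℚ (p ∸ 1) (λ n → divPow (G3 n) 3 n)
S243 p = sumℚ (p ∸ 1) (λ n → divPow (G3 n) 243 n)

ι : ℤ → ℚ
ι z = ℚ._/_ z 1

{-# OPTIONS --safe #-}
module Submission where

open import Defs
open import Data.Nat using (ℕ; _>_; _∸_; _%_)
open import Data.Nat.Divisibility using () renaming (_∣_ to _∣ℕ_)
open import Data.Nat.Primality using (Prime)
open import Data.Integer using (ℤ; +_; _+_; _-_; _*_; -_)
open import Data.Integer.Divisibility using (_∣_)
open import Data.Rational using (0ℚ)
open import Data.Product using (_×_)
open import Relation.Binary.PropositionalEquality using (_≡_)

open import Data.Nat as ℕ using (zero; suc; z≤n; s≤s)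
import Data.Nat.Divisibility as ℕd
import Data.Nat.Properties as ℕₚ
import Data.Nat.Tactic.RingSolver as ℕ-Solver
open import Data.Nat.Combinatorics using (_C_; nCn≡1; k>n⇒nCk≡0; nCk≡nC[n∸k]; nCk+nC[k+1]≡[n+1]C[k+1])
open import Data.Nat.DivMod using (m≡m%n+[m/n]*n; m%n<n; [m+kn]%n≡m%n)
open import Data.Nat.Induction using (<-rec)
open import Data.Nat.Primality using (prime⇒nonZero; prime⇒irreducible; euclidsLemma; prime[2]; prime?)
open import Data.Integer as ℤ using (-[1+_]; _^_; 0ℤ; 1ℤ; ∣_∣)
open import Data.Integer.DivMod using (_%ℕ_; _/ℕ_; n%ℕd<d; a≡a%ℕn+[a/ℕn]*n)
import Data.Integer.Divisibility.Signed as Signed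
open import Data.Integer.GCD using (gcd)
import Data.Integer.Properties as ℤₚ
open ℤₚ using (*-identityˡ; *-identityʳ; +-identityʳ; +-identityˡ; ^-zeroˡ; *-zeroʳ; *-zeroˡ; pos-*; ^-*-assoc; ^-distribˡ-+-*; i-j≡0⇒i≡j; i*j≡0⇒i≡0∨j≡0; -1*i≡-i; +-inverseʳ; neg-involutive)
open import Data.Integer.Tactic.RingSolver using (solve-∀)
open import Data.Rational as ℚ using (ℚ; ↥_; ↧_)
import Data.Rational.Properties as ℚₚ
open import Data.Empty using (⊥-elim)
open import Data.Product using (_,_; proj₁; proj₂; ∃)
open import Data.Sum using (_⊎_; inj₁; inj₂; [_,_]′)
open import Relation.Binary using (Setoid; tri<; tri≈; tri>)
open import Relation.Binary.PropositionalEquality using (refl; sym; trans; cong; cong₂; subst; subst₂; _≢_; module ≡-Reasoning)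
open import Relation.Nullary using (¬_; Dec; yes; no)
open import Relation.Nullary.Decidable using (toWitness; from-no)

-- Put c k = (3k)! / k!³. Summing over n first, a truncated binomial series gives
-- Σ Gₙ / mⁿ ≡ Σ c k Tᵏ (mod p) with T = 1 / (27 − m), so T = 1/54, 1/24 and −1/216.
--
-- Modulo p, Σ c k Tᵏ is the Hasse invariant − Σₓ (4 x³ + (x + T)²)^((p−1)/2) of y² + x y + T y = x³,
-- and also a Legendre polynomial Pₙ(1 − 54 T) with n = ⌊p/3⌋. At T = 1/24 the cubic is a
-- translate of 4 x³ − 1/1728, at T = 1/54 one needs Pₙ(0), and T = −1/216 is related to T = 1/24 by
-- Pₙ(−x) = (−1)ⁿ Pₙ(x). For p ≡ 2 (mod 3) the relevant coefficients vanish. For p = 6 m + 1 the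
-- sums are congruent to −E(1) and −E(16), where E(c) + p is the number of solutions of y² = x³ + c.
--
-- E(c) is evaluated exactly by counting. With g not a cube, the first two moments of E show that
-- its values at s², s² g², s² g⁴ have sum 0 and sum of squares 6 p, hence A² + 3 b² = 4 p with A = E(s²). Automorphisms of the curves show that
-- E(s²) ≡ 1 (mod 3) and 2 ∣ E(1), and comparison with x³ + y³ = 1 shows E(16) + p ≡ 8 (mod 9).
-- Uniqueness of the representation of p (or 4 p) by the form A² + 3 B² (or A² + 27 B²)
-- then gives E(1) = −2 u and E(16) = L.

-- Congruences modulo p determine E(c) only modulo p, whereas u and L are integers. Hence all point
-- counts are exact integer sums of an indicator `δ`; congruences enter only through the Hasse
-- invariants and Euler's criterion. Moments over cosets of cubes take the place of cubic characters
-- and Jacobi sums. Legendre polynomials occur because the ratio of consecutive c k is 3 (3k + 1)(3k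
-- + 2) / (k + 1)², which agrees modulo p with the ratio of (-27)ᵏ C(n, k) C(n + k, k) as soon as 3n
-- is -1 or -2. The three values of 27 T are 1/2, 9/8 and -1/8: the first is fixed by y ↦ 1 - y and
-- the other two are exchanged. The main obstacle is that 4 p has several representations by A² + 3
-- B². The uniqueness argument for k p and A² + d B² requires k² < d, which fails for k = 4, d = 3.
-- Evenness of E(1) leads to k = 1, d = 3, and the congruence modulo 9 for E(16) leads to k = 4, d =
-- 27. The remaining sign is settled modulo 3.

-- Finite sums and powers of integers

∑ : ℕ → (ℕ → ℤ) → ℤ
∑ zero    f = 0ℤ
∑ (suc n) f = ∑ n f + f n

∑-cong : ∀ n {f g} → (∀ i → i ℕ.< n → f i ≡ g i) → ∑ n f ≡ ∑ n g
∑-cong zero    eq = refl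
∑-cong (suc n) eq = cong₂ _+_ (∑-cong n (λ i i<n → eq i (ℕₚ.m<n⇒m<1+n i<n))) (eq n (ℕₚ.n<1+n n))

∑-ext : ∀ n {f g} → (∀ i → f i ≡ g i) → ∑ n f ≡ ∑ n g
∑-ext n eq = ∑-cong n (λ i _ → eq i)

interchange : ∀ a b c d → (a + b) + (c + d) ≡ (a + c) + (b + d)
interchange = solve-∀

∑-distrib-+ : ∀ n f g → ∑ n (λ i → f i + g i) ≡ ∑ n f + ∑ n g
∑-distrib-+ zero    f g = refl
∑-distrib-+ (suc n) f g =
  trans (cong (_+ (f n + g n)) (∑-distrib-+ n f g)) (interchange (∑ n f) (∑ n g) (f n) (g n))

*-distribˡ-∑ : ∀ c n f → c * ∑ n f ≡ ∑ n (λ i → c * f i)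
*-distribˡ-∑ c zero    f = *-zeroʳ c
*-distribˡ-∑ c (suc n) f =
  trans (ℤₚ.*-distribˡ-+ c (∑ n f) (f n)) (cong (_+ c * f n) (*-distribˡ-∑ c n f))

*-distribʳ-∑ : ∀ c n f → ∑ n f * c ≡ ∑ n (λ i → f i * c)
*-distribʳ-∑ c n f =
  trans (ℤₚ.*-comm (∑ n f) c) (trans (*-distribˡ-∑ c n f) (∑-ext n (λ i → ℤₚ.*-comm c (f i))))

∑-zero : ∀ n → ∑ n (λ _ → 0ℤ) ≡ 0ℤ
∑-zero zero = refl
∑-zero (suc n) = trans (+-identityʳ _) (∑-zero n)

∑-const : ∀ n c → ∑ n (λ _ → c) ≡ + n * c
∑-const zero    c = refl
∑-const (suc n) c = trans (cong (_+ c) (∑-const n c)) (sym (trans (ℤₚ.*-distribʳ-+ c 1ℤ (+ n))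
  (trans (cong (_+ + n * c) (*-identityˡ c)) (ℤₚ.+-comm c (+ n * c)))))

∑-swap : ∀ m n (f : ℕ → ℕ → ℤ) → ∑ m (λ i → ∑ n (λ j → f i j)) ≡ ∑ n (λ j → ∑ m (λ i → f i j))
∑-swap zero    n f = sym (∑-zero n)
∑-swap (suc m) n f =
  trans (cong (_+ ∑ n (f m)) (∑-swap m n f)) (sym (∑-distrib-+ n (λ j → ∑ m (λ i → f i j)) (f m)))

∑-head : ∀ n f → ∑ (suc n) f ≡ f 0 + ∑ n (λ i → f (suc i))
∑-head zero    f = trans (+-identityˡ (f 0)) (sym (+-identityʳ (f 0)))
∑-head (suc n) f = trans (cong (_+ f (suc n)) (∑-head n f)) (ℤₚ.+-assoc (f 0) _ _)

∑-single : ∀ n f i → i ℕ.< n → (∀ j → j ℕ.< n → j ≢ i → f j ≡ 0ℤ) → ∑ n f ≡ f i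
∑-single (suc n) f i i<1+n z with i ℕ.≟ n
... | yes refl = trans (cong (_+ f n)
        (trans (∑-cong n (λ j j<n → z j (ℕₚ.m<n⇒m<1+n j<n) (ℕₚ.<⇒≢ j<n))) (∑-zero n))) (+-identityˡ (f n))
... | no i≢n = trans (cong₂ _+_
        (∑-single n f i (ℕₚ.≤∧≢⇒< (ℕ.s≤s⁻¹ i<1+n) i≢n) (λ j j<n → z j (ℕₚ.m<n⇒m<1+n j<n)))
        (z n (ℕₚ.n<1+n n) (λ n≡i → i≢n (sym n≡i)))) (+-identityʳ (f i))

∑-telescope : ∀ n (f : ℕ → ℤ) → ∑ n (λ i → f (suc i) - f i) ≡ f n - f 0
∑-telescope zero    f = sym (+-inverseʳ (f 0))
∑-telescope (suc n) f = trans (cong (_+ (f (suc n) - f n)) (∑-telescope n f)) (lemma (f n) (f 0) (f (suc n)))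
  where
  lemma : ∀ a b c → (a - b) + (c - a) ≡ c - b
  lemma = solve-∀

∑-nonneg : ∀ n f → (∀ i → 0ℤ ℤ.≤ f i) → 0ℤ ℤ.≤ ∑ n f
∑-nonneg zero    f f≥0 = ℤₚ.≤-refl
∑-nonneg (suc n) f f≥0 = ℤₚ.+-mono-≤ (∑-nonneg n f f≥0) (f≥0 n)

-- Serves to turn a pointwise inequality that is tight in total into a pointwise equality.
∑-nonneg-zero : ∀ n f → (∀ i → 0ℤ ℤ.≤ f i) → ∑ n f ≡ 0ℤ → ∀ i → i ℕ.< n → f i ≡ 0ℤ
∑-nonneg-zero (suc n) f f≥0 eq i i<1+n with i ℕ.≟ n
... | yes refl = ℤₚ.≤-antisym
        (subst (f n ℤ.≤_) eq (subst (ℤ._≤ ∑ (suc n) f) (+-identityˡ (f n)) (ℤₚ.+-monoˡ-≤ (f n) (∑-nonneg n f f≥0))))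
        (f≥0 n)
... | no i≢n = ∑-nonneg-zero n f f≥0
        (ℤₚ.≤-antisym
          (subst (∑ n f ℤ.≤_) eq (subst (ℤ._≤ ∑ (suc n) f) (+-identityʳ (∑ n f)) (ℤₚ.+-monoʳ-≤ (∑ n f) (f≥0 n))))
          (∑-nonneg n f f≥0))
        i (ℕₚ.≤∧≢⇒< (ℕ.s≤s⁻¹ i<1+n) i≢n)

^-distribʳ-* : ∀ x y n → (x * y) ^ n ≡ x ^ n * y ^ n
^-distribʳ-* x y zero = refl
^-distribʳ-* x y (suc n) = trans (cong (x * y *_) (^-distribʳ-* x y n)) (lemma x y (x ^ n) (y ^ n))
  where
  lemma : ∀ a b c d → a * b * (c * d) ≡ a * c * (b * d)
  lemma = solve-∀

^-suc-∸ : ∀ x {n k} → k ℕ.< n → x ^ (n ∸ k) ≡ x * x ^ (n ∸ suc k)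
^-suc-∸ x {n} {k} k<n = cong (x ^_) (ℕₚ.+-∸-assoc 1 k<n)

neg-^-even : ∀ x n → (- x) ^ (2 ℕ.* n) ≡ x ^ (2 ℕ.* n)
neg-^-even x n = trans (sym (^-*-assoc (- x) 2 n)) (trans (cong (_^ n) (lemma x)) (^-*-assoc x 2 n))
  where
  lemma : ∀ a → (- a) * ((- a) * 1ℤ) ≡ a * (a * 1ℤ)
  lemma = solve-∀

-- Binomial coefficients, falling factorials and factorials

abstract
  -- Kept opaque: only the laws below are used, with `bin-def` as the link to the coefficients in
  -- `G3`.
  bin : ℕ → ℕ → ℤ
  bin n k = + (n C k)

  bin-def : ∀ n k → bin n k ≡ + (n C k)
  bin-def n k = refl

  bin-zero : ∀ n → bin n 0 ≡ 1ℤ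
  bin-zero n = cong +_ (trans (nCk≡nC[n∸k] {0} {n} z≤n) (nCn≡1 n))

  bin-diag : ∀ n → bin n n ≡ 1ℤ
  bin-diag n = cong +_ (nCn≡1 n)

  bin-> : ∀ {n k} → n ℕ.< k → bin n k ≡ 0ℤ
  bin-> n<k = cong +_ (k>n⇒nCk≡0 n<k)

  bin-suc : ∀ n k → bin (suc n) (suc k) ≡ bin n k + bin n (suc k)
  bin-suc n k = cong +_ (sym (nCk+nC[k+1]≡[n+1]C[k+1] n k))

  bin-sym : ∀ {n k} → k ℕ.≤ n → bin n k ≡ bin n (n ∸ k)
  bin-sym k≤n = cong +_ (nCk≡nC[n∸k] k≤n)

binomial-theorem : ∀ x y n → (x + y) ^ n ≡ ∑ (suc n) (λ k → bin n k * (x ^ k * y ^ (n ∸ k)))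
binomial-theorem x y zero = sym (trans (+-identityˡ _) (cong (_* 1ℤ) (bin-zero 0)))
binomial-theorem x y (suc n) = sym (begin
  ∑ (suc (suc n)) (λ k → bin (suc n) k * (x ^ k * y ^ (suc n ∸ k)))
    ≡⟨ ∑-head (suc n) _ ⟩
  bin (suc n) 0 * (1ℤ * y ^ suc n) + ∑ (suc n) (λ k → bin (suc n) (suc k) * (x ^ suc k * y ^ (n ∸ k)))
    ≡⟨ cong₂ _+_ (trans (cong (_* (1ℤ * y ^ suc n)) (bin-zero (suc n))) (lemma₁ y (y ^ n)))
         (trans (∑-ext (suc n) (λ k → trans (cong (_* (x ^ suc k * y ^ (n ∸ k))) (bin-suc n k))
                                             (lemma₂ (bin n k) (bin n (suc k)) x (x ^ k) (y ^ (n ∸ k)))))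
                (∑-distrib-+ (suc n) _ _)) ⟩
  y * y ^ n + (∑ (suc n) (λ k → x * (bin n k * (x ^ k * y ^ (n ∸ k)))) + ∑ (suc n) (λ k → bin n (suc k) * (x ^ suc k * y ^ (n ∸ k))))
    ≡⟨ cong (λ z → y * y ^ n + (z + ∑ (suc n) (λ k → bin n (suc k) * (x ^ suc k * y ^ (n ∸ k))))) (sym (*-distribˡ-∑ x (suc n) _)) ⟩
  y * y ^ n + (x * s + (∑ n (λ k → bin n (suc k) * (x ^ suc k * y ^ (n ∸ k))) + bin n (suc n) * (x ^ suc n * y ^ (n ∸ n))))
    ≡⟨ cong (λ z → y * y ^ n + (x * s + (∑ n (λ k → bin n (suc k) * (x ^ suc k * y ^ (n ∸ k))) + z * (x ^ suc n * y ^ (n ∸ n))))) (bin-> (ℕₚ.n<1+n n)) ⟩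
  y * y ^ n + (x * s + (∑ n (λ k → bin n (suc k) * (x ^ suc k * y ^ (n ∸ k))) + 0ℤ))
    ≡⟨ cong (λ z → y * y ^ n + (x * s + (z + 0ℤ)))
         (trans (∑-cong n (λ k k<n → trans (cong (λ z → bin n (suc k) * (x ^ suc k * z)) (^-suc-∸ y k<n))
                                            (lemma₃ (bin n (suc k)) (x ^ suc k) y (y ^ (n ∸ suc k)))))
                (sym (*-distribˡ-∑ y n _))) ⟩
  y * y ^ n + (x * s + (y * s' + 0ℤ))
    ≡⟨ lemma₄ x y s s' (y ^ n) ⟩
  x * s + y * (1ℤ * (1ℤ * y ^ n) + s')
    ≡⟨ cong (λ z → x * s + y * z) (sym (trans (∑-head n (λ k → bin n k * (x ^ k * y ^ (n ∸ k)))) (cong (λ z → z * (1ℤ * y ^ n) + s') (bin-zero n)))) ⟩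
  x * s + y * s
    ≡⟨ sym (ℤₚ.*-distribʳ-+ s x y) ⟩
  (x + y) * s
    ≡⟨ cong ((x + y) *_) (sym (binomial-theorem x y n)) ⟩
  (x + y) ^ suc n ∎)
  where
  open ≡-Reasoning
  s s' : ℤ
  s = ∑ (suc n) (λ k → bin n k * (x ^ k * y ^ (n ∸ k)))
  s' = ∑ n (λ k → bin n (suc k) * (x ^ suc k * y ^ (n ∸ suc k)))
  lemma₁ : ∀ a b → 1ℤ * (1ℤ * (a * b)) ≡ a * b
  lemma₁ = solve-∀
  lemma₂ : ∀ a b c d e → (a + b) * (c * d * e) ≡ c * (a * (d * e)) + b * (c * d * e)
  lemma₂ = solve-∀
  lemma₃ : ∀ a b c d → a * (b * (c * d)) ≡ c * (a * (b * d))
  lemma₃ = solve-∀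
  lemma₄ : ∀ a b c d e → b * e + (a * c + (b * d + 0ℤ)) ≡ a * c + b * (1ℤ * (1ℤ * e) + d)
  lemma₄ = solve-∀

-- The falling factorial a (a - 1) ⋯ (a - k + 1). The argument is an integer because reduction
-- modulo p leads to negative arguments.
ff : ℤ → ℕ → ℤ
ff a zero = 1ℤ
ff a (suc k) = ff a k * (a - + k)

fact : ℕ → ℤ
fact zero = 1ℤ
fact (suc k) = fact k * + suc k

-- `ff` grows by appending the smallest factor; here the largest one is split off.
ff-suc : ∀ a k → ff (1ℤ + a) (suc k) ≡ (1ℤ + a) * ff a k
ff-suc a zero = lemma a
  where
  lemma : ∀ a → 1ℤ * (1ℤ + a - 0ℤ) ≡ (1ℤ + a) * 1ℤ
  lemma = solve-∀
ff-suc a (suc k) = trans (cong (_* (1ℤ + a - + suc k)) (ff-suc a k)) (lemma a (ff a k) (+ k))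
  where
  lemma : ∀ a b c → (1ℤ + a) * b * (1ℤ + a - (1ℤ + c)) ≡ (1ℤ + a) * (b * (a - c))
  lemma = solve-∀

-- The division-free form of the quotient formula for C(n, k). Modulo p the factor k! is a unit for
-- k < p and can be cancelled.
fact-bin : ∀ n k → fact k * bin n k ≡ ff (+ n) k
fact-bin n       zero = trans (*-identityˡ _) (bin-zero n)
fact-bin zero    (suc k) = trans (trans (cong (fact (suc k) *_) (bin-> {zero} {suc k} (s≤s z≤n))) (*-zeroʳ (fact (suc k)))) (sym (ff-zero k))
  where
  ff-zero : ∀ k → ff 0ℤ (suc k) ≡ 0ℤ
  ff-zero zero = refl
  ff-zero (suc k) = cong (_* (0ℤ - + suc k)) (ff-zero k)
fact-bin (suc n) (suc k) = begin
  fact k * + suc k * bin (suc n) (suc k)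
    ≡⟨ cong (fact k * + suc k *_) (bin-suc n k) ⟩
  fact k * (1ℤ + + k) * (bin n k + bin n (suc k))
    ≡⟨ lemma₁ (fact k) (+ k) (bin n k) (bin n (suc k)) ⟩
  fact k * bin n k * (1ℤ + + k) + fact (suc k) * bin n (suc k)
    ≡⟨ cong₂ (λ y z → y * (1ℤ + + k) + z) (fact-bin n k) (fact-bin n (suc k)) ⟩
  ff (+ n) k * (1ℤ + + k) + ff (+ n) k * (+ n - + k)
    ≡⟨ lemma₂ (ff (+ n) k) (+ k) (+ n) ⟩
  (1ℤ + + n) * ff (+ n) k
    ≡⟨ sym (ff-suc (+ n) k) ⟩
  ff (+ suc n) (suc k) ∎
  where
  open ≡-Reasoning
  lemma₁ : ∀ a b c d → a * (1ℤ + b) * (c + d) ≡ a * c * (1ℤ + b) + a * (1ℤ + b) * d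
  lemma₁ = solve-∀
  lemma₂ : ∀ a b c → a * (1ℤ + b) + a * (c - b) ≡ (1ℤ + c) * a
  lemma₂ = solve-∀

-- Uniqueness of representations by A² + d B²

euclid : ∀ {q} → Prime q → ∀ a b → + q Signed.∣ a * b → + q Signed.∣ a ⊎ + q Signed.∣ b
euclid {q} q-prime a b d with euclidsLemma ∣ a ∣ ∣ b ∣ q-prime (subst (q ℕd.∣_) (ℤₚ.abs-* a b) (Signed.∣⇒∣ᵤ d))
... | inj₁ e = inj₁ (Signed.∣ᵤ⇒∣ e)
... | inj₂ e = inj₂ (Signed.∣ᵤ⇒∣ e)

euclid-square : ∀ {q} → Prime q → ∀ a → + q Signed.∣ a * a → + q Signed.∣ a
euclid-square q-prime a d = [ (λ e → e) , (λ e → e) ]′ (euclid q-prime a a d)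

prime[3] : Prime 3
prime[3] = toWitness {a? = prime? 3} _

square-abs : ∀ i → i * i ≡ + (∣ i ∣ ℕ.* ∣ i ∣)
square-abs (+ n) = sym (pos-* n n)
square-abs -[1+ n ] = refl

square-injective : ∀ a b → a * a ≡ b * b → a ≡ b ⊎ a ≡ - b
square-injective a b e with i*j≡0⇒i≡0∨j≡0 (a - b) (trans (lemma a b) (trans (cong (_- b * b) e) (+-inverseʳ (b * b))))
  where
  lemma : ∀ a b → (a - b) * (a - - b) ≡ a * a - b * b
  lemma = solve-∀
... | inj₁ z = inj₁ (i-j≡0⇒i≡j a b z)
... | inj₂ z = inj₂ (i-j≡0⇒i≡j a (- b) z)

module _ {q : ℕ} (q-prime : Prime q) {k d : ℕ} {{k-nonZero : ℕ.NonZero k}} (k²<d : k ℕ.* k ℕ.< d) where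

  -- A nonzero multiple x of q already has d x² ≥ d q² > k² q²; this is the use of k² < d.
  multiple-too-large : ∀ x y → q ℕd.∣ x → y ℕ.* y ℕ.+ d ℕ.* (x ℕ.* x) ≡ k ℕ.* q ℕ.* (k ℕ.* q) → x ≡ 0
  multiple-too-large _ y (ℕd.divides zero refl) e = refl
  multiple-too-large _ y (ℕd.divides (suc t) refl) e = ⊥-elim (ℕₚ.<-irrefl (sym e) (begin-strict
    k ℕ.* q ℕ.* (k ℕ.* q) ≡⟨ lemma k q ⟩
    k ℕ.* k ℕ.* (q ℕ.* q) <⟨ ℕₚ.*-monoˡ-< (q ℕ.* q) {{q²-nonZero}} k²<d ⟩
    d ℕ.* (q ℕ.* q) ≤⟨ ℕₚ.*-monoʳ-≤ d (ℕₚ.*-mono-≤ (ℕₚ.m≤m+n q (t ℕ.* q)) (ℕₚ.m≤m+n q (t ℕ.* q))) ⟩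
    d ℕ.* (suc t ℕ.* q ℕ.* (suc t ℕ.* q)) ≤⟨ ℕₚ.m≤n+m _ (y ℕ.* y) ⟩
    y ℕ.* y ℕ.+ d ℕ.* (suc t ℕ.* q ℕ.* (suc t ℕ.* q))   ∎))
    where
    open ℕₚ.≤-Reasoning
    q²-nonZero : ℕ.NonZero (q ℕ.* q)
    q²-nonZero = ℕₚ.m*n≢0 q q {{prime⇒nonZero q-prime}} {{prime⇒nonZero q-prime}}
    lemma : ∀ k q → k ℕ.* q ℕ.* (k ℕ.* q) ≡ k ℕ.* k ℕ.* (q ℕ.* q)
    lemma = ℕ-Solver.solve-∀

  multiple-zero : ∀ X Y → + q Signed.∣ X → Y * Y + + d * (X * X) ≡ (+ k * + q) * (+ k * + q) → X ≡ 0ℤ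
  multiple-zero X Y q∣X e = ℤₚ.∣i∣≡0⇒i≡0 (multiple-too-large ∣ X ∣ ∣ Y ∣ (Signed.∣⇒∣ᵤ q∣X) (ℤₚ.+-injective (begin
    + (∣ Y ∣ ℕ.* ∣ Y ∣ ℕ.+ d ℕ.* (∣ X ∣ ℕ.* ∣ X ∣)) ≡⟨ cong₂ _+_ (sym (square-abs Y)) (trans (pos-* d _) (cong (+ d *_) (sym (square-abs X)))) ⟩
    Y * Y + + d * (X * X) ≡⟨ e ⟩
    (+ k * + q) * (+ k * + q) ≡⟨ cong (λ z → z * z) (sym (pos-* k q)) ⟩
    + (k ℕ.* q) * + (k ℕ.* q) ≡⟨ sym (pos-* (k ℕ.* q) (k ℕ.* q)) ⟩
    + (k ℕ.* q ℕ.* (k ℕ.* q))                         ∎)))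
    where open ≡-Reasoning

  -- From (B A′ − A B′)(B A′ + A B′) = k q (B² − B′²), the prime q divides one factor X, and
  -- the product of the two norms is Y² + d X² = k² q², which forces X = 0.
  norm-unique : ∀ A B A′ B′ → A * A + + d * (B * B) ≡ + k * + q → A′ * A′ + + d * (B′ * B′) ≡ + k * + q → A * A ≡ A′ * A′
  norm-unique A B A′ B′ e₁ e₂ = i-j≡0⇒i≡j (A * A) (A′ * A′) (begin
    A * A - A′ * A′ ≡⟨ lemma₁ (+ d) A B A′ B′ ⟩
    (A * A + + d * (B * B)) - (A′ * A′ + + d * (B′ * B′)) - + d * (B * B - B′ * B′) ≡⟨ cong₂ (λ x y → x - y - + d * (B * B - B′ * B′)) e₁ e₂ ⟩
    + k * + q - + k * + q - + d * (B * B - B′ * B′) ≡⟨ cong (λ z → + k * + q - + k * + q - + d * z) B²-B′² ⟩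
    + k * + q - + k * + q - + d * 0ℤ ≡⟨ lemma₂ (+ k * + q) (+ d) ⟩
    0ℤ                                                  ∎)
    where
    open ≡-Reasoning
    lemma₁ : ∀ d A B A′ B′ → A * A - A′ * A′ ≡ (A * A + d * (B * B)) - (A′ * A′ + d * (B′ * B′)) - d * (B * B - B′ * B′)
    lemma₁ = solve-∀
    lemma₂ : ∀ a d → a - a - d * 0ℤ ≡ 0ℤ
    lemma₂ = solve-∀
    lemma₃ : ∀ d A B A′ B′ → (B * A′ - A * B′) * (B * A′ + A * B′) ≡ (A′ * A′ + d * (B′ * B′)) * (B * B) - (A * A + d * (B * B)) * (B′ * B′)
    lemma₃ = solve-∀
    lemma₄ : ∀ a b c → a * b - a * c ≡ a * (b - c)
    lemma₄ = solve-∀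
    lemma₅ : ∀ d A B A′ B′ → (A * A′ + d * (B * B′)) * (A * A′ + d * (B * B′)) + d * ((B * A′ - A * B′) * (B * A′ - A * B′))
                        ≡ (A * A + d * (B * B)) * (A′ * A′ + d * (B′ * B′))
    lemma₅ = solve-∀
    lemma₆ : ∀ d A B A′ B′ → (A * A′ - d * (B * B′)) * (A * A′ - d * (B * B′)) + d * ((B * A′ + A * B′) * (B * A′ + A * B′))
                        ≡ (A * A + d * (B * B)) * (A′ * A′ + d * (B′ * B′))
    lemma₆ = solve-∀
    lemma₇ : ∀ k q z → k * q * z ≡ k * z * q
    lemma₇ = solve-∀
    product : (B * A′ - A * B′) * (B * A′ + A * B′) ≡ + k * + q * (B * B - B′ * B′)
    product = trans (lemma₃ (+ d) A B A′ B′) (trans (cong₂ (λ x y → x * (B * B) - y * (B′ * B′)) e₂ e₁) (lemma₄ (+ k * + q) (B * B) (B′ * B′)))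
    kq-zero : 0ℤ ≡ + k * + q * (B * B - B′ * B′) → B * B - B′ * B′ ≡ 0ℤ
    kq-zero e = [ (λ z → ⊥-elim (kq≢0 z)) , (λ z → z) ]′ (i*j≡0⇒i≡0∨j≡0 (+ k * + q) (sym e))
      where
      kq≢0 : + k * + q ≢ 0ℤ
      kq≢0 z = [ (λ k≡0 → ℕ.≢-nonZero⁻¹ k (ℤₚ.+-injective k≡0)) , (λ q≡0 → ℕ.≢-nonZero⁻¹ q {{prime⇒nonZero q-prime}} (ℤₚ.+-injective q≡0)) ]′ (i*j≡0⇒i≡0∨j≡0 (+ k) z)
    B²-B′² : B * B - B′ * B′ ≡ 0ℤ
    B²-B′² = [ (λ q∣ → kq-zero (trans (sym (cong (_* (B * A′ + A * B′)) (multiple-zero (B * A′ - A * B′) (A * A′ + + d * (B * B′)) q∣ (trans (lemma₅ (+ d) A B A′ B′) (cong₂ _*_ e₁ e₂))))) product))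
            , (λ q∣ → kq-zero (trans (sym (trans (cong ((B * A′ - A * B′) *_) (multiple-zero (B * A′ + A * B′) (A * A′ - + d * (B * B′)) q∣ (trans (lemma₆ (+ d) A B A′ B′) (cong₂ _*_ e₁ e₂)))) (*-zeroʳ (B * A′ - A * B′)))) product))
            ]′ (euclid q-prime (B * A′ - A * B′) (B * A′ + A * B′) (Signed.divides (+ k * (B * B - B′ * B′)) (trans product (lemma₇ (+ k) (+ q) (B * B - B′ * B′)))))

-- Congruences modulo an integer

module Congruence (M : ℤ) where

  infix 4 _≈_ _≉_ _≈?_
  infixl 7 _⟨*⟩_
  infixl 6 _⟨+⟩_ _⟨-⟩_

  -- The explicit quotient makes every compatibility law a ring identity.
  record _≈_ (a b : ℤ) : Set where
    constructor congruent
    field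
      quotient : ℤ
      equality : a ≡ b + quotient * M

  _≉_ : ℤ → ℤ → Set
  a ≉ b = ¬ (a ≈ b)

  ≡⇒≈ : ∀ {a b} → a ≡ b → a ≈ b
  ≡⇒≈ {a} refl = congruent 0ℤ (sym (+-identityʳ a))

  ≈-refl : ∀ {a} → a ≈ a
  ≈-refl = ≡⇒≈ refl

  ≈-sym : ∀ {a b} → a ≈ b → b ≈ a
  ≈-sym {b = b} (congruent k refl) = congruent (- k) (lemma b k M)
    where
    lemma : ∀ b k m → b ≡ b + k * m + - k * m
    lemma = solve-∀

  ≈-trans : ∀ {a b c} → a ≈ b → b ≈ c → a ≈ c
  ≈-trans {c = c} (congruent k refl) (congruent l refl) = congruent (l + k) (lemma c k l M)
    where
    lemma : ∀ c k l m → c + l * m + k * m ≡ c + (l + k) * m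
    lemma = solve-∀

  ≈-setoid : Setoid _ _
  ≈-setoid = record
    { Carrier = ℤ ; _≈_ = _≈_
    ; isEquivalence = record { refl = ≈-refl ; sym = ≈-sym ; trans = ≈-trans } }

  _⟨+⟩_ : ∀ {a b c d} → a ≈ b → c ≈ d → a + c ≈ b + d
  _⟨+⟩_ {b = b} {d = d} (congruent k refl) (congruent l refl) = congruent (k + l) (lemma b d k l M)
    where
    lemma : ∀ b d k l m → b + k * m + (d + l * m) ≡ b + d + (k + l) * m
    lemma = solve-∀

  _⟨*⟩_ : ∀ {a b c d} → a ≈ b → c ≈ d → a * c ≈ b * d
  _⟨*⟩_ {b = b} {d = d} (congruent k refl) (congruent l refl) =
    congruent (k * d + b * l + k * l * M) (lemma b d k l M)
    where
    lemma : ∀ b d k l m → (b + k * m) * (d + l * m) ≡ b * d + (k * d + b * l + k * l * m) * m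
    lemma = solve-∀

  *-≈ˡ : ∀ c {a b} → a ≈ b → c * a ≈ c * b
  *-≈ˡ c e = ≈-refl {c} ⟨*⟩ e

  *-≈ʳ : ∀ c {a b} → a ≈ b → a * c ≈ b * c
  *-≈ʳ c e = e ⟨*⟩ ≈-refl {c}

  +-≈ˡ : ∀ c {a b} → a ≈ b → c + a ≈ c + b
  +-≈ˡ c e = ≈-refl {c} ⟨+⟩ e

  +-≈ʳ : ∀ c {a b} → a ≈ b → a + c ≈ b + c
  +-≈ʳ c e = e ⟨+⟩ ≈-refl {c}

  ≈-neg : ∀ {a b} → a ≈ b → - a ≈ - b
  ≈-neg {b = b} (congruent k refl) = congruent (- k) (lemma b k M)
    where
    lemma : ∀ b k m → - (b + k * m) ≡ - b + - k * m
    lemma = solve-∀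

  _⟨-⟩_ : ∀ {a b c d} → a ≈ b → c ≈ d → a - c ≈ b - d
  e ⟨-⟩ f = e ⟨+⟩ ≈-neg f

  ≈-^ : ∀ {a b} n → a ≈ b → a ^ n ≈ b ^ n
  ≈-^ zero    e = ≈-refl
  ≈-^ (suc n) e = e ⟨*⟩ ≈-^ n e

  ≈⇒-≈0 : ∀ {a b} → a ≈ b → a - b ≈ 0ℤ
  ≈⇒-≈0 {b = b} (congruent k refl) = congruent k (lemma b (k * M))
    where
    lemma : ∀ b c → b + c - b ≡ 0ℤ + c
    lemma = solve-∀

  -≈0⇒≈ : ∀ {a b} → a - b ≈ 0ℤ → a ≈ b
  -≈0⇒≈ {a} {b} e = ≈-trans (≡⇒≈ (lemma a b)) (≈-trans (e ⟨+⟩ ≈-refl) (≡⇒≈ (+-identityˡ b)))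
    where
    lemma : ∀ a b → a ≡ a - b + b
    lemma = solve-∀

  -- The usual route to a congruence below: once a - b is exhibited as a multiple of a quantity
  -- known to vanish, only a polynomial identity remains.
  ≈-by : ∀ {a b c} e → a - b ≡ e * c → c ≈ 0ℤ → a ≈ b
  ≈-by e eq c≈0 = -≈0⇒≈ (≈-trans (≡⇒≈ eq) (≈-trans (*-≈ˡ e c≈0) (≡⇒≈ (*-zeroʳ e))))

  M≈0 : M ≈ 0ℤ
  M≈0 = congruent 1ℤ (sym (trans (+-identityˡ _) (*-identityˡ M)))

  ≈0⇒∣ : ∀ {a} → a ≈ 0ℤ → M Signed.∣ a
  ≈0⇒∣ (congruent k eq) = Signed.divides k (trans eq (+-identityˡ _))

  ∣⇒≈0 : ∀ {a} → M Signed.∣ a → a ≈ 0ℤ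
  ∣⇒≈0 (Signed.divides k eq) = congruent k (trans eq (sym (+-identityˡ _)))

  _≈?_ : ∀ a b → Dec (a ≈ b)
  a ≈? b with M Signed.∣? (a - b)
  ... | yes d = yes (-≈0⇒≈ (∣⇒≈0 d))
  ... | no ¬d = no (λ e → ¬d (≈0⇒∣ (≈⇒-≈0 e)))

  *-≈0ˡ : ∀ c {a} → a ≈ 0ℤ → c * a ≈ 0ℤ
  *-≈0ˡ c e = ≈-trans (*-≈ˡ c e) (≡⇒≈ (*-zeroʳ c))

  by-cases : ∀ {Q : Set} a → (a ≈ 0ℤ → Q) → (a ≉ 0ℤ → Q) → Q
  by-cases a f g with a ≈? 0ℤ
  ... | yes e = f e
  ... | no ne = g ne

  ∑-≈ : ∀ n {f g} → (∀ i → i ℕ.< n → f i ≈ g i) → ∑ n f ≈ ∑ n g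
  ∑-≈ zero    e = ≈-refl
  ∑-≈ (suc n) e = ∑-≈ n (λ i i<n → e i (ℕₚ.m<n⇒m<1+n i<n)) ⟨+⟩ e n (ℕₚ.n<1+n n)

  ∑-≈0 : ∀ n {f} → (∀ i → i ℕ.< n → f i ≈ 0ℤ) → ∑ n f ≈ 0ℤ
  ∑-≈0 n e = ≈-trans (∑-≈ n e) (≡⇒≈ (∑-zero n))

  ∑-≈-single : ∀ n f i → i ℕ.< n → (∀ j → j ℕ.< n → j ≢ i → f j ≈ 0ℤ) → ∑ n f ≈ f i
  ∑-≈-single (suc n) f i i<1+n z with i ℕ.≟ n
  ... | yes refl = ≈-trans (∑-≈0 n (λ j j<n → z j (ℕₚ.m<n⇒m<1+n j<n) (ℕₚ.<⇒≢ j<n)) ⟨+⟩ ≈-refl) (≡⇒≈ (+-identityˡ (f n)))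
  ... | no i≢n = ≈-trans
          (∑-≈-single n f i (ℕₚ.≤∧≢⇒< (ℕ.s≤s⁻¹ i<1+n) i≢n) (λ j j<n → z j (ℕₚ.m<n⇒m<1+n j<n))
            ⟨+⟩ z n (ℕₚ.n<1+n n) (λ n≡i → i≢n (sym n≡i)))
          (≡⇒≈ (+-identityʳ (f i)))

-- Arithmetic modulo a prime p > 3

module ModuloPrime (p : ℕ) (p-prime : Prime p) (p>3 : p ℕ.> 3) where

  open Congruence (+ p)
  open import Relation.Binary.Reasoning.Setoid ≈-setoid

  instance
    p-nonZero : ℕ.NonZero p
    p-nonZero = prime⇒nonZero p-prime

  p≡1+[p∸1] : p ≡ suc (p ∸ 1)
  p≡1+[p∸1] = sym (ℕₚ.m+[n∸m]≡n (ℕₚ.≤-trans (s≤s z≤n) p>3))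

  p∸1<p : p ∸ 1 ℕ.< p
  p∸1<p = ℕₚ.≤-reflexive (sym p≡1+[p∸1])

  ≈0-small : ∀ {a} → ∣ a ∣ ℕ.< p → a ≈ 0ℤ → a ≡ 0ℤ
  ≈0-small {a} a<p a≈0 with ∣ a ∣ in eq
  ... | zero  = ℤₚ.∣i∣≡0⇒i≡0 eq
  ... | suc k = ⊥-elim (ℕₚ.<⇒≱ a<p (ℕd.∣⇒≤ (subst (p ℕd.∣_) eq (Signed.∣⇒∣ᵤ (≈0⇒∣ a≈0)))))

  +-≉0 : ∀ {k} → 0 ℕ.< k → k ℕ.< p → + k ≉ 0ℤ
  +-≉0 {k} 0<k k<p e = ℕₚ.<⇒≢ 0<k (sym (ℤₚ.+-injective (≈0-small k<p e)))

  1≉0 : 1ℤ ≉ 0ℤ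
  1≉0 = +-≉0 (s≤s z≤n) (ℕₚ.≤-trans (s≤s (s≤s z≤n)) p>3)

  2≉0 : + 2 ≉ 0ℤ
  2≉0 = +-≉0 (s≤s z≤n) (ℕₚ.≤-trans (s≤s (s≤s (s≤s z≤n))) p>3)

  3≉0 : + 3 ≉ 0ℤ
  3≉0 = +-≉0 (s≤s z≤n) p>3

  +-injective-≈ : ∀ {i j} → i ℕ.< p → j ℕ.< p → + i ≈ + j → i ≡ j
  +-injective-≈ {i} {j} i<p j<p e =
    ℤₚ.+-injective (i-j≡0⇒i≡j (+ i) (+ j) (≈0-small small (≈⇒-≈0 e)))
    where
    small : ∣ + i - + j ∣ ℕ.< p
    small = subst (ℕ._< p) (cong ∣_∣ (sym (ℤₚ.[+m]-[+n]≡m⊖n i j)))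
      (ℕₚ.≤-<-trans (ℤₚ.∣m⊝n∣≤m⊔n i j) (ℕₚ.⊔-lub i<p j<p))

  *-≈0 : ∀ a b → a * b ≈ 0ℤ → a ≈ 0ℤ ⊎ b ≈ 0ℤ
  *-≈0 a b e with euclidsLemma ∣ a ∣ ∣ b ∣ p-prime (subst (p ℕd.∣_) (ℤₚ.abs-* a b) (Signed.∣⇒∣ᵤ (≈0⇒∣ e)))
  ... | inj₁ d = inj₁ (∣⇒≈0 (Signed.∣ᵤ⇒∣ d))
  ... | inj₂ d = inj₂ (∣⇒≈0 (Signed.∣ᵤ⇒∣ d))

  *-≈0-right : ∀ a b → a ≉ 0ℤ → a * b ≈ 0ℤ → b ≈ 0ℤ
  *-≈0-right a b a≉0 e with *-≈0 a b e
  ... | inj₁ a≈0 = ⊥-elim (a≉0 a≈0)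
  ... | inj₂ b≈0 = b≈0

  *-≉0 : ∀ {a b} → a ≉ 0ℤ → b ≉ 0ℤ → a * b ≉ 0ℤ
  *-≉0 {a} {b} a≉0 b≉0 e with *-≈0 a b e
  ... | inj₁ a≈0 = a≉0 a≈0
  ... | inj₂ b≈0 = b≉0 b≈0

  4≉0 : + 4 ≉ 0ℤ
  4≉0 = *-≉0 {+ 2} {+ 2} 2≉0 2≉0

  8≉0 : + 8 ≉ 0ℤ
  8≉0 = *-≉0 {+ 2} {+ 4} 2≉0 4≉0

  9≉0 : + 9 ≉ 0ℤ
  9≉0 = *-≉0 {+ 3} {+ 3} 3≉0 3≉0

  -1≉0 : - 1ℤ ≉ 0ℤ
  -1≉0 e = 1≉0 (≈-neg e)

  ^-≉0 : ∀ {a} n → a ≉ 0ℤ → a ^ n ≉ 0ℤ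
  ^-≉0 zero    a≉0 = 1≉0
  ^-≉0 {a} (suc n) a≉0 = *-≉0 {a} {a ^ n} a≉0 (^-≉0 n a≉0)

  *-cancelˡ-≈ : ∀ c {a b} → c ≉ 0ℤ → c * a ≈ c * b → a ≈ b
  *-cancelˡ-≈ c {a} {b} c≉0 e = -≈0⇒≈ (*-≈0-right c (a - b) c≉0 (≈-trans (≡⇒≈ (lemma c a b)) (≈⇒-≈0 e)))
    where
    lemma : ∀ c a b → c * (a - b) ≡ c * a - c * b
    lemma = solve-∀

  ≉0-resp : ∀ {a b} → a ≈ b → a ≉ 0ℤ → b ≉ 0ℤ
  ≉0-resp e a≉0 b≈0 = a≉0 (≈-trans e b≈0)

  residue : ℤ → ℕ
  residue a = a %ℕ p

  residue<p : ∀ a → residue a ℕ.< p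
  residue<p a = n%ℕd<d a p

  residue≈ : ∀ a → a ≈ + residue a
  residue≈ a = congruent (a /ℕ p) (a≡a%ℕn+[a/ℕn]*n a p)

  fact-≉0 : ∀ k → k ℕ.< p → fact k ≉ 0ℤ
  fact-≉0 zero    k<p = 1≉0
  fact-≉0 (suc k) k<p = *-≉0 {fact k} {+ suc k} (fact-≉0 k (ℕₚ.<-trans (ℕₚ.n<1+n k) k<p)) (+-≉0 (s≤s z≤n) k<p)

  -- The falling factorial k! C(p, k) contains the factor p, while k! is prime to p.
  bin-p : ∀ {k} → 0 ℕ.< k → k ℕ.< p → bin p k ≈ 0ℤ
  bin-p {k@(suc j)} 0<k k<p = *-≈0-right (fact k) (bin p k) (fact-≉0 k k<p) (≈-trans (≡⇒≈ (fact-bin p k)) (ff-p j))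
    where
    ff-p : ∀ j → ff (+ p) (suc j) ≈ 0ℤ
    ff-p zero = ≈-trans (≡⇒≈ (lemma (+ p))) M≈0
      where
      lemma : ∀ a → 1ℤ * (a - 0ℤ) ≡ a
      lemma = solve-∀
    ff-p (suc j) = *-≈ʳ (+ p - + suc j) (ff-p j)

  frobenius : ∀ x → (x + 1ℤ) ^ p ≈ x ^ p + 1ℤ
  frobenius x = begin
    (x + 1ℤ) ^ p ≡⟨ binomial-theorem x 1ℤ p ⟩
    ∑ p f + f p ≈⟨ first ⟨+⟩ ≡⇒≈ last ⟩
    1ℤ + x ^ p ≡⟨ ℤₚ.+-comm 1ℤ (x ^ p) ⟩
    x ^ p + 1ℤ           ∎
    where
    f : ℕ → ℤ
    f k = bin p k * (x ^ k * 1ℤ ^ (p ∸ k))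
    f0 : f 0 ≡ 1ℤ
    f0 = cong₂ (λ a b → a * (1ℤ * b)) (bin-zero p) (^-zeroˡ p)
    last : f p ≡ x ^ p
    last = trans (cong₂ _*_ (bin-diag p) (cong (x ^ p *_) (^-zeroˡ (p ∸ p)))) (trans (*-identityˡ _) (*-identityʳ _))
    first : ∑ p f ≈ 1ℤ
    first = ≈-trans (∑-≈-single p f 0 (ℕₚ.≤-trans (s≤s z≤n) p>3)
              (λ j j<p j≢0 → *-≈ʳ (x ^ j * 1ℤ ^ (p ∸ j)) (bin-p (ℕₚ.n≢0⇒n>0 j≢0) j<p)))
            (≡⇒≈ f0)

  fermat : ∀ a → a ^ p ≈ a
  fermat a = ≈-trans (≈-^ p (residue≈ a)) (≈-trans (nat (residue a)) (≈-sym (residue≈ a)))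
    where
    nat : ∀ n → (+ n) ^ p ≈ + n
    nat zero = ≡⇒≈ (subst (λ k → 0ℤ ^ k ≡ 0ℤ) (sym p≡1+[p∸1]) refl)
    nat (suc n) = begin
      (+ suc n) ^ p ≡⟨ cong (_^ p) (ℤₚ.+-comm 1ℤ (+ n)) ⟩
      (+ n + 1ℤ) ^ p  ≈⟨ frobenius (+ n) ⟩
      (+ n) ^ p + 1ℤ  ≈⟨ +-≈ʳ 1ℤ (nat n) ⟩
      + n + 1ℤ ≡⟨ ℤₚ.+-comm (+ n) 1ℤ ⟩
      + suc n         ∎

  fermat-unit : ∀ {a} → a ≉ 0ℤ → a ^ (p ∸ 1) ≈ 1ℤ
  fermat-unit {a} a≉0 = *-cancelˡ-≈ a a≉0 (begin
    a * a ^ (p ∸ 1)  ≡⟨ cong (a ^_) (sym p≡1+[p∸1]) ⟩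
    a ^ p ≈⟨ fermat a ⟩
    a ≡⟨ sym (*-identityʳ a) ⟩
    a * 1ℤ           ∎)

  inv : ℤ → ℤ
  inv a = a ^ (p ∸ 2)

  *-inv : ∀ {a} → a ≉ 0ℤ → a * inv a ≈ 1ℤ
  *-inv {a} a≉0 = ≈-trans (≡⇒≈ (cong (a ^_) (sym (ℕₚ.+-∸-assoc 1 (ℕₚ.≤-trans (s≤s (s≤s z≤n)) p>3))))) (fermat-unit a≉0)

  inv-≉0 : ∀ {a} → a ≉ 0ℤ → inv a ≉ 0ℤ
  inv-≉0 a≉0 = ^-≉0 (p ∸ 2) a≉0

  -- Indicators and sums over residue classes

  abstract
    -- Integer-valued, so that sums of `δ` are exact numbers of solutions and not just their
    -- residues.
    δ : ℤ → ℤ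
    δ a with a ≈? 0ℤ
    ... | yes _ = 1ℤ
    ... | no  _ = 0ℤ

    δ-one : ∀ {a} → a ≈ 0ℤ → δ a ≡ 1ℤ
    δ-one {a} a≈0 with a ≈? 0ℤ
    ... | yes _ = refl
    ... | no  a≉0 = ⊥-elim (a≉0 a≈0)

    δ-zero : ∀ {a} → a ≉ 0ℤ → δ a ≡ 0ℤ
    δ-zero {a} a≉0 with a ≈? 0ℤ
    ... | yes a≈0 = ⊥-elim (a≉0 a≈0)
    ... | no  _ = refl

  δ-iff : ∀ {a b} → (a ≈ 0ℤ → b ≈ 0ℤ) → (b ≈ 0ℤ → a ≈ 0ℤ) → δ a ≡ δ b
  δ-iff {a} {b} f g with a ≈? 0ℤ
  ... | yes a≈0 = trans (δ-one a≈0) (sym (δ-one (f a≈0)))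
  ... | no  a≉0 = trans (δ-zero a≉0) (sym (δ-zero (λ b≈0 → a≉0 (g b≈0))))

  δ-resp : ∀ {a b} → a ≈ b → δ a ≡ δ b
  δ-resp e = δ-iff (≈-trans (≈-sym e)) (≈-trans e)

  δ-scale : ∀ {a} c → c ≉ 0ℤ → δ (c * a) ≡ δ a
  δ-scale {a} c c≉0 = δ-iff (λ e → *-cancelˡ-≈ c c≉0 (≈-trans e (≡⇒≈ (sym (*-zeroʳ c)))))
                            (λ e → *-≈0ˡ c e)

  δ-product : ∀ a b → (a ≈ 0ℤ → b ≉ 0ℤ) → δ (a * b) ≡ δ a + δ b
  δ-product a b disjoint with a ≈? 0ℤ
  ... | yes a≈0 = trans (δ-one (*-≈ʳ b a≈0)) (sym (cong₂ _+_ (δ-one a≈0) (δ-zero (disjoint a≈0))))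
  ... | no  a≉0 = trans (δ-scale a a≉0) (sym (trans (cong (_+ δ b) (δ-zero a≉0)) (+-identityˡ (δ b))))

  -- These are the functions on residue classes; for them `Σₚ` is independent of the choice of
  -- representatives.
  Respects : (ℤ → ℤ) → Set
  Respects f = ∀ {a b} → a ≈ b → f a ≡ f b

  abstract
    Σₚ : (ℤ → ℤ) → ℤ
    Σₚ f = ∑ p (λ x → f (+ x))

    Σₚ-def : ∀ f → Σₚ f ≡ ∑ p (λ x → f (+ x))
    Σₚ-def f = refl

    Σₚ-ext : ∀ {f g} → (∀ x → f x ≡ g x) → Σₚ f ≡ Σₚ g
    Σₚ-ext e = ∑-ext p (λ i → e (+ i))

    Σₚ-≈ : ∀ {f g} → (∀ x → f x ≈ g x) → Σₚ f ≈ Σₚ g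
    Σₚ-≈ e = ∑-≈ p (λ i _ → e (+ i))

    Σₚ-swap : ∀ (f : ℤ → ℤ → ℤ) → Σₚ (λ x → Σₚ (λ y → f x y)) ≡ Σₚ (λ y → Σₚ (λ x → f x y))
    Σₚ-swap f = ∑-swap p p (λ i j → f (+ i) (+ j))

    Σₚ-+ : ∀ f g → Σₚ (λ x → f x + g x) ≡ Σₚ f + Σₚ g
    Σₚ-+ f g = ∑-distrib-+ p (λ i → f (+ i)) (λ i → g (+ i))

    Σₚ-*ˡ : ∀ c f → Σₚ (λ x → c * f x) ≡ c * Σₚ f
    Σₚ-*ˡ c f = sym (*-distribˡ-∑ c p (λ i → f (+ i)))

    Σₚ-*ʳ : ∀ c f → Σₚ (λ x → f x * c) ≡ Σₚ f * c
    Σₚ-*ʳ c f = sym (*-distribʳ-∑ c p (λ i → f (+ i)))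

    Σₚ-const : ∀ c → Σₚ (λ _ → c) ≡ + p * c
    Σₚ-const c = ∑-const p c

    Σₚ-∑ : ∀ n (f : ℕ → ℤ → ℤ) → Σₚ (λ x → ∑ n (λ j → f j x)) ≡ ∑ n (λ j → Σₚ (f j))
    Σₚ-∑ n f = ∑-swap p n (λ i j → f j (+ i))

    Σₚ-nonneg-zero : ∀ f → (∀ x → 0ℤ ℤ.≤ f x) → Respects f → Σₚ f ≡ 0ℤ → ∀ x → f x ≡ 0ℤ
    Σₚ-nonneg-zero f f≥0 f-resp e x =
      trans (f-resp (residue≈ x)) (∑-nonneg-zero p (λ i → f (+ i)) (λ i → f≥0 (+ i)) e (residue x) (residue<p x))

    -- The sifting property of `δ`, on which grouping by values and changes of variables rest.
    Σₚ-pick : ∀ f → Respects f → ∀ a → Σₚ (λ x → δ (x - a) * f x) ≡ f a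
    Σₚ-pick f f-resp a = trans
      (∑-single p (λ i → δ (+ i - a) * f (+ i)) (residue a) (residue<p a)
        (λ j j<p j≢r → trans (cong (_* f (+ j)) (δ-zero (λ e →
           j≢r (+-injective-≈ j<p (residue<p a) (≈-trans (-≈0⇒≈ e) (residue≈ a)))))) (*-zeroˡ (f (+ j)))))
      (trans (cong₂ _*_ (δ-one (≈⇒-≈0 (≈-sym (residue≈ a)))) (f-resp (≈-sym (residue≈ a)))) (*-identityˡ (f a)))

  Σₚ-δ : ∀ a → Σₚ (λ x → δ (x - a)) ≡ 1ℤ
  Σₚ-δ a = trans (Σₚ-ext (λ x → sym (*-identityʳ (δ (x - a))))) (Σₚ-pick (λ _ → 1ℤ) (λ _ → refl) a)

  Σₚ-δ0 : Σₚ δ ≡ 1ℤ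
  Σₚ-δ0 = trans (Σₚ-ext (λ x → δ-resp (≡⇒≈ (sym (+-identityʳ x))))) (Σₚ-δ 0ℤ)

  -- Instead of permuting the range, f (σ x) is written as a `δ`-sum over y. After the sums are
  -- exchanged, the condition y = σ x reads x = τ y and is met exactly once.
  Σₚ-reindex : ∀ f (σ τ : ℤ → ℤ) → Respects f →
    (∀ {a b} → a ≈ b → σ a ≈ σ b) → (∀ {a b} → a ≈ b → τ a ≈ τ b) →
    (∀ a → σ (τ a) ≈ a) → (∀ a → τ (σ a) ≈ a) → Σₚ (λ x → f (σ x)) ≡ Σₚ f
  Σₚ-reindex f σ τ f-resp σ-resp τ-resp στ τσ = ≡.begin
    Σₚ (λ x → f (σ x)) ≡.≡⟨ Σₚ-ext (λ x → sym (Σₚ-pick f f-resp (σ x))) ⟩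
    Σₚ (λ x → Σₚ (λ y → δ (y - σ x) * f y)) ≡.≡⟨ Σₚ-swap (λ x y → δ (y - σ x) * f y) ⟩
    Σₚ (λ y → Σₚ (λ x → δ (y - σ x) * f y)) ≡.≡⟨ Σₚ-ext (λ y → Σₚ-*ʳ (f y) (λ x → δ (y - σ x))) ⟩
    Σₚ (λ y → Σₚ (λ x → δ (y - σ x)) * f y) ≡.≡⟨ Σₚ-ext (λ y → cong (_* f y) (trans (Σₚ-ext (λ x → flip x y)) (Σₚ-δ (τ y)))) ⟩
    Σₚ (λ y → 1ℤ * f y) ≡.≡⟨ Σₚ-ext (λ y → *-identityˡ (f y)) ⟩
    Σₚ f ≡.∎
    where
    module ≡ = ≡-Reasoning
    flip : ∀ x y → δ (y - σ x) ≡ δ (x - τ y)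
    flip x y = δ-iff (λ e → ≈⇒-≈0 (≈-trans (≈-sym (τσ x)) (τ-resp (≈-sym (-≈0⇒≈ e)))))
                     (λ e → ≈⇒-≈0 (≈-trans (≈-sym (στ y)) (σ-resp (≈-sym (-≈0⇒≈ e)))))

  Σₚ-affine : ∀ f a b → Respects f → a ≉ 0ℤ → Σₚ (λ x → f (a * x + b)) ≡ Σₚ f
  Σₚ-affine f a b f-resp a≉0 = Σₚ-reindex f (λ x → a * x + b) (λ y → inv a * (y - b)) f-resp
    (λ e → +-≈ʳ b (*-≈ˡ a e)) (λ e → *-≈ˡ (inv a) (+-≈ʳ (- b) e))
    (λ y → ≈-by (y - b) (lemma₁ a (inv a) y b) (≈⇒-≈0 (*-inv a≉0)))
    (λ y → ≈-by y (lemma₂ a (inv a) y b) (≈⇒-≈0 (*-inv a≉0)))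
    where
    lemma₁ : ∀ a i y b → a * (i * (y - b)) + b - y ≡ (y - b) * (a * i - 1ℤ)
    lemma₁ = solve-∀
    lemma₂ : ∀ a i y b → i * (a * y + b - b) - y ≡ y * (a * i - 1ℤ)
    lemma₂ = solve-∀

  Σₚ-scale : ∀ f a → Respects f → a ≉ 0ℤ → Σₚ (λ x → f (a * x)) ≡ Σₚ f
  Σₚ-scale f a f-resp a≉0 = trans (Σₚ-ext (λ x → f-resp (≡⇒≈ (sym (+-identityʳ (a * x)))))) (Σₚ-affine f a 0ℤ f-resp a≉0)

  Σₚ-shift : ∀ f b → Respects f → Σₚ (λ x → f (x + b)) ≡ Σₚ f
  Σₚ-shift f b f-resp = trans (Σₚ-ext (λ x → f-resp (+-≈ʳ b (≡⇒≈ (sym (*-identityˡ x)))))) (Σₚ-affine f 1ℤ b f-resp 1≉0)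

  -- Here f preserves congruence only up to congruence; replacing its values by their residues gives
  -- a function on classes in the strict sense.
  Σₚ-affine-≈ : ∀ f a b → (∀ {x y} → x ≈ y → f x ≈ f y) → a ≉ 0ℤ → Σₚ (λ x → f (a * x + b)) ≈ Σₚ f
  Σₚ-affine-≈ f a b f-resp a≉0 = begin
    Σₚ (λ x → f (a * x + b)) ≈⟨ Σₚ-≈ (λ x → residue≈ (f (a * x + b))) ⟩
    Σₚ (λ x → + residue (f (a * x + b)))  ≡⟨ Σₚ-affine (λ x → + residue (f x)) a b resp a≉0 ⟩
    Σₚ (λ x → + residue (f x)) ≈⟨ Σₚ-≈ (λ x → ≈-sym (residue≈ (f x))) ⟩
    Σₚ f                                  ∎
    where
    resp : Respects (λ x → + residue (f x))
    resp {x} {y} e = cong +_ (+-injective-≈ (residue<p (f x)) (residue<p (f y))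
      (≈-trans (≈-sym (residue≈ (f x))) (≈-trans (f-resp e) (residue≈ (f y)))))

  -- Power sums and extraction of coefficients

  powerSum : ℕ → ℤ
  powerSum k = Σₚ (_^ k)

  bin-suc-diag : ∀ k → bin (suc k) k ≡ + suc k
  bin-suc-diag zero = bin-zero 1
  bin-suc-diag (suc k) = trans (bin-suc (suc k) k)
    (trans (cong₂ _+_ (bin-suc-diag k) (bin-diag (suc k))) (cong +_ (ℕₚ.+-comm (suc k) 1)))

  -- Telescoping (x + 1)ᵏ⁺¹ − xᵏ⁺¹ over x < p.
  powerSum-recursion : ∀ k → ∑ (suc k) (λ j → bin (suc k) j * powerSum j) ≈ 0ℤ
  powerSum-recursion k = begin
    ∑ (suc k) (λ j → bin (suc k) j * powerSum j)
      ≡⟨ ∑-ext (suc k) (λ j → sym (Σₚ-*ˡ (bin (suc k) j) (_^ j))) ⟩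
    ∑ (suc k) (λ j → Σₚ (λ x → bin (suc k) j * x ^ j))
      ≡⟨ sym (Σₚ-∑ (suc k) (λ j x → bin (suc k) j * x ^ j)) ⟩
    Σₚ (λ x → ∑ (suc k) (λ j → bin (suc k) j * x ^ j))
      ≡⟨ Σₚ-def _ ⟩
    ∑ p (λ i → ∑ (suc k) (λ j → bin (suc k) j * (+ i) ^ j))
      ≡⟨ ∑-ext p (λ i → step (+ i)) ⟩
    ∑ p (λ i → (1ℤ + + i) ^ suc k - (+ i) ^ suc k)
      ≡⟨ ∑-telescope p (λ i → (+ i) ^ suc k) ⟩
    (+ p) ^ suc k - 0ℤ ^ suc k
      ≈⟨ ≈-^ (suc k) M≈0 ⟨-⟩ ≈-refl {0ℤ ^ suc k} ⟩
    0ℤ ^ suc k - 0ℤ ^ suc k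
      ≡⟨ +-inverseʳ (0ℤ ^ suc k) ⟩
    0ℤ ∎
    where
    step : ∀ x → ∑ (suc k) (λ j → bin (suc k) j * x ^ j) ≡ (1ℤ + x) ^ suc k - x ^ suc k
    step x = sym (≡.begin
      (1ℤ + x) ^ suc k - x ^ suc k
        ≡.≡⟨ cong (λ z → z ^ suc k - x ^ suc k) (ℤₚ.+-comm 1ℤ x) ⟩
      (x + 1ℤ) ^ suc k - x ^ suc k
        ≡.≡⟨ cong (_- x ^ suc k) (binomial-theorem x 1ℤ (suc k)) ⟩
      ∑ (suc k) f + f (suc k) - x ^ suc k
        ≡.≡⟨ cong₂ (λ a b → a + b - x ^ suc k) (∑-ext (suc k) (λ j → cong (bin (suc k) j *_) (unit j)))
              (trans (cong₂ _*_ (bin-diag (suc k)) (unit (suc k))) (*-identityˡ _)) ⟩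
      ∑ (suc k) (λ j → bin (suc k) j * x ^ j) + x ^ suc k - x ^ suc k
        ≡.≡⟨ lemma (∑ (suc k) (λ j → bin (suc k) j * x ^ j)) (x ^ suc k) ⟩
      ∑ (suc k) (λ j → bin (suc k) j * x ^ j) ≡.∎)
      where
      module ≡ = ≡-Reasoning
      f : ℕ → ℤ
      f j = bin (suc k) j * (x ^ j * 1ℤ ^ (suc k ∸ j))
      unit : ∀ j → x ^ j * 1ℤ ^ (suc k ∸ j) ≡ x ^ j
      unit j = trans (cong (x ^ j *_) (^-zeroˡ (suc k ∸ j))) (*-identityʳ (x ^ j))
      lemma : ∀ a b → a + b - b ≡ a
      lemma = solve-∀

  -- In the recursion the terms below k vanish by induction, which leaves (k + 1) times the sum of
  -- k-th powers, and k + 1 < p is a unit. With 0⁰ = 1 the case k = 0 is included.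
  powerSum-small : ∀ k → k ℕ.< p ∸ 1 → powerSum k ≈ 0ℤ
  powerSum-small = <-rec _ rec
    where
    rec : ∀ k → (∀ {j} → j ℕ.< k → j ℕ.< p ∸ 1 → powerSum j ≈ 0ℤ) → k ℕ.< p ∸ 1 → powerSum k ≈ 0ℤ
    rec k ih k<d = *-≈0-right (+ suc k) (powerSum k) (+-≉0 (s≤s z≤n) (subst (suc k ℕ.<_) (sym p≡1+[p∸1]) (s≤s k<d))) (begin
        + suc k * powerSum k
          ≡⟨ cong (_* powerSum k) (sym (bin-suc-diag k)) ⟩
        bin (suc k) k * powerSum k
          ≡⟨ sym (+-identityˡ (bin (suc k) k * powerSum k)) ⟩
        0ℤ + bin (suc k) k * powerSum k
          ≈⟨ +-≈ʳ (bin (suc k) k * powerSum k) (≈-sym lower) ⟩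
        ∑ (suc k) (λ j → bin (suc k) j * powerSum j)
          ≈⟨ powerSum-recursion k ⟩
        0ℤ ∎)
      where
      lower : ∑ k (λ j → bin (suc k) j * powerSum j) ≈ 0ℤ
      lower = ∑-≈0 k (λ j j<k →
               *-≈0ˡ (bin (suc k) j) (ih j<k (ℕₚ.<-trans j<k k<d)))

  1<p∸1 : 1 ℕ.< p ∸ 1
  1<p∸1 = ℕₚ.∸-monoˡ-≤ 1 (ℕₚ.<⇒≤ p>3)

  ^-[p∸1] : ∀ x → x ^ (p ∸ 1) ≈ 1ℤ - δ x
  ^-[p∸1] x with x ≈? 0ℤ
  ... | yes e = ≈-trans (≈-^ (p ∸ 1) e) (≡⇒≈ (trans (zero^ (ℕₚ.<⇒≤ 1<p∸1)) (sym (cong (_-_ 1ℤ) (δ-one e)))))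
    where
    zero^ : ∀ {n} → 0 ℕ.< n → 0ℤ ^ n ≡ 0ℤ
    zero^ (s≤s _) = refl
  ... | no ne = ≈-trans (fermat-unit ne) (≡⇒≈ (sym (cong (_-_ 1ℤ) (δ-zero ne))))

  powerSum-[p∸1] : powerSum (p ∸ 1) ≈ - 1ℤ
  powerSum-[p∸1] = begin
    Σₚ (_^ (p ∸ 1)) ≈⟨ Σₚ-≈ ^-[p∸1] ⟩
    Σₚ (λ x → 1ℤ - δ x) ≡⟨ Σₚ-+ (λ _ → 1ℤ) (λ x → - δ x) ⟩
    Σₚ (λ _ → 1ℤ) + Σₚ (λ x → - δ x)
      ≡⟨ cong₂ _+_ (Σₚ-const 1ℤ) (trans (Σₚ-ext (λ x → sym (-1*i≡-i (δ x)))) (trans (Σₚ-*ˡ (- 1ℤ) δ) (cong ((- 1ℤ) *_) Σₚ-δ0))) ⟩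
    + p * 1ℤ + - 1ℤ ≈⟨ +-≈ʳ (- 1ℤ) (*-≈ʳ 1ℤ M≈0) ⟩
    - 1ℤ                        ∎

  -- The exponents are positive because 0⁰ and 0^(p-1) differ.
  powerSum-periodic : ∀ k → powerSum ((p ∸ 1) ℕ.+ suc k) ≈ powerSum (suc k)
  powerSum-periodic k = Σₚ-≈ (λ x → begin
    x ^ ((p ∸ 1) ℕ.+ suc k)  ≡⟨ cong (x ^_) (trans (ℕₚ.+-suc (p ∸ 1) k) (cong (ℕ._+ k) (sym p≡1+[p∸1]))) ⟩
    x ^ (p ℕ.+ k) ≡⟨ ^-distribˡ-+-* x p k ⟩
    x ^ p * x ^ k ≈⟨ *-≈ʳ (x ^ k) (fermat x) ⟩
    x ^ suc k                ∎)

  -- A power sum survives only at positive multiples of p - 1, and p - 1 is the only one below 2 (p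
  -- - 1).
  powerSum-zero : ∀ k → k ℕ.< (p ∸ 1) ℕ.+ (p ∸ 1) → k ≢ p ∸ 1 → powerSum k ≈ 0ℤ
  powerSum-zero k k<2d k≢d with ℕₚ.<-cmp k (p ∸ 1)
  ... | tri< k<d _ _ = powerSum-small k k<d
  ... | tri≈ _ k≡d _ = ⊥-elim (k≢d k≡d)
  ... | tri> _ _ d<k = subst (λ n → powerSum n ≈ 0ℤ) k-split
          (≈-trans (powerSum-periodic j) (powerSum-small (suc j) (ℕₚ.+-cancelˡ-< (p ∸ 1) (suc j) (p ∸ 1) (subst (ℕ._< _) (sym k-split) k<2d))))
    where
    j : ℕ
    j = k ∸ suc (p ∸ 1)
    k-split : (p ∸ 1) ℕ.+ suc j ≡ k
    k-split = trans (ℕₚ.+-suc (p ∸ 1) j) (ℕₚ.m+[n∸m]≡n d<k)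

  monomial-expansion : ∀ a e b α c x →
    x ^ a * (α * x ^ e + c) ^ b ≡ ∑ (suc b) (λ i → bin b i * (α ^ i * c ^ (b ∸ i)) * x ^ (a ℕ.+ e ℕ.* i))
  monomial-expansion a e b α c x = trans (cong (x ^ a *_) (binomial-theorem (α * x ^ e) c b))
    (trans (*-distribˡ-∑ (x ^ a) (suc b) _) (∑-ext (suc b) term))
    where
    lemma : ∀ x a b c d → x * (a * (b * c * d)) ≡ a * (b * d) * (x * c)
    lemma = solve-∀
    term : ∀ i → x ^ a * (bin b i * ((α * x ^ e) ^ i * c ^ (b ∸ i))) ≡ bin b i * (α ^ i * c ^ (b ∸ i)) * x ^ (a ℕ.+ e ℕ.* i)
    term i = trans (cong (λ z → x ^ a * (bin b i * (z * c ^ (b ∸ i)))) (trans (^-distribʳ-* α (x ^ e) i) (cong (α ^ i *_) (^-*-assoc x e i))))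
      (trans (lemma (x ^ a) (bin b i) (α ^ i) (x ^ (e ℕ.* i)) (c ^ (b ∸ i)))
             (cong (bin b i * (α ^ i * c ^ (b ∸ i)) *_) (sym (^-distribˡ-+-* x a (e ℕ.* i)))))

  Σₚ-expansion : ∀ a e b α c →
    Σₚ (λ x → x ^ a * (α * x ^ e + c) ^ b) ≡ ∑ (suc b) (λ i → bin b i * (α ^ i * c ^ (b ∸ i)) * powerSum (a ℕ.+ e ℕ.* i))
  Σₚ-expansion a e b α c = trans (Σₚ-ext (monomial-expansion a e b α c))
    (trans (Σₚ-∑ (suc b) (λ i x → bin b i * (α ^ i * c ^ (b ∸ i)) * x ^ (a ℕ.+ e ℕ.* i)))
           (∑-ext (suc b) (λ i → Σₚ-*ˡ (bin b i * (α ^ i * c ^ (b ∸ i))) (_^ (a ℕ.+ e ℕ.* i)))))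

  *-powerSum-zero : ∀ z k → k ℕ.< (p ∸ 1) ℕ.+ (p ∸ 1) → k ≢ p ∸ 1 → z * powerSum k ≈ 0ℤ
  *-powerSum-zero z k k<2d k≢d = *-≈0ˡ z (powerSum-zero k k<2d k≢d)

  exponent< : ∀ a e {b i} → a ℕ.+ e ℕ.* b ℕ.< (p ∸ 1) ℕ.+ (p ∸ 1) → i ℕ.< suc b → a ℕ.+ e ℕ.* i ℕ.< (p ∸ 1) ℕ.+ (p ∸ 1)
  exponent< a e bound i≤b = ℕₚ.≤-<-trans (ℕₚ.+-monoʳ-≤ a (ℕₚ.*-monoʳ-≤ e (ℕ.s≤s⁻¹ i≤b))) bound

  -- The degree is below 2 (p - 1), so only x^(p-1) contributes, with power sum -1; e ≠ 0 makes j
  -- the only index that reaches this exponent. Summation over x thus reads off a coefficient up to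
  -- sign.
  Σₚ-coefficient : ∀ a e .{{_ : ℕ.NonZero e}} b j α c → j ℕ.≤ b → a ℕ.+ e ℕ.* j ≡ p ∸ 1 →
    a ℕ.+ e ℕ.* b ℕ.< (p ∸ 1) ℕ.+ (p ∸ 1) →
    Σₚ (λ x → x ^ a * (α * x ^ e + c) ^ b) ≈ - (bin b j * (α ^ j * c ^ (b ∸ j)))
  Σₚ-coefficient a e b j α c j≤b hit bound = begin
    Σₚ (λ x → x ^ a * (α * x ^ e + c) ^ b)
      ≡⟨ Σₚ-expansion a e b α c ⟩
    ∑ (suc b) (λ i → bin b i * (α ^ i * c ^ (b ∸ i)) * powerSum (a ℕ.+ e ℕ.* i))
      ≈⟨ ∑-≈-single (suc b) _ j (s≤s j≤b) (λ i i≤b i≢j → *-powerSum-zero (bin b i * (α ^ i * c ^ (b ∸ i))) (a ℕ.+ e ℕ.* i)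
           (exponent< a e bound i≤b) (λ eq → i≢j (ℕₚ.*-cancelˡ-≡ i j e (ℕₚ.+-cancelˡ-≡ a (e ℕ.* i) (e ℕ.* j) (trans eq (sym hit)))))) ⟩
    z * powerSum (a ℕ.+ e ℕ.* j)
      ≡⟨ cong (λ n → z * powerSum n) hit ⟩
    z * powerSum (p ∸ 1)
      ≈⟨ *-≈ˡ z powerSum-[p∸1] ⟩
    z * - 1ℤ
      ≡⟨ trans (ℤₚ.*-comm z (- 1ℤ)) (-1*i≡-i z) ⟩
    - z ∎
    where
    z : ℤ
    z = bin b j * (α ^ j * c ^ (b ∸ j))

  Σₚ-no-coefficient : ∀ a e b α c → (∀ j → j ℕ.≤ b → a ℕ.+ e ℕ.* j ≢ p ∸ 1) →
    a ℕ.+ e ℕ.* b ℕ.< (p ∸ 1) ℕ.+ (p ∸ 1) →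
    Σₚ (λ x → x ^ a * (α * x ^ e + c) ^ b) ≈ 0ℤ
  Σₚ-no-coefficient a e b α c miss bound = ≈-trans (≡⇒≈ (Σₚ-expansion a e b α c))
    (∑-≈0 (suc b) (λ i i≤b → *-powerSum-zero (bin b i * (α ^ i * c ^ (b ∸ i))) (a ℕ.+ e ℕ.* i)
      (exponent< a e bound i≤b) (miss i (ℕ.s≤s⁻¹ i≤b))))

  -- From Gₙ to the sums Σ c k Tᵏ

  ∑-extend : ∀ {m n} f → m ℕ.≤ n → (∀ k → m ℕ.≤ k → f k ≡ 0ℤ) → ∑ n f ≡ ∑ m f
  ∑-extend {m} {n} f m≤n z = trans (cong (λ k → ∑ k f) (sym (ℕₚ.m∸n+n≡m m≤n))) (go (n ∸ m))
    where
    go : ∀ d → ∑ (d ℕ.+ m) f ≡ ∑ m f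
    go zero = refl
    go (suc d) = trans (cong₂ _+_ (go d) (z (d ℕ.+ m) (ℕₚ.m≤n+m m d))) (+-identityʳ (∑ m f))

  sumℤ-∑ : ∀ n f → sumℤ n f ≡ ∑ (suc n) f
  sumℤ-∑ zero    f = sym (+-identityˡ (f 0))
  sumℤ-∑ (suc n) f = cong (_+ f (suc n)) (sumℤ-∑ n f)

  pos-^ : ∀ m n → + (m ℕ.^ n) ≡ (+ m) ^ n
  pos-^ m zero = refl
  pos-^ m (suc n) = trans (pos-* m (m ℕ.^ n)) (cong (+ m *_) (pos-^ m n))

  module _ (t : ℤ) (1-t≉0 : 1ℤ - t ≉ 0ℤ) where

    -- A truncation of Σ C(n, k) tⁿ⁻ᵏ = (1 - t)^(-k-1). For k = 0 truncating multiplies by 1 - tᵖ ≡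
    -- 1 - t, and this loss of one power persists for all k < p: the value is (1 - t)⁻ᵏ modulo p.
    binomialColumn : ℕ → ℤ
    binomialColumn k = ∑ p (λ n → bin n k * t ^ (n ∸ k))

    binomialColumn-zero : binomialColumn 0 ≈ 1ℤ
    binomialColumn-zero = *-cancelˡ-≈ (1ℤ - t) 1-t≉0 (begin
      (1ℤ - t) * binomialColumn 0 ≡⟨ *-distribˡ-∑ (1ℤ - t) p (λ n → bin n 0 * t ^ n) ⟩
      ∑ p (λ n → (1ℤ - t) * (bin n 0 * t ^ n))
        ≡⟨ ∑-ext p (λ n → trans (cong (λ z → (1ℤ - t) * (z * t ^ n)) (bin-zero n)) (lemma₁ t (t ^ n))) ⟩
      ∑ p (λ n → - (t ^ suc n) - - (t ^ n)) ≡⟨ ∑-telescope p (λ n → - (t ^ n)) ⟩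
      - (t ^ p) - - 1ℤ ≈⟨ +-≈ʳ (- - 1ℤ) (≈-neg (fermat t)) ⟩
      - t - - 1ℤ ≡⟨ lemma₂ t ⟩
      (1ℤ - t) * 1ℤ                      ∎)
      where
      lemma₁ : ∀ t a → (1ℤ - t) * (1ℤ * a) ≡ - (t * a) - - a
      lemma₁ = solve-∀
      lemma₂ : ∀ t → - t - - 1ℤ ≡ (1ℤ - t) * 1ℤ
      lemma₂ = solve-∀

    -- Pascal's rule is applied to the sum shifted by one. The shift changes the sum only by the
    -- boundary term with C(p, k + 1), which vanishes modulo p.
    binomialColumn-suc : ∀ k → suc k ℕ.< p → (1ℤ - t) * binomialColumn (suc k) ≈ binomialColumn k
    binomialColumn-suc k k+1<p = begin
      (1ℤ - t) * binomialColumn (suc k)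
        ≡⟨ lemma₁ t (binomialColumn (suc k)) ⟩
      binomialColumn (suc k) - t * binomialColumn (suc k)
        ≈⟨ +-≈ʳ (- (t * binomialColumn (suc k))) (≈-sym shifted) ⟩
      ∑ p (λ n → g (suc n)) - t * binomialColumn (suc k)
        ≡⟨ cong (_- t * binomialColumn (suc k)) pascal ⟩
      binomialColumn k + t * binomialColumn (suc k) - t * binomialColumn (suc k)
        ≡⟨ lemma₂ (binomialColumn k) (t * binomialColumn (suc k)) ⟩
      binomialColumn k ∎
      where
      lemma₁ : ∀ t a → (1ℤ - t) * a ≡ a - t * a
      lemma₁ = solve-∀
      lemma₂ : ∀ a b → a + b - b ≡ a
      lemma₂ = solve-∀
      g : ℕ → ℤ
      g n = bin n (suc k) * t ^ (n ∸ suc k)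
      g-zero : g 0 ≡ 0ℤ
      g-zero = cong (_* 1ℤ) (bin-> {0} {suc k} (s≤s z≤n))
      shifted : ∑ p (λ n → g (suc n)) ≈ binomialColumn (suc k)
      shifted = begin
        ∑ p (λ n → g (suc n)) ≡⟨ sym (+-identityˡ _) ⟩
        0ℤ + ∑ p (λ n → g (suc n)) ≡⟨ cong (_+ ∑ p (λ n → g (suc n))) (sym g-zero) ⟩
        g 0 + ∑ p (λ n → g (suc n)) ≡⟨ sym (∑-head p g) ⟩
        ∑ p g + g p ≈⟨ +-≈ˡ (∑ p g) (*-≈ʳ (t ^ (p ∸ suc k)) (bin-p (s≤s z≤n) k+1<p)) ⟩
        ∑ p g + 0ℤ * t ^ (p ∸ suc k) ≡⟨ trans (cong (λ z → ∑ p g + z) (*-zeroˡ (t ^ (p ∸ suc k)))) (+-identityʳ (∑ p g)) ⟩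
        ∑ p g                          ∎
      lemma₃ : ∀ a b c → a * (b * c) ≡ b * (a * c)
      lemma₃ = solve-∀
      -- For n ≤ k truncated subtraction breaks the exponent law, but there the coefficient is zero.
      lower : ∀ n → bin n (suc k) * t ^ (n ∸ k) ≡ t * g n
      lower n with k ℕ.<? n
      ... | yes k<n = trans (cong (bin n (suc k) *_) (^-suc-∸ t k<n)) (lemma₃ (bin n (suc k)) t (t ^ (n ∸ suc k)))
      ... | no k≮n = trans (trans (cong (_* t ^ (n ∸ k)) vanish) (*-zeroˡ (t ^ (n ∸ k))))
          (sym (trans (cong (λ z → t * (z * t ^ (n ∸ suc k))) vanish) (*-zeroʳ t)))
        where
        vanish : bin n (suc k) ≡ 0ℤ
        vanish = bin-> (s≤s (ℕₚ.≮⇒≥ k≮n))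
      pascal : ∑ p (λ n → g (suc n)) ≡ binomialColumn k + t * binomialColumn (suc k)
      pascal = trans (∑-ext p (λ n → trans (cong (_* t ^ (n ∸ k)) (bin-suc n k)) (trans (ℤₚ.*-distribʳ-+ (t ^ (n ∸ k)) (bin n k) (bin n (suc k))) (cong (λ z → bin n k * t ^ (n ∸ k) + z) (lower n)))))
        (trans (∑-distrib-+ p (λ n → bin n k * t ^ (n ∸ k)) (λ n → t * g n)) (cong (λ z → binomialColumn k + z) (sym (*-distribˡ-∑ t p g))))

    binomialColumn-value : ∀ k → k ℕ.< p → (1ℤ - t) ^ k * binomialColumn k ≈ 1ℤ
    binomialColumn-value zero    k<p = ≈-trans (*-≈ˡ 1ℤ binomialColumn-zero) ≈-refl
    binomialColumn-value (suc k) k<p = begin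
      (1ℤ - t) * (1ℤ - t) ^ k * binomialColumn (suc k) ≡⟨ lemma (1ℤ - t) ((1ℤ - t) ^ k) (binomialColumn (suc k)) ⟩
      (1ℤ - t) ^ k * ((1ℤ - t) * binomialColumn (suc k))  ≈⟨ *-≈ˡ ((1ℤ - t) ^ k) (binomialColumn-suc k k<p) ⟩
      (1ℤ - t) ^ k * binomialColumn k ≈⟨ binomialColumn-value k (ℕₚ.<-trans (ℕₚ.n<1+n k) k<p) ⟩
      1ℤ                                                  ∎
      where
      lemma : ∀ a b c → a * b * c ≡ b * (a * c)
      lemma = solve-∀

  trinomial : ℕ → ℤ
  trinomial k = bin (2 ℕ.* k) k * bin (3 ℕ.* k) k

  -- J stands for 1/m. As C(n, k) = 0 for k > n, the sum can be extended to all k < p; the ranges of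
  -- n and k then become independent and the sums can be exchanged.
  G3-∑ : ∀ n → n ℕ.< p → ∀ J → G3 n * J ^ n ≡ ∑ p (λ k → (- J) ^ k * trinomial k * (bin n k * (+ 27 * J) ^ (n ∸ k)))
  G3-∑ n n<p J = trans (cong (_* J ^ n) (sumℤ-∑ n _))
    (trans (*-distribʳ-∑ (J ^ n) (suc n) _)
    (trans (∑-cong (suc n) (λ k k≤n → term k (ℕ.s≤s⁻¹ k≤n)))
    (sym (∑-extend (λ k → (- J) ^ k * trinomial k * (bin n k * (+ 27 * J) ^ (n ∸ k))) n<p
      (λ k n<k → trans (cong (λ z → (- J) ^ k * trinomial k * (z * (+ 27 * J) ^ (n ∸ k))) (bin-> n<k)) (*-zeroʳ ((- J) ^ k * trinomial k)))))))
    where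
    lemma : ∀ a s b c d e f → a * s * b * c * d * (e * f) ≡ s * f * (b * c) * (a * (d * e))
    lemma = solve-∀
    term : ∀ k → k ℕ.≤ n →
      + (n C k) * sgn k * + ((2 ℕ.* k) C k) * + ((3 ℕ.* k) C k) * + (27 ℕ.^ (n ∸ k)) * J ^ n
        ≡ (- J) ^ k * trinomial k * (bin n k * (+ 27 * J) ^ (n ∸ k))
    term k k≤n = ≡.begin
      N * sgn k * c₂ * c₃ * + (27 ℕ.^ (n ∸ k)) * J ^ n
        ≡.≡⟨ cong₂ (λ x y → N * sgn k * c₂ * c₃ * x * y) (pos-^ 27 (n ∸ k))
               (trans (cong (J ^_) (sym (ℕₚ.m∸n+n≡m k≤n))) (^-distribˡ-+-* J (n ∸ k) k)) ⟩
      N * sgn k * c₂ * c₃ * (+ 27) ^ (n ∸ k) * (J ^ (n ∸ k) * J ^ k)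
        ≡.≡⟨ lemma N (sgn k) c₂ c₃ ((+ 27) ^ (n ∸ k)) (J ^ (n ∸ k)) (J ^ k) ⟩
      sgn k * J ^ k * (c₂ * c₃) * (N * ((+ 27) ^ (n ∸ k) * J ^ (n ∸ k)))
        ≡.≡⟨ cong₂ (λ x y → x * (c₂ * c₃) * (N * y))
               (trans (sym (^-distribʳ-* (- 1ℤ) J k)) (cong (_^ k) (-1*i≡-i J))) (sym (^-distribʳ-* (+ 27) J (n ∸ k))) ⟩
      (- J) ^ k * (c₂ * c₃) * (N * (+ 27 * J) ^ (n ∸ k))
        ≡.≡⟨ cong₂ (λ x y → (- J) ^ k * x * (y * (+ 27 * J) ^ (n ∸ k)))
               (cong₂ _*_ (sym (bin-def (2 ℕ.* k) k)) (sym (bin-def (3 ℕ.* k) k))) (sym (bin-def n k)) ⟩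
      (- J) ^ k * trinomial k * (bin n k * (+ 27 * J) ^ (n ∸ k)) ≡.∎
      where
      module ≡ = ≡-Reasoning
      N c₂ c₃ : ℤ
      N = + (n C k)
      c₂ = + ((2 ℕ.* k) C k)
      c₃ = + ((3 ℕ.* k) C k)

  -- With t = 27 J the inner sum over n is (1 − t)⁻ᵏ, and T = −J / (1 − t).
  G3-sum : ∀ J T → 1ℤ - + 27 * J ≉ 0ℤ → T * (1ℤ - + 27 * J) ≈ - J →
    ∑ p (λ n → G3 n * J ^ n) ≈ ∑ p (λ k → trinomial k * T ^ k)
  G3-sum J T unit T-eq = begin
    ∑ p (λ n → G3 n * J ^ n)
      ≡⟨ ∑-cong p (λ n n<p → G3-∑ n n<p J) ⟩
    ∑ p (λ n → ∑ p (λ k → a k * (bin n k * (+ 27 * J) ^ (n ∸ k))))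
      ≡⟨ ∑-swap p p (λ n k → a k * (bin n k * (+ 27 * J) ^ (n ∸ k))) ⟩
    ∑ p (λ k → ∑ p (λ n → a k * (bin n k * (+ 27 * J) ^ (n ∸ k))))
      ≡⟨ ∑-ext p (λ k → sym (*-distribˡ-∑ (a k) p (λ n → bin n k * (+ 27 * J) ^ (n ∸ k)))) ⟩
    ∑ p (λ k → a k * binomialColumn (+ 27 * J) unit k)
      ≈⟨ ∑-≈ p term ⟩
    ∑ p (λ k → trinomial k * T ^ k) ∎
    where
    a : ℕ → ℤ
    a k = (- J) ^ k * trinomial k
    lemma : ∀ a b c d → a * b * c * d ≡ c * a * (b * d)
    lemma = solve-∀
    term : ∀ k → k ℕ.< p → a k * binomialColumn (+ 27 * J) unit k ≈ trinomial k * T ^ k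
    term k k<p = begin
      (- J) ^ k * trinomial k * B ≈⟨ *-≈ʳ B (*-≈ʳ (trinomial k) (≈-^ k (≈-sym T-eq))) ⟩
      (T * s) ^ k * trinomial k * B ≡⟨ cong (λ z → z * trinomial k * B) (^-distribʳ-* T s k) ⟩
      T ^ k * s ^ k * trinomial k * B ≡⟨ lemma (T ^ k) (s ^ k) (trinomial k) B ⟩
      trinomial k * T ^ k * (s ^ k * B) ≈⟨ *-≈ˡ (trinomial k * T ^ k) (binomialColumn-value (+ 27 * J) unit k k<p) ⟩
      trinomial k * T ^ k * 1ℤ ≡⟨ *-identityʳ (trinomial k * T ^ k) ⟩
      trinomial k * T ^ k                         ∎
      where
      B s : ℤ
      B = binomialColumn (+ 27 * J) unit k
      s = 1ℤ - + 27 * J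

  -- Factorial identities for c k

  ff-≈ : ∀ {a b} k → a ≈ b → ff a k ≈ ff b k
  ff-≈ zero    e = ≈-refl
  ff-≈ (suc k) e = ff-≈ k e ⟨*⟩ +-≈ʳ (- (+ k)) e

  -- Upper negation: the factors on the left are a + 1, ..., a + k, each with its sign changed.
  ff-reflect : ∀ a k → ff (- (1ℤ + + a)) k ≡ (- 1ℤ) ^ k * ff (+ (a ℕ.+ k)) k
  ff-reflect a zero = refl
  ff-reflect a (suc k) = trans (cong (_* (- (1ℤ + + a) - + k)) (ff-reflect a k))
    (trans (lemma ((- 1ℤ) ^ k) (ff (+ (a ℕ.+ k)) k) (+ a) (+ k))
    (cong ((- 1ℤ) * (- 1ℤ) ^ k *_) (trans (sym (ff-suc (+ (a ℕ.+ k)) k)) (cong (λ n → ff (+ n) (suc k)) (sym (ℕₚ.+-suc a k))))))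
    where
    lemma : ∀ s f a k → s * f * (- (1ℤ + a) - k) ≡ (- 1ℤ) * s * ((1ℤ + (a + k)) * f)
    lemma = solve-∀

  ff-fact : ∀ a k → fact a * ff (+ (a ℕ.+ k)) k ≡ fact (a ℕ.+ k)
  ff-fact a zero = trans (*-identityʳ (fact a)) (cong fact (sym (ℕₚ.+-identityʳ a)))
  ff-fact a (suc k) = trans (cong (λ n → fact a * ff (+ n) (suc k)) (ℕₚ.+-suc a k))
    (trans (cong (fact a *_) (ff-suc (+ (a ℕ.+ k)) k))
    (trans (lemma (fact a) (+ suc (a ℕ.+ k)) (ff (+ (a ℕ.+ k)) k))
    (trans (cong (_* + suc (a ℕ.+ k)) (ff-fact a k)) (cong fact (sym (ℕₚ.+-suc a k))))))
    where
    lemma : ∀ a b c → a * (b * c) ≡ a * c * b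
    lemma = solve-∀

  fact-2* : ∀ k → fact (2 ℕ.* suc k) ≡ fact (2 ℕ.* k) * ((1ℤ + + 2 * + k) * (+ 2 + + 2 * + k))
  fact-2* k = trans (cong fact (ℕₚ.*-suc 2 k))
    (trans (ℤₚ.*-assoc (fact (2 ℕ.* k)) (+ suc (2 ℕ.* k)) (+ suc (suc (2 ℕ.* k))))
    (cong (λ z → fact (2 ℕ.* k) * ((1ℤ + z) * (+ 2 + z))) (pos-* 2 k)))

  fact-3* : ∀ k → fact (3 ℕ.* suc k) ≡ fact (3 ℕ.* k) * ((1ℤ + + 3 * + k) * (+ 2 + + 3 * + k) * (+ 3 + + 3 * + k))
  fact-3* k = trans (cong fact (ℕₚ.*-suc 3 k))
    (trans (lemma (fact (3 ℕ.* k)) (+ suc (3 ℕ.* k)) (+ suc (suc (3 ℕ.* k))) (+ suc (suc (suc (3 ℕ.* k)))))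
    (cong (λ z → fact (3 ℕ.* k) * ((1ℤ + z) * (+ 2 + z) * (+ 3 + z))) (pos-* 3 k)))
    where
    lemma : ∀ a b c d → a * b * c * d ≡ a * (b * c * d)
    lemma = solve-∀

  fact-bin-fact : ∀ a k → fact a * fact k * bin (a ℕ.+ k) k ≡ fact (a ℕ.+ k)
  fact-bin-fact a k = trans (ℤₚ.*-assoc (fact a) (fact k) (bin (a ℕ.+ k) k))
    (trans (cong (fact a *_) (fact-bin (a ℕ.+ k) k)) (ff-fact a k))

  fact-central : ∀ k → fact k * fact k * bin (2 ℕ.* k) k ≡ fact (2 ℕ.* k)
  fact-central k = subst (λ n → fact k * fact k * bin n k ≡ fact n) (cong (k ℕ.+_) (sym (ℕₚ.+-identityʳ k))) (fact-bin-fact k k)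

  fact-trinomial : ∀ k → fact k * fact k * fact k * trinomial k ≡ fact (3 ℕ.* k)
  fact-trinomial k = trans (lemma (fact k) (bin (2 ℕ.* k) k) (bin (3 ℕ.* k) k))
    (trans (cong (λ z → z * fact k * bin (3 ℕ.* k) k) (fact-central k))
    (subst (λ n → fact (2 ℕ.* k) * fact k * bin n k ≡ fact n) (arith k) (fact-bin-fact (2 ℕ.* k) k)))
    where
    lemma : ∀ a b c → a * a * a * (b * c) ≡ a * a * b * a * c
    lemma = solve-∀
    arith : ∀ k → 2 ℕ.* k ℕ.+ k ≡ 3 ℕ.* k
    arith = ℕ-Solver.solve-∀

  [-1]^-square : ∀ k → (- 1ℤ) ^ k * (- 1ℤ) ^ k ≡ 1ℤ
  [-1]^-square k = trans (sym (^-distribʳ-* (- 1ℤ) (- 1ℤ) k)) (^-zeroˡ k)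

  p≡1+ : ∀ {n} → p ∸ 1 ≡ n → p ≡ suc n
  p≡1+ eq = trans p≡1+[p∸1] (cong suc eq)

  -- The Hasse invariant of y² + x y + T y = x³

  module _ (h : ℕ) (p∸1≡2h : p ∸ 1 ≡ 2 ℕ.* h) where

    1+2h≈0 : 1ℤ + + 2 * + h ≈ 0ℤ
    1+2h≈0 = ≈-trans (≡⇒≈ (trans (cong (λ z → 1ℤ + z) (sym (pos-* 2 h))) (cong +_ (sym (p≡1+ p∸1≡2h))))) M≈0

    0<h : 0 ℕ.< h
    0<h = ℕₚ.n≢0⇒n>0 (λ h≡0 → ℕₚ.<⇒≢ (ℕₚ.<⇒≤ 1<p∸1) (sym (trans p∸1≡2h (cong (2 ℕ.*_) h≡0))))

    h<p : h ℕ.< p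
    h<p = subst (h ℕ.<_) (sym (p≡1+ p∸1≡2h)) (s≤s (ℕₚ.m≤m+n h (h ℕ.+ 0)))

    -- Since h ≡ -1/2, this is C(-1/2, i) = (-1/4)ⁱ C(2i, i) with denominators cleared.
    bin-half : ∀ i → i ℕ.< p → (+ 4) ^ i * bin h i ≈ (- 1ℤ) ^ i * bin (2 ℕ.* i) i
    bin-half i i<p = *-cancelˡ-≈ (fact i * fact i) (*-≉0 {fact i} {fact i} (fact-≉0 i i<p) (fact-≉0 i i<p)) (begin
      fact i * fact i * ((+ 4) ^ i * bin h i) ≡⟨ lemma₁ (fact i) ((+ 4) ^ i) (bin h i) ⟩
      fact i * (+ 4) ^ i * (fact i * bin h i) ≡⟨ cong (fact i * (+ 4) ^ i *_) (fact-bin h i) ⟩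
      fact i * (+ 4) ^ i * ff (+ h) i ≈⟨ product i ⟩
      (- 1ℤ) ^ i * fact (2 ℕ.* i) ≡⟨ cong ((- 1ℤ) ^ i *_) (sym (fact-central i)) ⟩
      (- 1ℤ) ^ i * (fact i * fact i * bin (2 ℕ.* i) i)  ≡⟨ lemma₂ ((- 1ℤ) ^ i) (fact i * fact i) (bin (2 ℕ.* i) i) ⟩
      fact i * fact i * ((- 1ℤ) ^ i * bin (2 ℕ.* i) i) ∎)
      where
      lemma₁ : ∀ f a b → f * f * (a * b) ≡ f * a * (f * b)
      lemma₁ = solve-∀
      lemma₂ : ∀ a b c → a * (b * c) ≡ b * (a * c)
      lemma₂ = solve-∀
      lemma₃ : ∀ f k a b h → f * (1ℤ + k) * (+ 4 * a) * (b * (h - k)) ≡ f * a * b * ((1ℤ + k) * (+ 4 * (h - k)))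
      lemma₃ = solve-∀
      lemma₄ : ∀ k h → (1ℤ + k) * (+ 4 * (h - k)) - - ((1ℤ + + 2 * k) * (+ 2 + + 2 * k)) ≡ (+ 2 * (1ℤ + k)) * (1ℤ + + 2 * h)
      lemma₄ = solve-∀
      lemma₅ : ∀ s f c → s * f * - c ≡ (- 1ℤ) * s * (f * c)
      lemma₅ = solve-∀
      product : ∀ i → fact i * (+ 4) ^ i * ff (+ h) i ≈ (- 1ℤ) ^ i * fact (2 ℕ.* i)
      product zero = ≈-refl
      product (suc i) = begin
        fact (suc i) * (+ 4) ^ suc i * ff (+ h) (suc i)
          ≡⟨ lemma₃ (fact i) (+ i) ((+ 4) ^ i) (ff (+ h) i) (+ h) ⟩
        fact i * (+ 4) ^ i * ff (+ h) i * ((1ℤ + + i) * (+ 4 * (+ h - + i)))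
          ≈⟨ product i ⟨*⟩ ≈-by (+ 2 * (1ℤ + + i)) (lemma₄ (+ i) (+ h)) 1+2h≈0 ⟩
        (- 1ℤ) ^ i * fact (2 ℕ.* i) * - ((1ℤ + + 2 * + i) * (+ 2 + + 2 * + i))
          ≡⟨ lemma₅ ((- 1ℤ) ^ i) (fact (2 ℕ.* i)) ((1ℤ + + 2 * + i) * (+ 2 + + 2 * + i)) ⟩
        (- 1ℤ) ^ suc i * (fact (2 ℕ.* i) * ((1ℤ + + 2 * + i) * (+ 2 + + 2 * + i)))
          ≡⟨ cong ((- 1ℤ) ^ suc i *_) (sym (fact-2* i)) ⟩
        (- 1ℤ) ^ suc i * fact (2 ℕ.* suc i) ∎

    -- Since 2 (h - i) ≡ -1 - 2i, upper negation turns the left side into C(3i, i) up to sign.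
    bin-reflect : ∀ i → i ℕ.≤ h → bin (2 ℕ.* (h ∸ i)) i ≈ (- 1ℤ) ^ i * bin (3 ℕ.* i) i
    bin-reflect i i≤h = *-cancelˡ-≈ (fact i) (fact-≉0 i (ℕₚ.≤-<-trans i≤h h<p)) (begin
      fact i * bin (2 ℕ.* (h ∸ i)) i ≡⟨ fact-bin (2 ℕ.* (h ∸ i)) i ⟩
      ff (+ (2 ℕ.* (h ∸ i))) i ≈⟨ ff-≈ i negative ⟩
      ff (- (1ℤ + + (2 ℕ.* i))) i ≡⟨ ff-reflect (2 ℕ.* i) i ⟩
      (- 1ℤ) ^ i * ff (+ (2 ℕ.* i ℕ.+ i)) i ≡⟨ cong (λ n → (- 1ℤ) ^ i * ff (+ n) i) (arith i) ⟩
      (- 1ℤ) ^ i * ff (+ (3 ℕ.* i)) i ≡⟨ cong ((- 1ℤ) ^ i *_) (sym (fact-bin (3 ℕ.* i) i)) ⟩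
      (- 1ℤ) ^ i * (fact i * bin (3 ℕ.* i) i) ≡⟨ lemma₂ ((- 1ℤ) ^ i) (fact i) (bin (3 ℕ.* i) i) ⟩
      fact i * ((- 1ℤ) ^ i * bin (3 ℕ.* i) i) ∎)
      where
      lemma₂ : ∀ a b c → a * (b * c) ≡ b * (a * c)
      lemma₂ = solve-∀
      arith : ∀ k → 2 ℕ.* k ℕ.+ k ≡ 3 ℕ.* k
      arith = ℕ-Solver.solve-∀
      lemma₃ : ∀ a b → a - - (1ℤ + b) ≡ 1ℤ * (1ℤ + (a + b))
      lemma₃ = solve-∀
      total : 1ℤ + (+ (2 ℕ.* (h ∸ i)) + + (2 ℕ.* i)) ≡ + p
      total = cong +_ (trans (cong suc (trans (sym (ℕₚ.*-distribˡ-+ 2 (h ∸ i) i)) (cong (2 ℕ.*_) (ℕₚ.m∸n+n≡m i≤h)))) (sym (p≡1+ p∸1≡2h)))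
      negative : + (2 ℕ.* (h ∸ i)) ≈ - (1ℤ + + (2 ℕ.* i))
      negative = ≈-by 1ℤ (lemma₃ (+ (2 ℕ.* (h ∸ i))) (+ (2 ℕ.* i))) (≈-trans (≡⇒≈ total) M≈0)

    -- The two signs (-1)ⁱ cancel. For i > h the factor C(h, i) is zero, and `bin-half` makes c i
    -- vanish as well.
    trinomial-half : ∀ i → i ℕ.< p → trinomial i ≈ (+ 4) ^ i * bin h i * bin (2 ℕ.* (h ∸ i)) i
    trinomial-half i i<p with i ℕ.≤? h
    ... | yes i≤h = ≈-sym (begin
      (+ 4) ^ i * bin h i * bin (2 ℕ.* (h ∸ i)) i ≈⟨ bin-half i i<p ⟨*⟩ bin-reflect i i≤h ⟩
      s * bin (2 ℕ.* i) i * (s * bin (3 ℕ.* i) i) ≡⟨ lemma s (bin (2 ℕ.* i) i) (bin (3 ℕ.* i) i) ⟩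
      s * s * trinomial i ≡⟨ cong (_* trinomial i) ([-1]^-square i) ⟩
      1ℤ * trinomial i ≡⟨ *-identityˡ (trinomial i) ⟩
      trinomial i                                     ∎)
      where
      s : ℤ
      s = (- 1ℤ) ^ i
      lemma : ∀ s a b → s * a * (s * b) ≡ s * s * (a * b)
      lemma = solve-∀
    ... | no i≰h = begin
      bin (2 ℕ.* i) i * bin (3 ℕ.* i) i ≡⟨ sym (*-identityˡ _) ⟩
      1ℤ * trinomial i ≡⟨ cong (_* trinomial i) (sym ([-1]^-square i)) ⟩
      s * s * trinomial i ≡⟨ lemma s (bin (2 ℕ.* i) i) (bin (3 ℕ.* i) i) ⟩
      s * bin (2 ℕ.* i) i * (s * bin (3 ℕ.* i) i) ≈⟨ *-≈ʳ (s * bin (3 ℕ.* i) i) (≈-sym (bin-half i i<p)) ⟩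
      (+ 4) ^ i * bin h i * (s * bin (3 ℕ.* i) i) ≡⟨ trans (cong (_* (s * bin (3 ℕ.* i) i)) vanish) (*-zeroˡ (s * bin (3 ℕ.* i) i)) ⟩
      0ℤ ≡⟨ sym (trans (cong (_* bin (2 ℕ.* (h ∸ i)) i) vanish) (*-zeroˡ (bin (2 ℕ.* (h ∸ i)) i))) ⟩
      (+ 4) ^ i * bin h i * bin (2 ℕ.* (h ∸ i)) i     ∎
      where
      s : ℤ
      s = (- 1ℤ) ^ i
      lemma : ∀ s a b → s * s * (a * b) ≡ s * a * (s * b)
      lemma = solve-∀
      vanish : (+ 4) ^ i * bin h i ≡ 0ℤ
      vanish = trans (cong ((+ 4) ^ i *_) (bin-> (ℕₚ.≰⇒> i≰h))) (*-zeroʳ ((+ 4) ^ i))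

    -- To reach x^(p-1) one takes x^(2h-3i) out of (x + T)^(2h-2i), which leaves Tⁱ. If 3i > 2h no
    -- term reaches it, and then 2 (h - i) < i makes the binomial coefficient zero too.
    Σₚ-shifted-power : ∀ T i → i ℕ.≤ h → Σₚ (λ x → x ^ (3 ℕ.* i) * (1ℤ * x ^ 1 + T) ^ (2 ℕ.* (h ∸ i))) ≈ - (bin (2 ℕ.* (h ∸ i)) i * T ^ i)
    Σₚ-shifted-power T i i≤h = split (3 ℕ.* i ℕ.≤? 2 ℕ.* h)
      where
      b j : ℕ
      b = 2 ℕ.* (h ∸ i)
      j = 2 ℕ.* h ∸ 3 ℕ.* i
      arith : ∀ d i → 3 ℕ.* i ℕ.+ (2 ℕ.* d) ≡ 2 ℕ.* (d ℕ.+ i) ℕ.+ i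
      arith = ℕ-Solver.solve-∀
      arith′ : ∀ i → 3 ℕ.* i ≡ 2 ℕ.* i ℕ.+ i
      arith′ = ℕ-Solver.solve-∀
      degree : 3 ℕ.* i ℕ.+ b ≡ 2 ℕ.* h ℕ.+ i
      degree = trans (arith (h ∸ i) i) (cong (λ n → 2 ℕ.* n ℕ.+ i) (ℕₚ.m∸n+n≡m i≤h))
      bound : 3 ℕ.* i ℕ.+ 1 ℕ.* b ℕ.< (p ∸ 1) ℕ.+ (p ∸ 1)
      bound = subst₂ ℕ._<_ (sym (trans (cong (3 ℕ.* i ℕ.+_) (ℕₚ.*-identityˡ b)) degree))
        (sym (cong₂ ℕ._+_ p∸1≡2h p∸1≡2h))
        (ℕₚ.+-monoʳ-< (2 ℕ.* h) (ℕₚ.≤-<-trans i≤h (ℕₚ.m<m+n h (subst (0 ℕ.<_) (sym (ℕₚ.+-identityʳ h)) 0<h))))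
      split : Dec (3 ℕ.* i ℕ.≤ 2 ℕ.* h) → Σₚ (λ x → x ^ (3 ℕ.* i) * (1ℤ * x ^ 1 + T) ^ b) ≈ - (bin b i * T ^ i)
      split (yes 3i≤2h) = ≈-trans
        (Σₚ-coefficient (3 ℕ.* i) 1 b j 1ℤ T j≤b (trans (cong (3 ℕ.* i ℕ.+_) (ℕₚ.*-identityˡ j)) (trans (ℕₚ.m+[n∸m]≡n 3i≤2h) (sym p∸1≡2h))) bound)
        (≡⇒≈ (cong₂ (λ x y → - (x * y)) (trans (bin-sym j≤b) (cong (bin b) b∸j≡i))
           (trans (cong₂ _*_ (^-zeroˡ j) (cong (T ^_) b∸j≡i)) (*-identityˡ (T ^ i)))))
        where
        b≡i+j : b ≡ i ℕ.+ j
        b≡i+j = ℕₚ.+-cancelˡ-≡ (3 ℕ.* i) b (i ℕ.+ j) (trans degree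
          (trans (cong (ℕ._+ i) (sym (ℕₚ.m+[n∸m]≡n 3i≤2h))) (trans (ℕₚ.+-assoc (3 ℕ.* i) j i) (cong (3 ℕ.* i ℕ.+_) (ℕₚ.+-comm j i)))))
        j≤b : j ℕ.≤ b
        j≤b = subst (j ℕ.≤_) (sym b≡i+j) (ℕₚ.m≤n+m j i)
        b∸j≡i : b ∸ j ≡ i
        b∸j≡i = trans (cong (_∸ j) b≡i+j) (ℕₚ.m+n∸n≡m i j)
      split (no 3i≰2h) = ≈-trans
        (Σₚ-no-coefficient (3 ℕ.* i) 1 b 1ℤ T (λ j _ eq → 3i≰2h (subst (3 ℕ.* i ℕ.≤_) (trans eq p∸1≡2h) (ℕₚ.m≤m+n (3 ℕ.* i) (1 ℕ.* j)))) bound)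
        (≡⇒≈ (sym (cong -_ (trans (cong (_* T ^ i) (bin-> b<i)) (*-zeroˡ (T ^ i))))))
        where
        b<i : b ℕ.< i
        b<i = ℕₚ.+-cancelˡ-< (2 ℕ.* i) b i (subst₂ ℕ._<_
          (trans (cong (2 ℕ.*_) (sym (ℕₚ.m+[n∸m]≡n i≤h))) (ℕₚ.*-distribˡ-+ 2 i (h ∸ i))) (arith′ i) (ℕₚ.≰⇒> 3i≰2h))

    -- 4 x³ + (x + T)² is the discriminant in y of y² + x y + T y = x³, whose Hasse invariant is the left-hand side.
    trinomial-cubic : ∀ T → ∑ p (λ k → trinomial k * T ^ k) ≈ - Σₚ (λ x → (+ 4 * x ^ 3 + (x + T) ^ 2) ^ h)
    trinomial-cubic T = ≈-sym (begin
      - Σₚ (λ x → (+ 4 * x ^ 3 + (x + T) ^ 2) ^ h)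
        ≡⟨ cong -_ (trans (Σₚ-ext expand) (Σₚ-∑ (suc h) (λ i x → a i * (x ^ (3 ℕ.* i) * (1ℤ * x ^ 1 + T) ^ (2 ℕ.* (h ∸ i)))))) ⟩
      - ∑ (suc h) (λ i → Σₚ (λ x → a i * (x ^ (3 ℕ.* i) * (1ℤ * x ^ 1 + T) ^ (2 ℕ.* (h ∸ i)))))
        ≡⟨ cong -_ (∑-ext (suc h) (λ i → Σₚ-*ˡ (a i) (λ x → x ^ (3 ℕ.* i) * (1ℤ * x ^ 1 + T) ^ (2 ℕ.* (h ∸ i))))) ⟩
      - ∑ (suc h) (λ i → a i * Σₚ (λ x → x ^ (3 ℕ.* i) * (1ℤ * x ^ 1 + T) ^ (2 ℕ.* (h ∸ i))))
        ≈⟨ ≈-neg (∑-≈ (suc h) (λ i i≤h → *-≈ˡ (a i) (Σₚ-shifted-power T i (ℕ.s≤s⁻¹ i≤h)))) ⟩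
      - ∑ (suc h) (λ i → a i * - (bin (2 ℕ.* (h ∸ i)) i * T ^ i))
        ≡⟨ cong -_ (trans (∑-ext (suc h) (λ i → lemma (a i) (bin (2 ℕ.* (h ∸ i)) i) (T ^ i))) (sym (*-distribˡ-∑ (- 1ℤ) (suc h) g))) ⟩
      - (- 1ℤ * ∑ (suc h) g)
        ≡⟨ lemma₂ (∑ (suc h) g) ⟩
      ∑ (suc h) g
        ≡⟨ sym (∑-extend g h<p (λ i h<i → trans (cong (λ z → (+ 4) ^ i * z * bin (2 ℕ.* (h ∸ i)) i * T ^ i) (bin-> h<i)) (lemma₃ ((+ 4) ^ i) (bin (2 ℕ.* (h ∸ i)) i) (T ^ i)))) ⟩
      ∑ p g
        ≈⟨ ∑-≈ p (λ i i<p → *-≈ʳ (T ^ i) (≈-sym (trinomial-half i i<p))) ⟩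
      ∑ p (λ k → trinomial k * T ^ k) ∎)
      where
      a g : ℕ → ℤ
      a i = (+ 4) ^ i * bin h i
      g i = (+ 4) ^ i * bin h i * bin (2 ℕ.* (h ∸ i)) i * T ^ i
      lemma : ∀ a b c → a * - (b * c) ≡ - 1ℤ * (a * b * c)
      lemma = solve-∀
      lemma₂ : ∀ a → - (- 1ℤ * a) ≡ a
      lemma₂ = solve-∀
      lemma₃ : ∀ a b c → a * 0ℤ * b * c ≡ 0ℤ
      lemma₃ = solve-∀
      lemma₄ : ∀ a b c d → a * (b * c * d) ≡ b * a * (c * d)
      lemma₄ = solve-∀
      lemma₅ : ∀ x T → x + T ≡ 1ℤ * (x * 1ℤ) + T
      lemma₅ = solve-∀
      expand : ∀ x → (+ 4 * x ^ 3 + (x + T) ^ 2) ^ h ≡ ∑ (suc h) (λ i → a i * (x ^ (3 ℕ.* i) * (1ℤ * x ^ 1 + T) ^ (2 ℕ.* (h ∸ i))))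
      expand x = trans (binomial-theorem (+ 4 * x ^ 3) ((x + T) ^ 2) h) (∑-ext (suc h) (λ i →
        trans (cong₂ (λ y z → bin h i * (y * z))
                (trans (^-distribʳ-* (+ 4) (x ^ 3) i) (cong ((+ 4) ^ i *_) (^-*-assoc x 3 i)))
                (trans (^-*-assoc (x + T) 2 (h ∸ i)) (cong (_^ (2 ℕ.* (h ∸ i))) (lemma₅ x T))))
              (lemma₄ (bin h i) ((+ 4) ^ i) (x ^ (3 ℕ.* i)) ((1ℤ * x ^ 1 + T) ^ (2 ℕ.* (h ∸ i))))))

  -- Legendre polynomials modulo p

  module _ (n : ℕ) (n≤p∸1 : n ℕ.≤ p ∸ 1) (2n<p∸1 : 2 ℕ.* n ℕ.< p ∸ 1)
           (root : (1ℤ + + 3 * + n) * (+ 2 + + 3 * + n) ≈ 0ℤ) where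

    -- Both sides satisfy one recursion in k: (n - k)(n + k + 1) depends on n only through n² + n,
    -- and `root` says 9 (n² + n) ≡ -2, so that -9 (n - k)(n + k + 1) ≡ (3k + 1)(3k + 2). Since
    -- `root` allows n ≡ -1/3 and n ≡ -2/3, both classes of p modulo 3 are served.
    trinomial-legendre : ∀ k → k ℕ.< p → (- + 27) ^ k * (bin n k * bin (n ℕ.+ k) k) ≈ trinomial k
    trinomial-legendre k k<p = *-cancelˡ-≈ (fact k * fact k * fact k)
      (*-≉0 {fact k * fact k} {fact k} (*-≉0 {fact k} {fact k} (fact-≉0 k k<p) (fact-≉0 k k<p)) (fact-≉0 k k<p)) (begin
        fact k * fact k * fact k * ((- + 27) ^ k * (bin n k * bin (n ℕ.+ k) k))
          ≡⟨ lemma₁ (fact k) ((- + 27) ^ k) (bin n k) (bin (n ℕ.+ k) k) ⟩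
        fact k * (- + 27) ^ k * (fact k * bin n k * (fact k * bin (n ℕ.+ k) k))
          ≡⟨ cong₂ (λ x y → fact k * (- + 27) ^ k * (x * y)) (fact-bin n k) (fact-bin (n ℕ.+ k) k) ⟩
        fact k * (- + 27) ^ k * (ff (+ n) k * ff (+ (n ℕ.+ k)) k)
          ≈⟨ product k ⟩
        fact (3 ℕ.* k)
          ≡⟨ sym (fact-trinomial k) ⟩
        fact k * fact k * fact k * trinomial k ∎)
      where
      lemma₁ : ∀ f a b c → f * f * f * (a * (b * c)) ≡ f * a * (f * b * (f * c))
      lemma₁ = solve-∀
      lemma₂ : ∀ f k a b n c → f * (1ℤ + k) * (- + 27 * a) * (b * (n - k) * ((1ℤ + (n + k)) * c))
                          ≡ f * a * (b * c) * ((1ℤ + k) * (- + 27 * ((n - k) * (1ℤ + (n + k)))))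
      lemma₂ = solve-∀
      lemma₃ : ∀ n k → (1ℤ + k) * (- + 27 * ((n - k) * (1ℤ + (n + k)))) - (1ℤ + + 3 * k) * (+ 2 + + 3 * k) * (+ 3 + + 3 * k)
                    ≡ (- + 3 * (1ℤ + k)) * ((1ℤ + + 3 * n) * (+ 2 + + 3 * n))
      lemma₃ = solve-∀
      product : ∀ k → fact k * (- + 27) ^ k * (ff (+ n) k * ff (+ (n ℕ.+ k)) k) ≈ fact (3 ℕ.* k)
      product zero = ≈-refl
      product (suc k) = begin
        fact (suc k) * (- + 27) ^ suc k * (ff (+ n) (suc k) * ff (+ (n ℕ.+ suc k)) (suc k))
          ≡⟨ cong (λ z → fact (suc k) * (- + 27) ^ suc k * (ff (+ n) (suc k) * z))
               (trans (cong (λ j → ff (+ j) (suc k)) (ℕₚ.+-suc n k)) (ff-suc (+ (n ℕ.+ k)) k)) ⟩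
        fact (suc k) * (- + 27) ^ suc k * (ff (+ n) (suc k) * ((1ℤ + (+ n + + k)) * ff (+ (n ℕ.+ k)) k))
          ≡⟨ lemma₂ (fact k) (+ k) ((- + 27) ^ k) (ff (+ n) k) (+ n) (ff (+ (n ℕ.+ k)) k) ⟩
        fact k * (- + 27) ^ k * (ff (+ n) k * ff (+ (n ℕ.+ k)) k) * ((1ℤ + + k) * (- + 27 * ((+ n - + k) * (1ℤ + (+ n + + k)))))
          ≈⟨ product k ⟨*⟩ ≈-by (- + 3 * (1ℤ + + k)) (lemma₃ (+ n) (+ k)) root ⟩
        fact (3 ℕ.* k) * ((1ℤ + + 3 * + k) * (+ 2 + + 3 * + k) * (+ 3 + + 3 * + k))
          ≡⟨ sym (fact-3* k) ⟩
        fact (3 ℕ.* suc k) ∎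

    -- The factor z^(p-1-n) makes the sum over z pick the coefficient of zⁿ; the result is -Pₙ(1 -
    -- 2y) modulo p.
    legendreSum : ℤ → ℤ
    legendreSum y = Σₚ (λ z → z ^ (p ∸ 1 ∸ n) * ((z + y) ^ n * (1ℤ - (z + y)) ^ n))

    -- The Legendre polynomial is the coefficient of zⁿ in ((z + y) (1 − z − y))ⁿ.
    trinomial-legendreSum : ∀ T → ∑ p (λ k → trinomial k * T ^ k) ≈ - legendreSum (+ 27 * T)
    trinomial-legendreSum T = ≈-sym (begin
      - legendreSum y
        ≡⟨ cong -_ (trans (Σₚ-ext expand) (Σₚ-∑ (suc n) (λ j z → c j * (z ^ a * (1ℤ * z ^ 1 + y) ^ (n ℕ.+ j))))) ⟩
      - ∑ (suc n) (λ j → Σₚ (λ z → c j * (z ^ a * (1ℤ * z ^ 1 + y) ^ (n ℕ.+ j))))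
        ≡⟨ cong -_ (∑-ext (suc n) (λ j → Σₚ-*ˡ (c j) (λ z → z ^ a * (1ℤ * z ^ 1 + y) ^ (n ℕ.+ j)))) ⟩
      - ∑ (suc n) (λ j → c j * Σₚ (λ z → z ^ a * (1ℤ * z ^ 1 + y) ^ (n ℕ.+ j)))
        ≈⟨ ≈-neg (∑-≈ (suc n) (λ j j≤n → *-≈ˡ (c j) (coefficient j (ℕ.s≤s⁻¹ j≤n)))) ⟩
      - ∑ (suc n) (λ j → c j * - (bin (n ℕ.+ j) j * y ^ j))
        ≡⟨ cong -_ (trans (∑-ext (suc n) (λ j → rearrange j)) (sym (*-distribˡ-∑ (- 1ℤ) (suc n) g))) ⟩
      - (- 1ℤ * ∑ (suc n) g)
        ≡⟨ lemma₂ (∑ (suc n) g) ⟩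
      ∑ (suc n) g
        ≡⟨ sym (∑-extend g (subst (suc n ℕ.≤_) (sym p≡1+[p∸1]) (s≤s n≤p∸1)) (λ j n<j → trans (cong (λ z → (- + 27) ^ j * (z * bin (n ℕ.+ j) j) * T ^ j) (bin-> n<j)) (lemma₃ ((- + 27) ^ j) (bin (n ℕ.+ j) j) (T ^ j)))) ⟩
      ∑ p g
        ≈⟨ ∑-≈ p (λ j j<p → *-≈ʳ (T ^ j) (trinomial-legendre j j<p)) ⟩
      ∑ p (λ k → trinomial k * T ^ k) ∎)
      where
      y : ℤ
      y = + 27 * T
      a : ℕ
      a = p ∸ 1 ∸ n
      c g : ℕ → ℤ
      c j = bin n j * (- 1ℤ) ^ j
      g j = (- + 27) ^ j * (bin n j * bin (n ℕ.+ j) j) * T ^ j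
      lemma₁ : ∀ x y → 1ℤ - (x + y) ≡ - 1ℤ * (x + y) + 1ℤ
      lemma₁ = solve-∀
      lemma₂ : ∀ a → - (- 1ℤ * a) ≡ a
      lemma₂ = solve-∀
      lemma₃ : ∀ a b c → a * (0ℤ * b) * c ≡ 0ℤ
      lemma₃ = solve-∀
      lemma₄ : ∀ x w b s v → x * (w * (b * (s * v * 1ℤ))) ≡ b * s * (x * (w * v))
      lemma₄ = solve-∀
      lemma₅ : ∀ x T → x + T ≡ 1ℤ * (x * 1ℤ) + T
      lemma₅ = solve-∀
      lemma₆ : ∀ b s d v t → b * s * - (d * (v * t)) ≡ - 1ℤ * (s * v * (b * d) * t)
      lemma₆ = solve-∀
      expand : ∀ z → z ^ a * ((z + y) ^ n * (1ℤ - (z + y)) ^ n) ≡ ∑ (suc n) (λ j → c j * (z ^ a * (1ℤ * z ^ 1 + y) ^ (n ℕ.+ j)))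
      expand z = trans (cong (λ u → z ^ a * ((z + y) ^ n * u)) (trans (cong (_^ n) (lemma₁ z y)) (binomial-theorem (- 1ℤ * (z + y)) 1ℤ n)))
        (trans (cong (z ^ a *_) (*-distribˡ-∑ ((z + y) ^ n) (suc n) _))
        (trans (*-distribˡ-∑ (z ^ a) (suc n) _) (∑-ext (suc n) (λ j →
          trans (cong₂ (λ u v → z ^ a * ((z + y) ^ n * (bin n j * (u * v)))) (^-distribʳ-* (- 1ℤ) (z + y) j) (^-zeroˡ (n ∸ j)))
          (trans (lemma₄ (z ^ a) ((z + y) ^ n) (bin n j) ((- 1ℤ) ^ j) ((z + y) ^ j))
          (cong (λ u → c j * (z ^ a * u)) (trans (sym (^-distribˡ-+-* (z + y) n j)) (cong (_^ (n ℕ.+ j)) (lemma₅ z y)))))))))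
      coefficient : ∀ j → j ℕ.≤ n → Σₚ (λ z → z ^ a * (1ℤ * z ^ 1 + y) ^ (n ℕ.+ j)) ≈ - (bin (n ℕ.+ j) j * y ^ j)
      coefficient j j≤n = ≈-trans
        (Σₚ-coefficient a 1 (n ℕ.+ j) n 1ℤ y (ℕₚ.m≤m+n n j) (trans (cong (a ℕ.+_) (ℕₚ.*-identityˡ n)) (ℕₚ.m∸n+n≡m n≤p∸1)) bound)
        (≡⇒≈ (cong₂ (λ u v → - (u * v)) (trans (bin-sym (ℕₚ.m≤m+n n j)) (cong (bin (n ℕ.+ j)) (ℕₚ.m+n∸m≡n n j)))
          (trans (cong₂ _*_ (^-zeroˡ n) (cong (y ^_) (ℕₚ.m+n∸m≡n n j))) (*-identityˡ (y ^ j)))))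
        where
        bound : a ℕ.+ 1 ℕ.* (n ℕ.+ j) ℕ.< (p ∸ 1) ℕ.+ (p ∸ 1)
        bound = subst (ℕ._< (p ∸ 1) ℕ.+ (p ∸ 1))
          (trans (cong (ℕ._+ j) (sym (ℕₚ.m∸n+n≡m n≤p∸1))) (trans (ℕₚ.+-assoc a n j) (cong (a ℕ.+_) (sym (ℕₚ.*-identityˡ (n ℕ.+ j))))))
          (ℕₚ.+-monoʳ-< (p ∸ 1) (ℕₚ.≤-<-trans (ℕₚ.≤-trans j≤n (ℕₚ.m≤m+n n (n ℕ.+ 0))) 2n<p∸1))
      rearrange : ∀ j → c j * - (bin (n ℕ.+ j) j * y ^ j) ≡ - 1ℤ * g j
      rearrange j = trans (cong (λ u → c j * - (bin (n ℕ.+ j) j * u)) (^-distribʳ-* (+ 27) T j))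
        (trans (lemma₆ (bin n j) ((- 1ℤ) ^ j) (bin (n ℕ.+ j) j) ((+ 27) ^ j) (T ^ j))
        (cong (λ u → - 1ℤ * (u * (bin n j * bin (n ℕ.+ j) j) * T ^ j)) (sym (^-distribʳ-* (- 1ℤ) (+ 27) j))))

    -- The substitution z ↦ -z exchanges the two factors, and z^(p-1-n) supplies the sign. Since 1 -
    -- 2y changes sign and p - 1 is even, this is the parity of Pₙ.
    legendreSum-reflect : ∀ {y y′} → y + y′ ≈ 1ℤ → legendreSum y′ ≈ (- 1ℤ) ^ (p ∸ 1 ∸ n) * legendreSum y
    legendreSum-reflect {y} {y′} y+y′≈1 = begin
      Σₚ f
        ≈⟨ Σₚ-affine-≈ f (- 1ℤ) 0ℤ f-resp (λ e → 1≉0 (≈-trans (≈-neg (≈-refl { - 1ℤ})) (≈-neg e))) ⟨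
      Σₚ (λ z → f (- 1ℤ * z + 0ℤ))
        ≈⟨ Σₚ-≈ step ⟩
      Σₚ (λ z → s * (z ^ a * ((z + y) ^ n * (1ℤ - (z + y)) ^ n)))
        ≡⟨ Σₚ-*ˡ s (λ z → z ^ a * ((z + y) ^ n * (1ℤ - (z + y)) ^ n)) ⟩
      s * legendreSum y ∎
      where
      a : ℕ
      a = p ∸ 1 ∸ n
      s : ℤ
      s = (- 1ℤ) ^ a
      f : ℤ → ℤ
      f z = z ^ a * ((z + y′) ^ n * (1ℤ - (z + y′)) ^ n)
      f-resp : ∀ {u v} → u ≈ v → f u ≈ f v
      f-resp e = ≈-^ a e ⟨*⟩ (≈-^ n (+-≈ʳ y′ e) ⟨*⟩ ≈-^ n (≈-refl {1ℤ} ⟨-⟩ +-≈ʳ y′ e))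
      lemma₁ : ∀ z y y′ → - 1ℤ * z + 0ℤ + y′ - (1ℤ - (z + y)) ≡ 1ℤ * (y + y′ - 1ℤ)
      lemma₁ = solve-∀
      lemma₂ : ∀ z y y′ → 1ℤ - (- 1ℤ * z + 0ℤ + y′) - (z + y) ≡ - 1ℤ * (y + y′ - 1ℤ)
      lemma₂ = solve-∀
      lemma₃ : ∀ s z u v → s * z * (u * v) ≡ s * (z * (v * u))
      lemma₃ = solve-∀
      step : ∀ z → f (- 1ℤ * z + 0ℤ) ≈ s * (z ^ a * ((z + y) ^ n * (1ℤ - (z + y)) ^ n))
      step z = begin
        (- 1ℤ * z + 0ℤ) ^ a * ((- 1ℤ * z + 0ℤ + y′) ^ n * (1ℤ - (- 1ℤ * z + 0ℤ + y′)) ^ n)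
          ≈⟨ ≡⇒≈ (trans (cong (_^ a) (+-identityʳ (- 1ℤ * z))) (^-distribʳ-* (- 1ℤ) z a))
             ⟨*⟩ (≈-^ n (≈-by 1ℤ (lemma₁ z y y′) (≈⇒-≈0 y+y′≈1)) ⟨*⟩ ≈-^ n (≈-by (- 1ℤ) (lemma₂ z y y′) (≈⇒-≈0 y+y′≈1))) ⟩
        s * z ^ a * ((1ℤ - (z + y)) ^ n * (z + y) ^ n)
          ≡⟨ lemma₃ s (z ^ a) ((1ℤ - (z + y)) ^ n) ((z + y) ^ n) ⟩
        s * (z ^ a * ((z + y) ^ n * (1ℤ - (z + y)) ^ n)) ∎

    -- At y = 1/2 the product (z + y)(1 - z - y) is y² - z², so the value Pₙ(0) reduces to a
    -- binomial expansion in z².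
    legendreSum-half : ∀ {y} → + 2 * y ≈ 1ℤ → legendreSum y ≈ Σₚ (λ z → z ^ (p ∸ 1 ∸ n) * (- 1ℤ * z ^ 2 + y * y) ^ n)
    legendreSum-half {y} 2y≈1 = Σₚ-≈ (λ z → *-≈ˡ (z ^ (p ∸ 1 ∸ n))
      (≈-trans (≡⇒≈ (sym (^-distribʳ-* (z + y) (1ℤ - (z + y)) n))) (≈-^ n (≈-by (- (z + y)) (lemma z y) (≈⇒-≈0 2y≈1)))))
      where
      lemma : ∀ z y → (z + y) * (1ℤ - (z + y)) - (- 1ℤ * (z * (z * 1ℤ)) + y * y) ≡ - (z + y) * (+ 2 * y - 1ℤ)
      lemma = solve-∀

  -- Counting square roots and cube roots

  Σₚ-0 : ∀ {f} → (∀ x → f x ≡ 0ℤ) → Σₚ f ≡ 0ℤ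
  Σₚ-0 z = trans (Σₚ-ext z) (trans (Σₚ-const 0ℤ) (*-zeroʳ (+ p)))

  -- A search through the p residues; it decides whether a number is a square or a cube modulo p.
  find-root : (f : ℤ → ℤ) → (∀ {a b} → a ≈ b → f a ≈ f b) → (∃ λ x → f x ≈ 0ℤ) ⊎ (∀ x → f x ≉ 0ℤ)
  find-root f f-resp with below p
    where
    below : ∀ n → (∃ λ x → f x ≈ 0ℤ) ⊎ (∀ i → i ℕ.< n → f (+ i) ≉ 0ℤ)
    below zero = inj₂ (λ i ())
    below (suc n) with below n | f (+ n) ≈? 0ℤ
    ... | inj₁ found | _ = inj₁ found
    ... | inj₂ none  | yes e  = inj₁ (+ n , e)
    ... | inj₂ none  | no  ne = inj₂ (λ i i≤n → case i i≤n)
      where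
      case : ∀ i → i ℕ.< suc n → f (+ i) ≉ 0ℤ
      case i i<1+n with i ℕ.≟ n
      ... | yes refl = ne
      ... | no i≢n = none i (ℕₚ.≤∧≢⇒< (ℕ.s≤s⁻¹ i<1+n) i≢n)
  ... | inj₁ found = inj₁ found
  ... | inj₂ none  = inj₂ (λ x e → none (residue x) (residue<p x) (≈-trans (≈-sym (f-resp (residue≈ x))) e))

  δ-neg : ∀ a b → δ (a - b) ≡ δ (b - a)
  δ-neg a b = δ-iff (λ e → ≈⇒-≈0 (≈-sym (-≈0⇒≈ {a} {b} e))) (λ e → ≈⇒-≈0 (≈-sym (-≈0⇒≈ {b} {a} e)))

  δ-square : ∀ a → δ (a * a) ≡ δ a
  δ-square a = δ-iff (λ e → root (*-≈0 a a e)) (λ e → *-≈ʳ a e)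
    where
    root : a ≈ 0ℤ ⊎ a ≈ 0ℤ → a ≈ 0ℤ
    root (inj₁ e) = e
    root (inj₂ e) = e

  δ-cube : ∀ a → δ (a * a * a) ≡ δ a
  δ-cube a = δ-iff (λ e → root (*-≈0 (a * a) a e)) (λ e → *-≈ˡ (a * a) e ⟫ ≡⇒≈ (*-zeroʳ (a * a)))
    where
    _⟫_ = ≈-trans
    square-root : a ≈ 0ℤ ⊎ a ≈ 0ℤ → a ≈ 0ℤ
    square-root (inj₁ e) = e
    square-root (inj₂ e) = e
    root : a * a ≈ 0ℤ ⊎ a ≈ 0ℤ → a ≈ 0ℤ
    root (inj₁ e) = square-root (*-≈0 a a e)
    root (inj₂ e) = e

  squareRoots cubeRoots : ℤ → ℤ
  squareRoots d = Σₚ (λ y → δ (y * y - d))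
  cubeRoots d = Σₚ (λ s → δ (s * s * s - d))

  squareRoots-resp : Respects squareRoots
  squareRoots-resp e = Σₚ-ext (λ y → δ-resp (≈-refl {y * y} ⟨-⟩ e))

  cubeRoots-resp : Respects cubeRoots
  cubeRoots-resp e = Σₚ-ext (λ s → δ-resp (≈-refl {s * s * s} ⟨-⟩ e))

  cube-≈ : ∀ {a b} → a ≈ b → a * a * a ≈ b * b * b
  cube-≈ e = e ⟨*⟩ e ⟨*⟩ e

  Σₚ-squares : ∀ φ → Respects φ → Σₚ (λ x → φ (x * x)) ≡ Σₚ (λ d → squareRoots d * φ d)
  Σₚ-squares φ φ-resp = trans (Σₚ-ext (λ x → trans (sym (Σₚ-pick φ φ-resp (x * x))) (Σₚ-ext (λ d → cong (_* φ d) (δ-neg d (x * x))))))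
    (trans (Σₚ-swap (λ x d → δ (x * x - d) * φ d)) (Σₚ-ext (λ d → Σₚ-*ʳ (φ d) (λ x → δ (x * x - d)))))

  Σₚ-cubes : ∀ φ → Respects φ → Σₚ (λ x → φ (x * x * x)) ≡ Σₚ (λ d → cubeRoots d * φ d)
  Σₚ-cubes φ φ-resp = trans (Σₚ-ext (λ x → trans (sym (Σₚ-pick φ φ-resp (x * x * x))) (Σₚ-ext (λ d → cong (_* φ d) (δ-neg d (x * x * x))))))
    (trans (Σₚ-swap (λ x d → δ (x * x * x - d) * φ d)) (Σₚ-ext (λ d → Σₚ-*ʳ (φ d) (λ x → δ (x * x * x - d)))))

  Σₚ-1 : Σₚ (λ _ → 1ℤ) ≡ + p
  Σₚ-1 = trans (Σₚ-const 1ℤ) (*-identityʳ (+ p))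

  Σₚ-squareRoots : Σₚ squareRoots ≡ + p
  Σₚ-squareRoots = trans (Σₚ-ext (λ d → sym (*-identityʳ (squareRoots d)))) (trans (sym (Σₚ-squares (λ _ → 1ℤ) (λ _ → refl))) Σₚ-1)

  Σₚ-cubeRoots : Σₚ cubeRoots ≡ + p
  Σₚ-cubeRoots = trans (Σₚ-ext (λ d → sym (*-identityʳ (cubeRoots d)))) (trans (sym (Σₚ-cubes (λ _ → 1ℤ) (λ _ → refl))) Σₚ-1)

  squareRoots-0 : ∀ {d} → d ≈ 0ℤ → squareRoots d ≡ 1ℤ
  squareRoots-0 e = trans (squareRoots-resp e) (trans (Σₚ-ext (λ y → trans (δ-resp (≡⇒≈ (+-identityʳ (y * y)))) (δ-square y))) Σₚ-δ0)

  cubeRoots-0 : ∀ {d} → d ≈ 0ℤ → cubeRoots d ≡ 1ℤ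
  cubeRoots-0 e = trans (cubeRoots-resp e) (trans (Σₚ-ext (λ s → trans (δ-resp (≡⇒≈ (+-identityʳ (s * s * s)))) (δ-cube s))) Σₚ-δ0)

  squareRoots-square : ∀ {s d} → s ≉ 0ℤ → s * s ≈ d → squareRoots d ≡ + 2
  squareRoots-square {s} {d} s≉0 e = trans (squareRoots-resp (≈-sym e)) (trans (Σₚ-ext (λ y →
      trans (δ-resp (≡⇒≈ (lemma₁ y s))) (δ-product (y - s) (y - - s) (λ y≈s y≈-s → s≉0 (*-≈0-right (+ 2) s 2≉0
        (≈-trans (≡⇒≈ (lemma₂ y s)) (y≈-s ⟨-⟩ y≈s)))))))
    (trans (Σₚ-+ (λ y → δ (y - s)) (λ y → δ (y - - s))) (cong₂ _+_ (Σₚ-δ s) (Σₚ-δ (- s)))))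
    where
    lemma₁ : ∀ y s → y * y - s * s ≡ (y - s) * (y - - s)
    lemma₁ = solve-∀
    lemma₂ : ∀ y s → + 2 * s ≡ (y - - s) - (y - s)
    lemma₂ = solve-∀

  squareRoots-scale : ∀ t d → t ≉ 0ℤ → squareRoots (t * t * d) ≡ squareRoots d
  squareRoots-scale t d t≉0 = trans
    (sym (Σₚ-scale (λ y → δ (y * y - t * t * d)) t (λ e → δ-resp (e ⟨*⟩ e ⟨-⟩ ≈-refl {t * t * d})) t≉0))
    (Σₚ-ext (λ y → trans (δ-resp (≡⇒≈ (lemma t y d))) (δ-scale (t * t) (*-≉0 {t} {t} t≉0 t≉0))))
    where
    lemma : ∀ t y d → t * y * (t * y) - t * t * d ≡ t * t * (y * y - d)
    lemma = solve-∀

  data SquareRootCount (d : ℤ) : Set where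
    none : squareRoots d ≡ 0ℤ → SquareRootCount d
    one  : d ≈ 0ℤ → squareRoots d ≡ 1ℤ → SquareRootCount d
    two  : squareRoots d ≡ + 2 → SquareRootCount d

  squareRootCount : ∀ d → SquareRootCount d
  squareRootCount d with d ≈? 0ℤ
  ... | yes d≈0 = one d≈0 (squareRoots-0 d≈0)
  ... | no d≉0 with find-root (λ y → y * y - d) (λ e → e ⟨*⟩ e ⟨-⟩ ≈-refl {d})
  ...   | inj₁ (s , e) = two (squareRoots-square {s} {d} (λ s≈0 → d≉0 (≈-trans (≈-sym (-≈0⇒≈ {s * s} {d} e)) (*-≈ʳ s s≈0))) (-≈0⇒≈ {s * s} {d} e))
  ...   | inj₂ ¬e = none (Σₚ-0 (λ y → δ-zero (¬e y)))

  δ-fermat : ∀ a → δ a ≈ 1ℤ - a ^ (p ∸ 1)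
  δ-fermat a = ≈-trans (≡⇒≈ (lemma (δ a))) (≈-refl {1ℤ} ⟨-⟩ ≈-sym (^-[p∸1] a))
    where
    lemma : ∀ d → d ≡ 1ℤ - (1ℤ - d)
    lemma = solve-∀

  -- Euler's criterion

  module _ (h : ℕ) (p∸1≡2h : p ∸ 1 ≡ 2 ℕ.* h) where

    -- By Fermat `δ` a ≡ 1 - a^(p-1). The expansion of (y² - d)^(2h) reaches degree 2 (p - 1),
    -- outside the range of `Σₚ-coefficient`: two power sums survive, at i = h and at i = 2h.
    squareRoots-power : ∀ d → squareRoots d ≈ 1ℤ + (- 1ℤ) ^ h * bin (2 ℕ.* h) h * d ^ h
    squareRoots-power d = begin
      squareRoots d
        ≈⟨ Σₚ-≈ (λ y → δ-fermat (y * y - d)) ⟩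
      Σₚ (λ y → 1ℤ - (y * y - d) ^ (p ∸ 1))
        ≡⟨ Σₚ-ext (λ y → trans (cong₂ (λ b n → 1ℤ - b ^ n) (lemma₁ y d) p∸1≡2h) (lemma₂ ((1ℤ * y ^ 2 + - d) ^ (2 ℕ.* h)))) ⟩
      Σₚ (λ y → 1ℤ + - 1ℤ * (y ^ 0 * (1ℤ * y ^ 2 + - d) ^ (2 ℕ.* h)))
        ≡⟨ trans (Σₚ-+ (λ _ → 1ℤ) (λ y → - 1ℤ * (y ^ 0 * (1ℤ * y ^ 2 + - d) ^ (2 ℕ.* h)))) (cong₂ _+_ Σₚ-1 (Σₚ-*ˡ (- 1ℤ) (λ y → y ^ 0 * (1ℤ * y ^ 2 + - d) ^ (2 ℕ.* h)))) ⟩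
      + p + - 1ℤ * Σₚ (λ y → y ^ 0 * (1ℤ * y ^ 2 + - d) ^ (2 ℕ.* h))
        ≡⟨ cong (λ z → + p + - 1ℤ * z) (Σₚ-expansion 0 2 (2 ℕ.* h) 1ℤ (- d)) ⟩
      + p + - 1ℤ * (∑ (2 ℕ.* h) g + g (2 ℕ.* h))
        ≈⟨ M≈0 ⟨+⟩ *-≈ˡ (- 1ℤ) (middle ⟨+⟩ top) ⟩
      0ℤ + - 1ℤ * (- (K * d ^ h) + - 1ℤ)
        ≡⟨ lemma₃ (K * d ^ h) ⟩
      1ℤ + K * d ^ h ∎
      where
      K : ℤ
      K = (- 1ℤ) ^ h * bin (2 ℕ.* h) h
      lemma₁ : ∀ y d → y * y - d ≡ 1ℤ * (y * (y * 1ℤ)) + - d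
      lemma₁ = solve-∀
      lemma₂ : ∀ a → 1ℤ - a ≡ 1ℤ + - 1ℤ * (1ℤ * a)
      lemma₂ = solve-∀
      lemma₃ : ∀ a → 0ℤ + - 1ℤ * (- a + - 1ℤ) ≡ 1ℤ + a
      lemma₃ = solve-∀
      lemma₄ : ∀ b s d → b * (1ℤ * (s * d)) * - 1ℤ ≡ - (s * b * d)
      lemma₄ = solve-∀
      g : ℕ → ℤ
      g i = bin (2 ℕ.* h) i * (1ℤ ^ i * (- d) ^ (2 ℕ.* h ∸ i)) * powerSum (2 ℕ.* i)
      bound : ∀ {i} → i ℕ.< 2 ℕ.* h → 2 ℕ.* i ℕ.< (p ∸ 1) ℕ.+ (p ∸ 1)
      bound {i} i<2h = subst₂ ℕ._<_ (cong (i ℕ.+_) (sym (ℕₚ.+-identityʳ i))) (sym (cong₂ ℕ._+_ p∸1≡2h p∸1≡2h)) (ℕₚ.+-mono-< i<2h i<2h)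
      top : g (2 ℕ.* h) ≈ - 1ℤ
      top = begin
        g (2 ℕ.* h)
          ≡⟨ cong₂ (λ u v → u * (v * (- d) ^ (2 ℕ.* h ∸ 2 ℕ.* h)) * powerSum (2 ℕ.* (2 ℕ.* h))) (bin-diag (2 ℕ.* h)) (^-zeroˡ (2 ℕ.* h)) ⟩
        1ℤ * (1ℤ * (- d) ^ (2 ℕ.* h ∸ 2 ℕ.* h)) * powerSum (2 ℕ.* (2 ℕ.* h))
          ≡⟨ cong₂ (λ u v → 1ℤ * (1ℤ * (- d) ^ u) * powerSum v) (ℕₚ.n∸n≡0 (2 ℕ.* h))
               (trans (cong (2 ℕ.* h ℕ.+_) (ℕₚ.+-identityʳ (2 ℕ.* h))) (cong₂ ℕ._+_ (sym p∸1≡2h) (trans (sym p∸1≡2h) (sym (ℕₚ.m+[n∸m]≡n (ℕₚ.<⇒≤ 1<p∸1)))))) ⟩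
        1ℤ * powerSum ((p ∸ 1) ℕ.+ suc (p ∸ 1 ∸ 1))
          ≡⟨ *-identityˡ _ ⟩
        powerSum ((p ∸ 1) ℕ.+ suc (p ∸ 1 ∸ 1))
          ≈⟨ powerSum-periodic (p ∸ 1 ∸ 1) ⟩
        powerSum (suc (p ∸ 1 ∸ 1))
          ≡⟨ cong powerSum (ℕₚ.m+[n∸m]≡n (ℕₚ.<⇒≤ 1<p∸1)) ⟩
        powerSum (p ∸ 1)
          ≈⟨ powerSum-[p∸1] ⟩
        - 1ℤ ∎
      h<2h : h ℕ.< 2 ℕ.* h
      h<2h = ℕₚ.m<m+n h (subst (0 ℕ.<_) (sym (ℕₚ.+-identityʳ h)) (0<h h p∸1≡2h))
      middle : ∑ (2 ℕ.* h) g ≈ - (K * d ^ h)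
      middle = begin
        ∑ (2 ℕ.* h) g
          ≈⟨ ∑-≈-single (2 ℕ.* h) g h h<2h (λ i i<2h i≢h → *-powerSum-zero (bin (2 ℕ.* h) i * (1ℤ ^ i * (- d) ^ (2 ℕ.* h ∸ i))) (2 ℕ.* i) (bound i<2h) (λ eq → i≢h (ℕₚ.*-cancelˡ-≡ i h 2 (trans eq p∸1≡2h)))) ⟩
        bin (2 ℕ.* h) h * (1ℤ ^ h * (- d) ^ (2 ℕ.* h ∸ h)) * powerSum (2 ℕ.* h)
          ≈⟨ *-≈ˡ (bin (2 ℕ.* h) h * (1ℤ ^ h * (- d) ^ (2 ℕ.* h ∸ h))) (≈-trans (≡⇒≈ (cong powerSum (sym p∸1≡2h))) powerSum-[p∸1]) ⟩
        bin (2 ℕ.* h) h * (1ℤ ^ h * (- d) ^ (2 ℕ.* h ∸ h)) * - 1ℤ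
          ≡⟨ cong₂ (λ u v → bin (2 ℕ.* h) h * (u * v) * - 1ℤ) (^-zeroˡ h)
               (trans (cong₂ _^_ (sym (-1*i≡-i d)) (trans (ℕₚ.m+n∸m≡n h (h ℕ.+ 0)) (ℕₚ.+-identityʳ h))) (^-distribʳ-* (- 1ℤ) d h)) ⟩
        bin (2 ℕ.* h) h * (1ℤ * ((- 1ℤ) ^ h * d ^ h)) * - 1ℤ
          ≡⟨ lemma₄ (bin (2 ℕ.* h) h) ((- 1ℤ) ^ h) (d ^ h) ⟩
        - (K * d ^ h) ∎

    -- The constant left open by `squareRoots-power` is calibrated at d = 1, in place of an appeal
    -- to Wilson's theorem.
    squareRoots-euler : ∀ d → squareRoots d ≈ 1ℤ + d ^ h
    squareRoots-euler d = ≈-trans (squareRoots-power d) (+-≈ˡ 1ℤ (≈-trans (*-≈ʳ (d ^ h) leading) (≡⇒≈ (*-identityˡ (d ^ h)))))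
      where
      K : ℤ
      K = (- 1ℤ) ^ h * bin (2 ℕ.* h) h
      lemma : ∀ a b → a - b ≡ 1ℤ * (1ℤ + a - (1ℤ + b))
      lemma = solve-∀
      -- 1 has exactly two square roots.
      leading : K ≈ 1ℤ
      leading = ≈-by 1ℤ (lemma K 1ℤ) (≈⇒-≈0 (≈-trans
        (≡⇒≈ (cong (λ z → 1ℤ + z) (sym (trans (cong (K *_) (^-zeroˡ h)) (*-identityʳ K)))))
        (≈-trans (≈-sym (squareRoots-power 1ℤ)) (≡⇒≈ (squareRoots-square {1ℤ} {1ℤ} 1≉0 ≈-refl)))))

  -- Points on y² = x³ + c and their moments

  -- A unit y admits one w; for y = 0 either every w or none works, according to d. The right side
  -- encodes these cases through `δ`.
  Σₚ-hyperbola : ∀ d y → Σₚ (λ w → δ (y * w - d)) ≡ 1ℤ + - 1ℤ * δ y + + p * δ d * δ y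
  Σₚ-hyperbola d y with y ≈? 0ℤ
  ... | yes y≈0 = trans (Σₚ-ext (λ w → δ-iff (λ e → ≈-trans (lemma₁ w) (≈-neg e)) (λ e → ≈-trans (*-≈ʳ w y≈0 ⟨-⟩ e) ≈-refl)))
      (trans (Σₚ-const (δ d)) (trans (lemma₂ (+ p * δ d)) (cong (λ z → 1ℤ + - 1ℤ * z + + p * δ d * z) (sym (δ-one y≈0)))))
    where
    lemma₂ : ∀ a → a ≡ 1ℤ + - 1ℤ * 1ℤ + a * 1ℤ
    lemma₂ = solve-∀
    lemma₃ : ∀ y w d → d - - (y * w - d) ≡ w * y
    lemma₃ = solve-∀
    lemma₁ : ∀ w → d ≈ - (y * w - d)
    lemma₁ w = ≈-by w (lemma₃ y w d) y≈0
  ... | no y≉0 = trans (Σₚ-scale (λ w → δ (w - d)) y (λ e → δ-resp (+-≈ʳ (- d) e)) y≉0)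
      (trans (Σₚ-δ d) (trans (lemma₂ (+ p * δ d)) (cong (λ z → 1ℤ + - 1ℤ * z + + p * δ d * z) (sym (δ-zero y≉0)))))
    where
    lemma₂ : ∀ a → 1ℤ ≡ 1ℤ + - 1ℤ * 0ℤ + a * 0ℤ
    lemma₂ = solve-∀

  -- y² − w² = (y − w)(y + w), and y − w, y + w are independent variables.
  Σₚ-differenceOfSquares : ∀ d → Σₚ (λ w → Σₚ (λ y → δ (y * y - w * w - d))) ≡ + p - 1ℤ + + p * δ d
  Σₚ-differenceOfSquares d = ≡.begin
    Σₚ (λ w → Σₚ (λ y → δ (y * y - w * w - d)))
      ≡.≡⟨ Σₚ-ext (λ w → sym (Σₚ-shift (λ y → δ (y * y - w * w - d)) w (λ e → δ-resp (+-≈ʳ (- d) (+-≈ʳ (- (w * w)) (e ⟨*⟩ e)))))) ⟩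
    Σₚ (λ w → Σₚ (λ y → δ ((y + w) * (y + w) - w * w - d)))
      ≡.≡⟨ Σₚ-ext (λ w → Σₚ-ext (λ y → δ-resp (≡⇒≈ (lemma₁ y w d)))) ⟩
    Σₚ (λ w → Σₚ (λ y → δ (y * (+ 2 * w + y) - d)))
      ≡.≡⟨ Σₚ-swap (λ w y → δ (y * (+ 2 * w + y) - d)) ⟩
    Σₚ (λ y → Σₚ (λ w → δ (y * (+ 2 * w + y) - d)))
      ≡.≡⟨ Σₚ-ext (λ y → Σₚ-affine (λ w → δ (y * w - d)) (+ 2) y (λ e → δ-resp (+-≈ʳ (- d) (*-≈ˡ y e))) 2≉0) ⟩
    Σₚ (λ y → Σₚ (λ w → δ (y * w - d)))
      ≡.≡⟨ Σₚ-ext (Σₚ-hyperbola d) ⟩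
    Σₚ (λ y → 1ℤ + - 1ℤ * δ y + + p * δ d * δ y)
      ≡.≡⟨ trans (Σₚ-+ (λ y → 1ℤ + - 1ℤ * δ y) (λ y → + p * δ d * δ y)) (cong₂ _+_
            (trans (Σₚ-+ (λ _ → 1ℤ) (λ y → - 1ℤ * δ y)) (cong₂ _+_ Σₚ-1 (trans (Σₚ-*ˡ (- 1ℤ) δ) (cong (- 1ℤ *_) Σₚ-δ0))))
            (trans (Σₚ-*ˡ (+ p * δ d) δ) (cong (+ p * δ d *_) Σₚ-δ0))) ⟩
    + p + - 1ℤ * 1ℤ + + p * δ d * 1ℤ
      ≡.≡⟨ lemma₂ (+ p) (+ p * δ d) ⟩
    + p - 1ℤ + + p * δ d ≡.∎
    where
    module ≡ = ≡-Reasoning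
    lemma₁ : ∀ y w d → (y + w) * (y + w) - w * w - d ≡ y * (+ 2 * w + y) - d
    lemma₁ = solve-∀
    lemma₂ : ∀ a b → a + - 1ℤ * 1ℤ + b * 1ℤ ≡ a - 1ℤ + b
    lemma₂ = solve-∀

  -- `points` counts affine points, so `defect c`, the E(c) of the overview, is minus the trace of
  -- Frobenius of the curve when c is a unit.
  points defect : ℤ → ℤ
  points c = Σₚ (λ x → squareRoots (x * x * x + c))
  defect c = points c - + p

  points-resp : Respects points
  points-resp e = Σₚ-ext (λ x → squareRoots-resp (+-≈ˡ (x * x * x) e))

  defect-resp : Respects defect
  defect-resp e = cong (_- + p) (points-resp e)

  Σₚ-points : Σₚ points ≡ + p * + p
  Σₚ-points = trans (Σₚ-swap (λ c x → squareRoots (x * x * x + c))) (trans (Σₚ-ext (λ x →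
      trans (Σₚ-ext (λ c → squareRoots-resp (≡⇒≈ (ℤₚ.+-comm (x * x * x) c)))) (trans (Σₚ-shift squareRoots (x * x * x) squareRoots-resp) Σₚ-squareRoots)))
    (Σₚ-const (+ p)))

  -- For a unit x, x³ = x² x has as many square roots as x, so the cuspidal cubic has as many affine
  -- points as the line.
  points-0 : points 0ℤ ≡ + p
  points-0 = trans (Σₚ-ext curve) Σₚ-squareRoots
    where
    curve : ∀ x → squareRoots (x * x * x + 0ℤ) ≡ squareRoots x
    curve x with x ≈? 0ℤ
    ... | yes x≈0 = squareRoots-resp (≈-trans (≈-trans (≡⇒≈ (+-identityʳ (x * x * x))) (*-≈ˡ (x * x) x≈0)) (≈-trans (≡⇒≈ (*-zeroʳ (x * x))) (≈-sym x≈0)))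
    ... | no x≉0 = trans (squareRoots-resp (≡⇒≈ (+-identityʳ (x * x * x)))) (squareRoots-scale x x x≉0)

  defect-0 : ∀ {c} → c ≈ 0ℤ → defect c ≡ 0ℤ
  defect-0 e = trans (defect-resp e) (trans (cong (_- + p) points-0) (+-inverseʳ (+ p)))

  -- For fixed x the equation y² - t² = x³ is a hyperbola with p - 1 points, and p more when x = 0.
  -- The total p² is the average.
  Σₚ-defect-squares : Σₚ (λ t → defect (t * t)) ≡ 0ℤ
  Σₚ-defect-squares = ≡.begin
    Σₚ (λ t → points (t * t) + - + p)
      ≡.≡⟨ trans (Σₚ-+ (λ t → points (t * t)) (λ _ → - + p)) (cong (λ z → Σₚ (λ t → points (t * t)) + z) (Σₚ-const (- + p))) ⟩
    Σₚ (λ t → Σₚ (λ x → Σₚ (λ y → δ (y * y - (x * x * x + t * t))))) + + p * - + p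
      ≡.≡⟨ cong (_+ + p * - + p) (Σₚ-swap (λ t x → Σₚ (λ y → δ (y * y - (x * x * x + t * t))))) ⟩
    Σₚ (λ x → Σₚ (λ t → Σₚ (λ y → δ (y * y - (x * x * x + t * t))))) + + p * - + p
      ≡.≡⟨ cong (_+ + p * - + p) (Σₚ-ext (λ x → trans (Σₚ-ext (λ t → Σₚ-ext (λ y → δ-resp (≡⇒≈ (lemma₁ x y t)))))
             (trans (Σₚ-differenceOfSquares (x * x * x)) (cong (λ z → + p - 1ℤ + + p * z) (δ-cube x))))) ⟩
    Σₚ (λ x → + p - 1ℤ + + p * δ x) + + p * - + p
      ≡.≡⟨ cong (_+ + p * - + p) (trans (Σₚ-+ (λ _ → + p - 1ℤ) (λ x → + p * δ x)) (cong₂ _+_ (Σₚ-const (+ p - 1ℤ)) (trans (Σₚ-*ˡ (+ p) δ) (cong (+ p *_) Σₚ-δ0)))) ⟩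
    + p * (+ p - 1ℤ) + + p * 1ℤ + + p * - + p
      ≡.≡⟨ lemma₂ (+ p) ⟩
    0ℤ ≡.∎
    where
    module ≡ = ≡-Reasoning
    lemma₁ : ∀ x y t → y * y - (x * x * x + t * t) ≡ y * y - t * t - x * x * x
    lemma₁ = solve-∀
    lemma₂ : ∀ a → a * (a - 1ℤ) + a * 1ℤ + a * - a ≡ 0ℤ
    lemma₂ = solve-∀

  -- The square counts pairs (x, y), (u, v) on the same curve. Eliminating c leaves v² - y² = u³ -
  -- x³, a difference of squares for fixed x and u.
  Σₚ-points² : Σₚ (λ c → points c * points c) ≡ Σₚ (λ x → Σₚ (λ u → + p - 1ℤ + + p * δ (u * u * u - x * x * x)))
  Σₚ-points² = ≡.begin
    Σₚ (λ c → points c * points c)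
      ≡.≡⟨ Σₚ-ext (λ c → trans (sym (Σₚ-*ʳ (points c) (λ x → squareRoots (x * x * x + c))))
             (Σₚ-ext (λ x → sym (Σₚ-*ʳ (points c) (λ y → δ (y * y - (x * x * x + c))))))) ⟩
    Σₚ (λ c → Σₚ (λ x → Σₚ (λ y → δ (y * y - (x * x * x + c)) * points c)))
      ≡.≡⟨ Σₚ-swap (λ c x → Σₚ (λ y → δ (y * y - (x * x * x + c)) * points c)) ⟩
    Σₚ (λ x → Σₚ (λ c → Σₚ (λ y → δ (y * y - (x * x * x + c)) * points c)))
      ≡.≡⟨ Σₚ-ext (λ x → Σₚ-swap (λ c y → δ (y * y - (x * x * x + c)) * points c)) ⟩
    Σₚ (λ x → Σₚ (λ y → Σₚ (λ c → δ (y * y - (x * x * x + c)) * points c)))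
      ≡.≡⟨ Σₚ-ext (λ x → Σₚ-ext (λ y → trans (Σₚ-ext (λ c → cong (_* points c) (trans (δ-resp (≡⇒≈ (lemma₁ x y c))) (δ-neg (y * y - x * x * x) c))))
             (Σₚ-pick points points-resp (y * y - x * x * x)))) ⟩
    Σₚ (λ x → Σₚ (λ y → points (y * y - x * x * x)))
      ≡.≡⟨ Σₚ-ext (λ x → Σₚ-swap (λ y u → squareRoots (u * u * u + (y * y - x * x * x)))) ⟩
    Σₚ (λ x → Σₚ (λ u → Σₚ (λ y → Σₚ (λ v → δ (v * v - (u * u * u + (y * y - x * x * x)))))))
      ≡.≡⟨ Σₚ-ext (λ x → Σₚ-ext (λ u → trans (Σₚ-ext (λ y → Σₚ-ext (λ v → δ-resp (≡⇒≈ (lemma₂ x u y v)))))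
             (Σₚ-differenceOfSquares (u * u * u - x * x * x)))) ⟩
    Σₚ (λ x → Σₚ (λ u → + p - 1ℤ + + p * δ (u * u * u - x * x * x))) ≡.∎
    where
    module ≡ = ≡-Reasoning
    lemma₁ : ∀ x y c → y * y - (x * x * x + c) ≡ y * y - x * x * x - c
    lemma₁ = solve-∀
    lemma₂ : ∀ x u y v → v * v - (u * u * u + (y * y - x * x * x)) ≡ v * v - y * y - (u * u * u - x * x * x)
    lemma₂ = solve-∀

  -- Divisibility of weighted counts

  ∑-∣ : ∀ k n f → (∀ i → k Signed.∣ f i) → k Signed.∣ ∑ n f
  ∑-∣ k zero    f d = Signed.divides 0ℤ refl
  ∑-∣ k (suc n) f d = Signed.∣m∣n⇒∣m+n (∑-∣ k n f d) (d n)

  Σₚ-∣ : ∀ {k f} → (∀ x → k Signed.∣ f x) → k Signed.∣ Σₚ f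
  Σₚ-∣ {k} {f} d = subst (k Signed.∣_) (sym (Σₚ-def f)) (∑-∣ k p (λ i → f (+ i)) (λ i → d (+ i)))

  -- Orbit counting in terms of fibres: ρ will be `squareRoots` with k = 2 or `cubeRoots` with k =
  -- 3. The fibres over units have size divisible by k, so modulo k only the fibre over 0 remains.
  Σₚ-weighted-∣ : ∀ {k} (ρ φ : ℤ → ℤ) → Respects φ → (∀ {a} → a ≈ 0ℤ → ρ a ≡ 1ℤ) → (∀ {a} → a ≉ 0ℤ → k Signed.∣ ρ a) →
    k Signed.∣ Σₚ (λ a → ρ a * φ a) - φ 0ℤ
  Σₚ-weighted-∣ {k} ρ φ φ-resp ρ-0 ρ-∣ = subst (k Signed.∣_) total (Σₚ-∣ term)
    where
    lemma₁ : ∀ a → 1ℤ * a + - a * 1ℤ ≡ 0ℤ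
    lemma₁ = solve-∀
    lemma₂ : ∀ a b → a + - b * 0ℤ ≡ a
    lemma₂ = solve-∀
    lemma₃ : ∀ a b → a + - b * 1ℤ ≡ a - b
    lemma₃ = solve-∀
    term : ∀ a → k Signed.∣ ρ a * φ a + - φ 0ℤ * δ a
    term a = by-cases a
      (λ e → Signed.divides 0ℤ (trans (cong₂ _+_ (cong₂ _*_ (ρ-0 e) (φ-resp e)) (cong (- φ 0ℤ *_) (δ-one e))) (lemma₁ (φ 0ℤ))))
      (λ ne → subst (k Signed.∣_) (sym (trans (cong (λ z → ρ a * φ a + - φ 0ℤ * z) (δ-zero ne)) (lemma₂ (ρ a * φ a) (φ 0ℤ))))
                (Signed.∣m⇒∣m*n (φ a) (ρ-∣ ne)))
    total : Σₚ (λ a → ρ a * φ a + - φ 0ℤ * δ a) ≡ Σₚ (λ a → ρ a * φ a) - φ 0ℤ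
    total = trans (Σₚ-+ (λ a → ρ a * φ a) (λ a → - φ 0ℤ * δ a))
      (trans (cong (λ z → Σₚ (λ a → ρ a * φ a) + z) (trans (Σₚ-*ˡ (- φ 0ℤ) δ) (cong (- φ 0ℤ *_) Σₚ-δ0))) (lemma₃ (Σₚ (λ a → ρ a * φ a)) (φ 0ℤ)))

  squareRoots-even : ∀ {d} → d ≉ 0ℤ → + 2 Signed.∣ squareRoots d
  squareRoots-even {d} d≉0 with squareRootCount d
  ... | none e = Signed.divides 0ℤ e
  ... | one d≈0 _ = ⊥-elim (d≉0 d≈0)
  ... | two e = Signed.divides 1ℤ e

  cubeRoots-scale : ∀ t d → t ≉ 0ℤ → cubeRoots (t * t * t * d) ≡ cubeRoots d
  cubeRoots-scale t d t≉0 = trans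
    (sym (Σₚ-scale (λ s → δ (s * s * s - t * t * t * d)) t (λ e → δ-resp (cube-≈ e ⟨-⟩ ≈-refl {t * t * t * d})) t≉0))
    (Σₚ-ext (λ s → trans (δ-resp (≡⇒≈ (lemma t s d))) (δ-scale (t * t * t) (*-≉0 {t * t} {t} (*-≉0 {t} {t} t≉0 t≉0) t≉0))))
    where
    lemma : ∀ t s d → t * s * (t * s) * (t * s) - t * t * t * d ≡ t * t * t * (s * s * s - d)
    lemma = solve-∀

  no-cubeRoots : ∀ {d} → cubeRoots d ≡ 0ℤ → d ≉ 0ℤ
  no-cubeRoots e d≈0 with trans (sym e) (cubeRoots-0 d≈0)
  ... | ()

  inverse-≉0 : ∀ {a b} → a * b ≈ 1ℤ → a ≉ 0ℤ
  inverse-≉0 {a} {b} ab≈1 a≈0 = 1≉0 (≈-trans (≈-sym ab≈1) (≈-trans (*-≈ʳ b a≈0) (≡⇒≈ (*-zeroˡ b))))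

  Σₚ-unit : ∀ a → Σₚ (λ t → (1ℤ - δ t) * a) ≡ (+ p - 1ℤ) * a
  Σₚ-unit a = trans (Σₚ-*ʳ a (λ t → 1ℤ - δ t)) (cong (_* a)
    (trans (Σₚ-ext (λ t → cong (λ z → 1ℤ + z) (sym (-1*i≡-i (δ t)))))
    (trans (Σₚ-+ (λ _ → 1ℤ) (λ t → - 1ℤ * δ t)) (cong₂ _+_ Σₚ-1 (trans (Σₚ-*ˡ (- 1ℤ) δ) (cong (- 1ℤ *_) Σₚ-δ0))))))

  -- Cubic residues and cube roots for p = 6m + 1

  module OneModSix (m : ℕ) (p∸1≡6m : p ∸ 1 ≡ 6 ℕ.* m) where

    0<m : 0 ℕ.< m
    0<m = ℕₚ.n≢0⇒n>0 (λ m≡0 → ℕₚ.<⇒≢ (ℕₚ.<⇒≤ 1<p∸1) (sym (trans p∸1≡6m (cong (6 ℕ.*_) m≡0))))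

    p≡1+6m : + p ≡ 1ℤ + + 6 * + m
    p≡1+6m = trans (cong +_ (p≡1+ p∸1≡6m)) (cong (λ z → 1ℤ + z) (pos-* 6 m))

    p∸1≡2[3m] : p ∸ 1 ≡ 2 ℕ.* (3 ℕ.* m)
    p∸1≡2[3m] = trans p∸1≡6m (ℕₚ.*-assoc 2 3 m)

    p∸1≡[2m]3 : p ∸ 1 ≡ 2 ℕ.* m ℕ.* 3
    p∸1≡[2m]3 = trans p∸1≡6m (trans (ℕₚ.*-assoc 3 2 m) (ℕₚ.*-comm 3 (2 ℕ.* m)))

    4<p : 4 ℕ.< p
    4<p = subst (4 ℕ.<_) (sym (p≡1+ p∸1≡6m)) (s≤s (ℕₚ.≤-trans (s≤s (s≤s (s≤s (s≤s z≤n)))) (ℕₚ.*-monoʳ-≤ 6 0<m)))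

    2m<p∸1 : 2 ℕ.* m ℕ.< p ∸ 1
    2m<p∸1 = subst (2 ℕ.* m ℕ.<_) (sym p∸1≡6m) (ℕₚ.*-monoˡ-< m {{ℕ.>-nonZero 0<m}} 2<6)
      where
      2<6 : 2 ℕ.< 6
      2<6 = s≤s (s≤s (s≤s z≤n))

    -- The cubic residue symbol a^((p-1)/3), with values modulo p.
    cubicResidue : ℤ → ℤ
    cubicResidue a = a ^ (2 ℕ.* m)

    cubicResidue-* : ∀ a b → cubicResidue (a * b) ≡ cubicResidue a * cubicResidue b
    cubicResidue-* a b = ^-distribʳ-* a b (2 ℕ.* m)

    cubicResidue-1 : cubicResidue 1ℤ ≡ 1ℤ
    cubicResidue-1 = ^-zeroˡ (2 ℕ.* m)

    cubicResidue-cubed : ∀ {a} → a ≉ 0ℤ → cubicResidue a ^ 3 ≈ 1ℤ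
    cubicResidue-cubed {a} a≉0 = ≈-trans (≡⇒≈ (trans (^-*-assoc a (2 ℕ.* m) 3) (cong (a ^_) (sym p∸1≡[2m]3)))) (fermat-unit a≉0)

    cubicResidue-cube : ∀ {a} → a ≉ 0ℤ → cubicResidue (a * a * a) ≈ 1ℤ
    cubicResidue-cube {a} a≉0 = ≈-trans (≡⇒≈ (trans (trans (cubicResidue-* (a * a) a) (cong (_* cubicResidue a) (cubicResidue-* a a))) (lemma (cubicResidue a)))) (cubicResidue-cubed a≉0)
      where
      lemma : ∀ a → a * a * a ≡ a * (a * (a * 1ℤ))
      lemma = solve-∀

    -- If x^(2m) ≡ 1 held for every unit, the sum of 2m-th powers would be p - 1 ≡ -1; but it
    -- vanishes, as 0 < 2m < p - 1.
    nonCube : ∃ λ g → g ≉ 0ℤ × cubicResidue g ≉ 1ℤ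
    nonCube = split (find-root f f-resp)
      where
      f : ℤ → ℤ
      -- `find-root` looks for zeros, and `δ` turns the wanted condition x (x^(2m) - 1) ≢ 0 into
      -- one.
      f x = δ (x * (cubicResidue x - 1ℤ))
      f-resp : ∀ {a b} → a ≈ b → f a ≈ f b
      f-resp e = ≡⇒≈ (δ-resp (e ⟨*⟩ +-≈ʳ (- 1ℤ) (≈-^ (2 ℕ.* m) e)))
      power : (∀ x → f x ≉ 0ℤ) → ∀ x → cubicResidue x ≈ 1ℤ - δ x
      power ¬root x with x ≈? 0ℤ
      ... | yes e = ≈-trans (≈-^ (2 ℕ.* m) e) (≡⇒≈ (trans (zero^ (ℕₚ.≤-trans 0<m (ℕₚ.m≤m+n m (m ℕ.+ 0)))) (sym (cong (_-_ 1ℤ) (δ-one e)))))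
        where
        zero^ : ∀ {n} → 0 ℕ.< n → 0ℤ ^ n ≡ 0ℤ
        zero^ (s≤s _) = refl
      ... | no ne with (x * (cubicResidue x - 1ℤ)) ≈? 0ℤ
      ...   | yes e = ≈-trans (-≈0⇒≈ (*-≈0-right x (cubicResidue x - 1ℤ) ne e)) (≡⇒≈ (sym (cong (_-_ 1ℤ) (δ-zero ne))))
      ...   | no ne′ = ⊥-elim (¬root x (≡⇒≈ (δ-zero ne′)))
      split : (∃ λ x → f x ≈ 0ℤ) ⊎ (∀ x → f x ≉ 0ℤ) → ∃ λ g → g ≉ 0ℤ × cubicResidue g ≉ 1ℤ
      split (inj₁ (x , e)) = x ,
        (λ x≈0 → 1≉0 (≈-trans (≡⇒≈ (sym (δ-one (*-≈ʳ (cubicResidue x - 1ℤ) x≈0)))) e)) ,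
        (λ r≈1 → 1≉0 (≈-trans (≡⇒≈ (sym (δ-one (*-≈0ˡ x (≈⇒-≈0 r≈1))))) e))
      split (inj₂ ¬root) = ⊥-elim (1≉0 (begin
        1ℤ ≡⟨⟩
        0ℤ - - 1ℤ ≈⟨ ≈-sym (powerSum-small (2 ℕ.* m) 2m<p∸1) ⟨-⟩ ≈-refl { - 1ℤ} ⟩
        powerSum (2 ℕ.* m) - - 1ℤ ≈⟨ +-≈ʳ (- - 1ℤ) (Σₚ-≈ (power ¬root)) ⟩
        Σₚ (λ x → 1ℤ - δ x) - - 1ℤ  ≡⟨ cong (_- - 1ℤ) (trans (Σₚ-ext (λ x → sym (*-identityʳ (1ℤ - δ x)))) (Σₚ-unit 1ℤ)) ⟩
        (+ p - 1ℤ) * 1ℤ - - 1ℤ ≈⟨ +-≈ʳ (- - 1ℤ) (*-≈ʳ 1ℤ (+-≈ʳ (- 1ℤ) M≈0)) ⟩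
        0ℤ ∎))

    g : ℤ
    g = proj₁ nonCube

    g≉0 : g ≉ 0ℤ
    g≉0 = proj₁ (proj₂ nonCube)

    ω : ℤ
    ω = cubicResidue g

    ω≉1 : ω ≉ 1ℤ
    ω≉1 = proj₂ (proj₂ nonCube)

    ω-minimal : ω * ω + ω + 1ℤ ≈ 0ℤ
    ω-minimal = *-≈0-right (ω - 1ℤ) (ω * ω + ω + 1ℤ) (λ e → ω≉1 (-≈0⇒≈ e))
      (≈-trans (≡⇒≈ (lemma ω)) (≈⇒-≈0 (cubicResidue-cubed g≉0)))
      where
      lemma : ∀ w → (w - 1ℤ) * (w * w + w + 1ℤ) ≡ w * (w * (w * 1ℤ)) - 1ℤ
      lemma = solve-∀

    θ : ℤ
    θ = + 2 * ω + 1ℤ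

    θ² : θ * θ ≈ - + 3
    θ² = ≈-by (+ 4) (lemma ω) ω-minimal
      where
      lemma : ∀ w → (+ 2 * w + 1ℤ) * (+ 2 * w + 1ℤ) - - + 3 ≡ + 4 * (w * w + w + 1ℤ)
      lemma = solve-∀

    θ≉0 : θ ≉ 0ℤ
    θ≉0 e = 3≉0 (≈-trans (≈-neg (≈-sym θ²)) (≈-neg (*-≈ʳ θ e)))

    -- t³ - 1 splits as (t - 1)(t - ω)(t - ω²), and the factors have no common root because 3 is a
    -- unit.
    cubeRoots-1 : cubeRoots 1ℤ ≡ + 3
    cubeRoots-1 = trans (Σₚ-ext (λ t → trans (δ-resp (≈-by (t * t - ω * t + ω - 1ℤ) (lemma₁ t ω) ω-minimal))
        (trans (δ-product (t - 1ℤ) ((t - ω) * (t - ω * ω)) (disjoint₁ t))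
               (cong (λ z → δ (t - 1ℤ) + z) (δ-product (t - ω) (t - ω * ω) (disjoint₂ t))))))
      (trans (Σₚ-+ (λ t → δ (t - 1ℤ)) (λ t → δ (t - ω) + δ (t - ω * ω)))
        (cong₂ _+_ (Σₚ-δ 1ℤ) (trans (Σₚ-+ (λ t → δ (t - ω)) (λ t → δ (t - ω * ω))) (cong₂ _+_ (Σₚ-δ ω) (Σₚ-δ (ω * ω))))))
      where
      lemma₁ : ∀ t w → t * t * t - 1ℤ - (t - 1ℤ) * ((t - w) * (t - w * w)) ≡ (t * t - w * t + w - 1ℤ) * (w * w + w + 1ℤ)
      lemma₁ = solve-∀
      -- Bézout identities: a common root of two of the factors would give 3 ≡ 0.
      lemma₂ : ∀ t w → + 3 ≡ (t - w) * (t - w * w) - (t + 1ℤ - w - w * w) * (t - 1ℤ) - (w - + 2) * (w * w + w + 1ℤ)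
      lemma₂ = solve-∀
      lemma₃ : ∀ t w → + 3 ≡ (+ 3 - + 2 * w) * (w * w + w + 1ℤ) + (+ 2 * w + 1ℤ) * ((t - w) - (t - w * w))
      lemma₃ = solve-∀
      zero-sum : ∀ a b → a * 0ℤ + b * 0ℤ ≡ 0ℤ
      zero-sum = solve-∀
      zero-difference : ∀ a b → 0ℤ - a * 0ℤ - b * 0ℤ ≡ 0ℤ
      zero-difference = solve-∀
      disjoint₁ : ∀ t → t - 1ℤ ≈ 0ℤ → (t - ω) * (t - ω * ω) ≉ 0ℤ
      disjoint₁ t e₁ e₂ = 3≉0 (≈-trans (≡⇒≈ (lemma₂ t ω))
        (≈-trans (e₂ ⟨-⟩ *-≈ˡ (t + 1ℤ - ω - ω * ω) e₁ ⟨-⟩ *-≈ˡ (ω - + 2) ω-minimal) (≡⇒≈ (zero-difference (t + 1ℤ - ω - ω * ω) (ω - + 2)))))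
      disjoint₂ : ∀ t → t - ω ≈ 0ℤ → t - ω * ω ≉ 0ℤ
      disjoint₂ t e₁ e₂ = 3≉0 (≈-trans (≡⇒≈ (lemma₃ t ω))
        (≈-trans (*-≈ˡ (+ 3 - + 2 * ω) ω-minimal ⟨+⟩ *-≈ˡ (+ 2 * ω + 1ℤ) (e₁ ⟨-⟩ e₂)) (≡⇒≈ (zero-sum (+ 3 - + 2 * ω) (+ 2 * ω + 1ℤ)))))

    cubeRoots-cube : ∀ {s d} → s ≉ 0ℤ → s * s * s ≈ d → cubeRoots d ≡ + 3
    cubeRoots-cube {s} s≉0 e = trans (cubeRoots-resp (≈-trans (≈-sym e) (≡⇒≈ (sym (*-identityʳ (s * s * s))))))
      (trans (cubeRoots-scale s 1ℤ s≉0) cubeRoots-1)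

    data CubeRootCount (d : ℤ) : Set where
      none  : cubeRoots d ≡ 0ℤ → CubeRootCount d
      one : d ≈ 0ℤ → CubeRootCount d
      three : ∀ s → s ≉ 0ℤ → s * s * s ≈ d → CubeRootCount d

    cubeRootCount : ∀ d → CubeRootCount d
    cubeRootCount d with d ≈? 0ℤ
    ... | yes d≈0 = one d≈0
    ... | no d≉0 with find-root (λ s → s * s * s - d) (λ e → cube-≈ e ⟨-⟩ ≈-refl {d})
    ...   | inj₁ (s , e) = three s (λ s≈0 → d≉0 (≈-trans (≈-sym s³≈d) (*-≈0ˡ (s * s) s≈0))) s³≈d
      where
      s³≈d : s * s * s ≈ d
      s³≈d = -≈0⇒≈ e
    ...   | inj₂ ¬e = none (Σₚ-0 (λ s → δ-zero (¬e s)))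

    cubicResidue-root : ∀ {s d} → s ≉ 0ℤ → s * s * s ≈ d → cubicResidue d ≈ 1ℤ
    cubicResidue-root s≉0 e = ≈-trans (≈-^ (2 ℕ.* m) (≈-sym e)) (cubicResidue-cube s≉0)

    module _ (γ : ℤ) (γ≉0 : γ ≉ 0ℤ) (γ-nonCube : cubicResidue γ ≉ 1ℤ) (γ²-nonCube : cubicResidue (γ * γ) ≉ 1ℤ) where

      -- If two of c, γ c, γ² c were cubes of units, γ or γ² would have trivial residue symbol. So
      -- for a unit c at most one of them contributes, and it contributes 3; for c = 0 each
      -- contributes 1. Only the implication from being a cube to having trivial symbol is used,
      -- hence an inequality.
      cubeRoots-cosets≤3 : ∀ c → 0ℤ ℤ.≤ + 3 - (cubeRoots c + cubeRoots (γ * c) + cubeRoots (γ * γ * c))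
      cubeRoots-cosets≤3 c with cubeRootCount c | cubeRootCount (γ * c) | cubeRootCount (γ * γ * c)
      ... | one c≈0 | _ | _ = ℤₚ.≤-reflexive (sym (cong (_-_ (+ 3)) (cong₂ _+_ (cong₂ _+_ (cubeRoots-0 c≈0)
              (cubeRoots-0 (*-≈0ˡ γ c≈0))) (cubeRoots-0 (*-≈0ˡ (γ * γ) c≈0)))))
      ... | three s s≉0 e | three s′ s′≉0 e′ | _ = ⊥-elim (γ-nonCube
              (≈-trans (≡⇒≈ (sym (*-identityʳ (cubicResidue γ)))) (≈-trans (*-≈ˡ (cubicResidue γ) (≈-sym (cubicResidue-root s≉0 e)))
              (≈-trans (≡⇒≈ (sym (cubicResidue-* γ c))) (cubicResidue-root s′≉0 e′)))))
      ... | three s s≉0 e | _ | three s′ s′≉0 e′ = ⊥-elim (γ²-nonCube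
              (≈-trans (≡⇒≈ (sym (*-identityʳ (cubicResidue (γ * γ))))) (≈-trans (*-≈ˡ (cubicResidue (γ * γ)) (≈-sym (cubicResidue-root s≉0 e)))
              (≈-trans (≡⇒≈ (sym (cubicResidue-* (γ * γ) c))) (cubicResidue-root s′≉0 e′)))))
      ... | _ | three s s≉0 e | three s′ s′≉0 e′ = ⊥-elim (γ-nonCube
              (≈-trans (≡⇒≈ (sym (*-identityʳ (cubicResidue γ)))) (≈-trans (*-≈ˡ (cubicResidue γ) (≈-sym (cubicResidue-root s≉0 e)))
              (≈-trans (≡⇒≈ (trans (sym (cubicResidue-* γ (γ * c))) (cong cubicResidue (sym (ℤₚ.*-assoc γ γ c))))) (cubicResidue-root s′≉0 e′)))))
      ... | none n₁ | none n₂ | none n₃ = ℤₚ.≤-trans (ℤ.+≤+ z≤n) (ℤₚ.≤-reflexive {+ 3} (sym (cong (_-_ (+ 3)) (cong₂ _+_ (cong₂ _+_ n₁ n₂) n₃))))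
      ... | three s s≉0 e | none n₂ | none n₃ = ℤₚ.≤-reflexive (sym (cong (_-_ (+ 3)) (cong₂ _+_ (cong₂ _+_ (cubeRoots-cube s≉0 e) n₂) n₃)))
      ... | none n₁ | three s s≉0 e | none n₃ = ℤₚ.≤-reflexive (sym (cong (_-_ (+ 3)) (cong₂ _+_ (cong₂ _+_ n₁ (cubeRoots-cube s≉0 e)) n₃)))
      ... | none n₁ | none n₂ | three s s≉0 e = ℤₚ.≤-reflexive (sym (cong (_-_ (+ 3)) (cong₂ _+_ (cong₂ _+_ n₁ n₂) (cubeRoots-cube s≉0 e))))
      ... | three s s≉0 e | one z | _ = ⊥-elim (*-≉0 {s * s} {s} (*-≉0 {s} {s} s≉0 s≉0) s≉0 (≈-trans e (*-≈0-right γ c γ≉0 z)))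
      ... | three s s≉0 e | none _ | one z = ⊥-elim (*-≉0 {s * s} {s} (*-≉0 {s} {s} s≉0 s≉0) s≉0 (≈-trans e (*-≈0-right (γ * γ) c (*-≉0 {γ} {γ} γ≉0 γ≉0) z)))
      ... | none n₁ | one z | _ = ⊥-elim (no-cubeRoots n₁ (*-≈0-right γ c γ≉0 z))
      ... | none n₁ | none _ | one z = ⊥-elim (no-cubeRoots n₁ (*-≈0-right (γ * γ) c (*-≉0 {γ} {γ} γ≉0 γ≉0) z))
      ... | none n₁ | three s s≉0 e | one z = ⊥-elim (no-cubeRoots n₁ (*-≈0-right (γ * γ) c (*-≉0 {γ} {γ} γ≉0 γ≉0) z))

      -- The three counts sum to at most 3, and to 3 on average.
      cubeRoots-cosets : ∀ c → cubeRoots c + cubeRoots (γ * c) + cubeRoots (γ * γ * c) ≡ + 3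
      cubeRoots-cosets c = sym (i-j≡0⇒i≡j (+ 3) _ (Σₚ-nonneg-zero excess cubeRoots-cosets≤3 resp total c))
        where
        excess : ℤ → ℤ
        excess c = + 3 - (cubeRoots c + cubeRoots (γ * c) + cubeRoots (γ * γ * c))
        resp : Respects excess
        resp e = cong (_-_ (+ 3)) (cong₂ _+_ (cong₂ _+_ (cubeRoots-resp e) (cubeRoots-resp (*-≈ˡ γ e))) (cubeRoots-resp (*-≈ˡ (γ * γ) e)))
        lemma₁ : ∀ a b c → + 3 - (a + b + c) ≡ + 3 + (- 1ℤ * a + (- 1ℤ * b + - 1ℤ * c))
        lemma₁ = solve-∀
        lemma₂ : ∀ p → p * + 3 + (- 1ℤ * p + (- 1ℤ * p + - 1ℤ * p)) ≡ 0ℤ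
        lemma₂ = solve-∀
        total : Σₚ excess ≡ 0ℤ
        total = trans (Σₚ-ext (λ c → lemma₁ (cubeRoots c) (cubeRoots (γ * c)) (cubeRoots (γ * γ * c))))
          (trans (Σₚ-+ (λ _ → + 3) (λ c → - 1ℤ * cubeRoots c + (- 1ℤ * cubeRoots (γ * c) + - 1ℤ * cubeRoots (γ * γ * c))))
          (trans (cong₂ _+_ (Σₚ-const (+ 3))
            (trans (Σₚ-+ (λ c → - 1ℤ * cubeRoots c) (λ c → - 1ℤ * cubeRoots (γ * c) + - 1ℤ * cubeRoots (γ * γ * c)))
            (cong₂ _+_ (trans (Σₚ-*ˡ (- 1ℤ) cubeRoots) (cong (- 1ℤ *_) Σₚ-cubeRoots))
            (trans (Σₚ-+ (λ c → - 1ℤ * cubeRoots (γ * c)) (λ c → - 1ℤ * cubeRoots (γ * γ * c)))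
            (cong₂ _+_ (trans (Σₚ-*ˡ (- 1ℤ) (λ c → cubeRoots (γ * c))) (cong (- 1ℤ *_) (trans (Σₚ-scale cubeRoots γ cubeRoots-resp γ≉0) Σₚ-cubeRoots)))
                       (trans (Σₚ-*ˡ (- 1ℤ) (λ c → cubeRoots (γ * γ * c))) (cong (- 1ℤ *_) (trans (Σₚ-scale cubeRoots (γ * γ) cubeRoots-resp (*-≉0 {γ} {γ} γ≉0 γ≉0)) Σₚ-cubeRoots))))))))
          (lemma₂ (+ p))))

    -- Solving c t³ = a for t means taking cube roots of γ a.
    Σₚ-scaled-cubes : ∀ φ → Respects φ → ∀ c γ → c * γ ≈ 1ℤ → Σₚ (λ t → φ (c * (t * t * t))) ≡ Σₚ (λ a → cubeRoots (γ * a) * φ a)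
    Σₚ-scaled-cubes φ φ-resp c γ cγ≈1 = trans (Σₚ-cubes (λ a → φ (c * a)) (λ e → φ-resp (*-≈ˡ c e)))
      (trans (sym (Σₚ-scale (λ a → cubeRoots a * φ (c * a)) γ (λ e → cong₂ _*_ (cubeRoots-resp e) (φ-resp (*-≈ˡ c e)))
               (inverse-≉0 (≈-trans (≡⇒≈ (ℤₚ.*-comm γ c)) cγ≈1))))
             (Σₚ-ext (λ a → cong (cubeRoots (γ * a) *_) (φ-resp (≈-by a (lemma c γ a) (≈⇒-≈0 cγ≈1))))))
      where
      lemma : ∀ c γ a → c * (γ * a) - a ≡ a * (c * γ - 1ℤ)
      lemma = solve-∀

    -- The maps t ↦ t³, c t³, c² t³ together take every residue exactly three times, by
    -- `cubeRoots-cosets` for γ = 1/c.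
    Σₚ-cosets : ∀ φ → Respects φ → ∀ c → c ≉ 0ℤ → cubicResidue c ≉ 1ℤ → cubicResidue (c * c) ≉ 1ℤ →
      Σₚ (λ t → φ (t * t * t)) + Σₚ (λ t → φ (c * (t * t * t))) + Σₚ (λ t → φ (c * c * (t * t * t))) ≡ + 3 * Σₚ φ
    Σₚ-cosets φ φ-resp c c≉0 c-nonCube c²-nonCube = trans
      (cong₂ _+_ (cong₂ _+_ (Σₚ-cubes φ φ-resp) (Σₚ-scaled-cubes φ φ-resp c γ (*-inv c≉0)))
        (Σₚ-scaled-cubes φ φ-resp (c * c) (γ * γ) (≈-trans (≡⇒≈ (lemma₁ c γ)) (*-inv c≉0 ⟨*⟩ *-inv c≉0))))
      (trans (sym (trans (Σₚ-+ (λ a → cubeRoots a * φ a + cubeRoots (γ * a) * φ a) (λ a → cubeRoots (γ * γ * a) * φ a))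
                         (cong (_+ Σₚ (λ a → cubeRoots (γ * γ * a) * φ a)) (Σₚ-+ (λ a → cubeRoots a * φ a) (λ a → cubeRoots (γ * a) * φ a)))))
      (trans (Σₚ-ext (λ a → trans (lemma₂ (cubeRoots a) (cubeRoots (γ * a)) (cubeRoots (γ * γ * a)) (φ a))
                                  (cong (_* φ a) (cubeRoots-cosets γ (inv-≉0 c≉0)
                                    (λ e → c-nonCube (inverse-residue c γ (*-inv c≉0) e))
                                    (λ e → c²-nonCube (inverse-residue (c * c) (γ * γ) (≈-trans (≡⇒≈ (lemma₁ c γ)) (*-inv c≉0 ⟨*⟩ *-inv c≉0)) e)) a))))
             (Σₚ-*ˡ (+ 3) φ)))
      where
      γ : ℤ
      γ = inv c
      lemma₁ : ∀ a b → a * a * (b * b) ≡ a * b * (a * b)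
      lemma₁ = solve-∀
      lemma₂ : ∀ a b c d → a * d + b * d + c * d ≡ (a + b + c) * d
      lemma₂ = solve-∀
      inverse-residue : ∀ a b → a * b ≈ 1ℤ → cubicResidue b ≈ 1ℤ → cubicResidue a ≈ 1ℤ
      inverse-residue a b ab≈1 e = ≈-trans (≡⇒≈ (sym (*-identityʳ (cubicResidue a))))
        (≈-trans (*-≈ˡ (cubicResidue a) (≈-sym e)) (≈-trans (≡⇒≈ (sym (cubicResidue-* a b))) (≈-trans (≈-^ (2 ℕ.* m) ab≈1) (≡⇒≈ cubicResidue-1))))

    -- Twists of y² = x³ + c

    -- The isomorphism (x, y) ↦ (t² x, t³ y) between the two curves.
    points-scale : ∀ t c → t ≉ 0ℤ → points (c * (t * t * (t * t) * (t * t))) ≡ points c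
    points-scale t c t≉0 = trans
      (sym (Σₚ-scale (λ x → squareRoots (x * x * x + c * (t * t * (t * t) * (t * t)))) (t * t) (λ e → squareRoots-resp (+-≈ʳ (c * (t * t * (t * t) * (t * t))) (cube-≈ e))) (*-≉0 {t} {t} t≉0 t≉0)))
      (Σₚ-ext (λ x → trans (squareRoots-resp (≡⇒≈ (lemma t x c))) (squareRoots-scale (t * t * t) (x * x * x + c) (*-≉0 {t * t} {t} (*-≉0 {t} {t} t≉0 t≉0) t≉0))))
      where
      lemma : ∀ t x c → t * t * x * (t * t * x) * (t * t * x) + c * (t * t * (t * t) * (t * t)) ≡ t * t * t * (t * t * t) * (x * x * x + c)
      lemma = solve-∀

    squareRoots-value : ∀ d → ∃ λ k → k ℕ.≤ 2 × squareRoots d ≡ + k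
    squareRoots-value d with squareRootCount d
    ... | none e  = 0 , z≤n , e
    ... | one _ e = 1 , s≤s z≤n , e
    ... | two e = 2 , s≤s (s≤s z≤n) , e

    2<p : 2 ℕ.< p
    2<p = ℕₚ.<-trans (s≤s (s≤s (s≤s z≤n))) p>3

    -- Root counts lie between 0 and 2, too small for congruent values to differ.
    squareRoots-same : ∀ c d → squareRoots c ≈ squareRoots d → squareRoots c ≡ squareRoots d
    squareRoots-same c d e = compare (squareRoots-value c) (squareRoots-value d)
      where
      compare : (∃ λ k → k ℕ.≤ 2 × squareRoots c ≡ + k) → (∃ λ k → k ℕ.≤ 2 × squareRoots d ≡ + k) → squareRoots c ≡ squareRoots d
      compare (i , i≤2 , ei) (j , j≤2 , ej) = trans ei (trans (cong +_ (+-injective-≈ (ℕₚ.≤-<-trans i≤2 2<p) (ℕₚ.≤-<-trans j≤2 2<p)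
        (≈-trans (≡⇒≈ (sym ei)) (≈-trans e (≡⇒≈ ej))))) (sym ej))

    squareRoots-opposite : ∀ c d → squareRoots c + squareRoots d ≈ + 2 → squareRoots c ≡ + 2 - squareRoots d
    squareRoots-opposite c d e = compare (squareRoots-value c) (squareRoots-value d)
      where
      lemma : ∀ a b → a ≡ a + b - b
      lemma = solve-∀
      compare : (∃ λ k → k ℕ.≤ 2 × squareRoots c ≡ + k) → (∃ λ k → k ℕ.≤ 2 × squareRoots d ≡ + k) → squareRoots c ≡ + 2 - squareRoots d
      compare (i , i≤2 , ei) (j , j≤2 , ej) = trans (lemma (squareRoots c) (squareRoots d)) (cong (_- squareRoots d)
        (trans (cong₂ _+_ ei ej) (cong +_ (+-injective-≈ (ℕₚ.≤-<-trans (ℕₚ.+-mono-≤ i≤2 j≤2) 4<p) 2<p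
        (≈-trans (≡⇒≈ (cong₂ _+_ (sym ei) (sym ej))) e)))))

    -- By Euler's criterion the counts are 1 + dʰ and 1 + σ dʰ modulo p, where σ = tʰ is 1 or -1. So
    -- multiplication by t keeps all counts or reflects all of them about 1.
    squareRoots-twist : ∀ t → t ≉ 0ℤ → (∀ d → squareRoots (t * d) ≡ squareRoots d) ⊎ (∀ d → squareRoots (t * d) ≡ + 2 - squareRoots d)
    squareRoots-twist t t≉0 = decide (*-≈0 (σ - 1ℤ) (σ + 1ℤ) (≈-trans (≡⇒≈ (lemma₁ σ)) (≈⇒-≈0 square)))
      where
      h : ℕ
      h = 3 ℕ.* m
      σ : ℤ
      σ = t ^ h
      euler : ∀ d → squareRoots d ≈ 1ℤ + d ^ h
      euler = squareRoots-euler h p∸1≡2[3m]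
      lemma₁ : ∀ a → (a - 1ℤ) * (a + 1ℤ) ≡ a * (a * 1ℤ) - 1ℤ
      lemma₁ = solve-∀
      lemma₂ : ∀ a b → 1ℤ + a * b + (1ℤ + b) - + 2 ≡ b * (a + 1ℤ)
      lemma₂ = solve-∀
      lemma₃ : ∀ a b → 1ℤ + a * b - (1ℤ + b) ≡ b * (a - 1ℤ)
      lemma₃ = solve-∀
      square : σ ^ 2 ≈ 1ℤ
      square = ≈-trans (≡⇒≈ (trans (^-*-assoc t h 2) (cong (t ^_) (trans (ℕₚ.*-comm h 2) (sym p∸1≡2[3m]))))) (fermat-unit t≉0)
      euler-twisted : ∀ d → squareRoots (t * d) ≈ 1ℤ + σ * d ^ h
      euler-twisted d = ≈-trans (euler (t * d)) (≡⇒≈ (cong (λ z → 1ℤ + z) (^-distribʳ-* t d h)))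
      decide : σ - 1ℤ ≈ 0ℤ ⊎ σ + 1ℤ ≈ 0ℤ → (∀ d → squareRoots (t * d) ≡ squareRoots d) ⊎ (∀ d → squareRoots (t * d) ≡ + 2 - squareRoots d)
      decide (inj₁ e) = inj₁ (λ d → squareRoots-same (t * d) d
        (≈-trans (euler-twisted d) (≈-trans (≈-by (d ^ h) (lemma₃ σ (d ^ h)) e) (≈-sym (euler d)))))
      decide (inj₂ e) = inj₂ (λ d → squareRoots-opposite (t * d) d
        (≈-trans (euler-twisted d ⟨+⟩ euler d) (≈-by (d ^ h) (lemma₂ σ (d ^ h)) e)))

    -- Substituting t x for x produces t³ (x³ + c), and the square t² does not affect the number of
    -- roots: what remains is the quadratic twist by t.
    points-twist : ∀ t c → t ≉ 0ℤ → points (c * (t * t * t)) ≡ Σₚ (λ x → squareRoots (t * (x * x * x + c)))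
    points-twist t c t≉0 = trans
      (sym (Σₚ-scale (λ x → squareRoots (x * x * x + c * (t * t * t))) t (λ e → squareRoots-resp (+-≈ʳ (c * (t * t * t)) (cube-≈ e))) t≉0))
      (Σₚ-ext (λ x → trans (squareRoots-resp (≡⇒≈ (lemma t x c))) (squareRoots-scale t (t * (x * x * x + c)) t≉0)))
      where
      lemma : ∀ t x c → t * x * (t * x) * (t * x) + c * (t * t * t) ≡ t * t * (t * (x * x * x + c))
      lemma = solve-∀

    -- A quadratic twist changes E at most in sign, since a reflected count is 2 p minus the
    -- original one.
    defect²-twist : ∀ t c → t ≉ 0ℤ → defect (c * (t * t * t)) * defect (c * (t * t * t)) ≡ defect c * defect c
    defect²-twist t c t≉0 = [ (λ same → cong (λ z → z * z) (cong (_- + p) (trans (points-twist t c t≉0) (Σₚ-ext (λ x → same (x * x * x + c))))))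
                            , (λ flip → trans (cong (λ z → z * z) (cong (_- + p) (opposite flip))) (lemma₁ (+ p) (points c))) ]′ (squareRoots-twist t t≉0)
      where
      lemma₁ : ∀ p n → (p * + 2 + - 1ℤ * n - p) * (p * + 2 + - 1ℤ * n - p) ≡ (n - p) * (n - p)
      lemma₁ = solve-∀
      opposite : (∀ d → squareRoots (t * d) ≡ + 2 - squareRoots d) → points (c * (t * t * t)) ≡ + p * + 2 + - 1ℤ * points c
      opposite flip = trans (points-twist t c t≉0) (trans
        (Σₚ-ext (λ x → trans (flip (x * x * x + c)) (cong (λ z → + 2 + z) (sym (-1*i≡-i (squareRoots (x * x * x + c)))))))
        (trans (Σₚ-+ (λ _ → + 2) (λ x → - 1ℤ * squareRoots (x * x * x + c))) (cong₂ _+_ (Σₚ-const (+ 2)) (Σₚ-*ˡ (- 1ℤ) (λ x → squareRoots (x * x * x + c))))))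

    -- The decisive input is the number of u with u³ = x³: three for a unit x, one for x = 0. The
    -- factor 3 reflects p ≡ 1 modulo 3.
    Σₚ-defect² : Σₚ (λ c → defect c * defect c) ≡ + 2 * + p * (+ p - 1ℤ)
    Σₚ-defect² = ≡.begin
      Σₚ (λ c → defect c * defect c)
        ≡.≡⟨ Σₚ-ext (λ c → lemma₁ (points c) (+ p)) ⟩
      Σₚ (λ c → points c * points c + (- + 2 * + p * points c + + p * + p))
        ≡.≡⟨ trans (Σₚ-+ (λ c → points c * points c) (λ c → - + 2 * + p * points c + + p * + p)) (cong₂ _+_ second
              (trans (Σₚ-+ (λ c → - + 2 * + p * points c) (λ _ → + p * + p)) (cong₂ _+_ (trans (Σₚ-*ˡ (- + 2 * + p) points) (cong (- + 2 * + p *_) Σₚ-points)) (Σₚ-const (+ p * + p))))) ⟩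
      + p * (+ p * (+ p - 1ℤ)) + + p * (+ p * + 3 + - + 2 * 1ℤ) + (- + 2 * + p * (+ p * + p) + + p * (+ p * + p))
        ≡.≡⟨ lemma₂ (+ p) ⟩
      + 2 * + p * (+ p - 1ℤ) ≡.∎
      where
      module ≡ = ≡-Reasoning
      lemma₁ : ∀ n p → (n - p) * (n - p) ≡ n * n + (- + 2 * p * n + p * p)
      lemma₁ = solve-∀
      lemma₂ : ∀ p → p * (p * (p - 1ℤ)) + p * (p * + 3 + - + 2 * 1ℤ) + (- + 2 * p * (p * p) + p * (p * p)) ≡ + 2 * p * (p - 1ℤ)
      lemma₂ = solve-∀
      cubes : ∀ x → cubeRoots (x * x * x) ≡ + 3 + - + 2 * δ x
      cubes x = by-cases x (λ e → trans (cubeRoots-0 (*-≈0ˡ (x * x) e)) (sym (cong (λ z → + 3 + - + 2 * z) (δ-one e))))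
        (λ ne → trans (cubeRoots-cube ne ≈-refl) (sym (cong (λ z → + 3 + - + 2 * z) (δ-zero ne))))
      second : Σₚ (λ c → points c * points c) ≡ + p * (+ p * (+ p - 1ℤ)) + + p * (+ p * + 3 + - + 2 * 1ℤ)
      second = trans Σₚ-points² (trans
        (Σₚ-ext (λ x → trans (Σₚ-+ (λ _ → + p - 1ℤ) (λ u → + p * δ (u * u * u - x * x * x)))
          (cong₂ _+_ (Σₚ-const (+ p - 1ℤ)) (trans (Σₚ-*ˡ (+ p) (λ u → δ (u * u * u - x * x * x))) (cong (+ p *_) (cubes x))))))
        (trans (Σₚ-+ (λ _ → + p * (+ p - 1ℤ)) (λ x → + p * (+ 3 + - + 2 * δ x)))
          (cong₂ _+_ (Σₚ-const (+ p * (+ p - 1ℤ))) (trans (Σₚ-*ˡ (+ p) (λ x → + 3 + - + 2 * δ x)) (cong (+ p *_)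
            (trans (Σₚ-+ (λ _ → + 3) (λ x → - + 2 * δ x)) (cong₂ _+_ (Σₚ-const (+ 3)) (trans (Σₚ-*ˡ (- + 2) δ) (cong (- + 2 *_) Σₚ-δ0)))))))))

    defect-orbit : ∀ c t → defect (c * (t * t * (t * t) * (t * t))) ≡ (1ℤ - δ t) * defect c
    defect-orbit c t = by-cases t
      (λ e → trans (defect-0 (*-≈0ˡ c (≈-trans (*-≈ˡ (t * t * (t * t)) (*-≈ˡ t e)) (≡⇒≈ (lemma t)))))
          (sym (cong (λ z → (1ℤ - z) * defect c) (δ-one e))))
      (λ ne → trans (cong (_- + p) (points-scale t c ne)) (trans (sym (*-identityˡ (defect c))) (sym (cong (λ z → (1ℤ - z) * defect c) (δ-zero ne)))))
      where
      lemma : ∀ t → t * t * (t * t) * (t * 0ℤ) ≡ 0ℤ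
      lemma = solve-∀

    defect²-orbit : ∀ c t → defect (c * (t * t * t)) * defect (c * (t * t * t)) ≡ (1ℤ - δ t) * (defect c * defect c)
    defect²-orbit c t = by-cases t
      (λ e → trans (cong (λ z → z * z) (defect-0 (≈-trans (*-≈ˡ c (*-≈ˡ (t * t) e)) (≡⇒≈ (lemma c t)))))
          (sym (cong (λ z → (1ℤ - z) * (defect c * defect c)) (δ-one e))))
      (λ ne → trans (defect²-twist t c ne) (trans (sym (*-identityˡ (defect c * defect c))) (sym (cong (λ z → (1ℤ - z) * (defect c * defect c)) (δ-zero ne)))))
      where
      lemma : ∀ c t → c * (t * t * 0ℤ) ≡ 0ℤ
      lemma = solve-∀

    -- Moments of E over the cosets of cubes

    ω²≉1 : ω * ω ≉ 1ℤ
    ω²≉1 e = 3≉0 (≈-trans (≡⇒≈ (lemma ω))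
      (≈-trans (*-≈ˡ (+ 2 - ω) ω-minimal ⟨+⟩ *-≈ˡ (ω - 1ℤ) (≈⇒-≈0 e)) (≡⇒≈ (zero-sum (+ 2 - ω) (ω - 1ℤ)))))
      where
      lemma : ∀ w → + 3 ≡ (+ 2 - w) * (w * w + w + 1ℤ) + (w - 1ℤ) * (w * w - 1ℤ)
      lemma = solve-∀
      zero-sum : ∀ a b → a * 0ℤ + b * 0ℤ ≡ 0ℤ
      zero-sum = solve-∀

    g²-nonCube : cubicResidue (g * g) ≉ 1ℤ
    g²-nonCube e = ω²≉1 (≈-trans (≡⇒≈ (sym (cubicResidue-* g g))) e)

    g⁴-nonCube : cubicResidue (g * g * (g * g)) ≉ 1ℤ
    g⁴-nonCube e = ω≉1 (≈-trans (≈-sym ω⁴≈ω) (≈-trans (≡⇒≈ (sym (trans (cubicResidue-* (g * g) (g * g)) (cong₂ _*_ (cubicResidue-* g g) (cubicResidue-* g g))))) e))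
      where
      lemma : ∀ w → w * w * (w * w) - w ≡ (w * (w - 1ℤ)) * (w * w + w + 1ℤ)
      lemma = solve-∀
      ω⁴≈ω : ω * ω * (ω * ω) ≈ ω
      ω⁴≈ω = ≈-by (ω * (ω - 1ℤ)) (lemma ω) ω-minimal

    p-1≢0 : + p - 1ℤ ≢ 0ℤ
    p-1≢0 e = ℕₚ.<⇒≢ (ℕₚ.<-trans (s≤s (s≤s z≤n)) p>3) (sym (ℤₚ.+-injective (i-j≡0⇒i≡j (+ p) 1ℤ e)))

    module _ (s : ℤ) (s≉0 : s ≉ 0ℤ) where

      A₀ A₁ A₂ : ℤ
      A₀ = defect (s * s)
      A₁ = defect (s * s * (g * g))
      A₂ = defect (s * s * (g * g * (g * g)))

      -- `Σₚ-cosets` is applied to a ↦ E(s² a²). The arguments become s² t⁶, s² g² t⁶ and s² g⁴ t⁶,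
      -- along which E is constant for units t, and the total is three times the vanishing sum of E
      -- over squares.
      first-moment : A₀ + A₁ + A₂ ≡ 0ℤ
      first-moment = cancel (i*j≡0⇒i≡0∨j≡0 (+ p - 1ℤ) (≡.begin
        (+ p - 1ℤ) * (A₀ + A₁ + A₂)
          ≡.≡⟨ trans (lemma₄ (+ p - 1ℤ) A₀ A₁ A₂) (cong₂ _+_ (cong₂ _+_ (sym (Σₚ-unit A₀)) (sym (Σₚ-unit A₁))) (sym (Σₚ-unit A₂))) ⟩
        Σₚ (λ t → (1ℤ - δ t) * A₀) + Σₚ (λ t → (1ℤ - δ t) * A₁) + Σₚ (λ t → (1ℤ - δ t) * A₂)
          ≡.≡⟨ cong₂ _+_ (cong₂ _+_
                (Σₚ-ext (λ t → trans (sym (defect-orbit (s * s) t)) (defect-resp (≡⇒≈ (lemma₁ s t)))))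
                (Σₚ-ext (λ t → trans (sym (defect-orbit (s * s * (g * g)) t)) (defect-resp (≡⇒≈ (lemma₂ s g t))))))
                (Σₚ-ext (λ t → trans (sym (defect-orbit (s * s * (g * g * (g * g))) t)) (defect-resp (≡⇒≈ (lemma₃ s g t))))) ⟩
        Σₚ (λ t → φ (t * t * t)) + Σₚ (λ t → φ (g * (t * t * t))) + Σₚ (λ t → φ (g * g * (t * t * t)))
          ≡.≡⟨ Σₚ-cosets φ φ-resp g g≉0 ω≉1 g²-nonCube ⟩
        + 3 * Σₚ (λ t → defect (s * t * (s * t)))
          ≡.≡⟨ cong (+ 3 *_) (trans (Σₚ-scale (λ t → defect (t * t)) s (λ e → defect-resp (e ⟨*⟩ e)) s≉0) Σₚ-defect-squares) ⟩
        0ℤ ≡.∎))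
        where
        module ≡ = ≡-Reasoning
        φ : ℤ → ℤ
        φ t = defect (s * t * (s * t))
        φ-resp : Respects φ
        φ-resp e = defect-resp (*-≈ˡ s e ⟨*⟩ *-≈ˡ s e)
        lemma₁ : ∀ s t → s * s * (t * t * (t * t) * (t * t)) ≡ s * (t * t * t) * (s * (t * t * t))
        lemma₁ = solve-∀
        lemma₂ : ∀ s g t → s * s * (g * g) * (t * t * (t * t) * (t * t)) ≡ s * (g * (t * t * t)) * (s * (g * (t * t * t)))
        lemma₂ = solve-∀
        lemma₃ : ∀ s g t → s * s * (g * g * (g * g)) * (t * t * (t * t) * (t * t)) ≡ s * (g * g * (t * t * t)) * (s * (g * g * (t * t * t)))
        lemma₃ = solve-∀
        lemma₄ : ∀ q a b c → q * (a + b + c) ≡ q * a + q * b + q * c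
        lemma₄ = solve-∀
        cancel : + p - 1ℤ ≡ 0ℤ ⊎ A₀ + A₁ + A₂ ≡ 0ℤ → A₀ + A₁ + A₂ ≡ 0ℤ
        cancel (inj₁ e) = ⊥-elim (p-1≢0 e)
        cancel (inj₂ e) = e

      -- E² is constant along multiplication by all cubes of units, not only sixth powers, so the
      -- cosets are now s² t³ multiplied by 1, g² and g⁴. Dividing 3 · 2 p (p - 1) by p - 1 gives 6
      -- p.
      second-moment : A₀ * A₀ + A₁ * A₁ + A₂ * A₂ ≡ + 6 * + p
      second-moment = i-j≡0⇒i≡j _ _ (cancel (i*j≡0⇒i≡0∨j≡0 (+ p - 1ℤ) (≡.begin
        (+ p - 1ℤ) * (A₀ * A₀ + A₁ * A₁ + A₂ * A₂ - + 6 * + p)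
          ≡.≡⟨ trans (lemma₃ (+ p - 1ℤ) (A₀ * A₀) (A₁ * A₁) (A₂ * A₂) (+ p)) (cong (_- + 3 * (+ 2 * + p * (+ p - 1ℤ))) (cong₂ _+_ (cong₂ _+_ (sym (Σₚ-unit (A₀ * A₀))) (sym (Σₚ-unit (A₁ * A₁)))) (sym (Σₚ-unit (A₂ * A₂))))) ⟩
        Σₚ (λ t → (1ℤ - δ t) * (A₀ * A₀)) + Σₚ (λ t → (1ℤ - δ t) * (A₁ * A₁)) + Σₚ (λ t → (1ℤ - δ t) * (A₂ * A₂)) - + 3 * (+ 2 * + p * (+ p - 1ℤ))
          ≡.≡⟨ cong (_- + 3 * (+ 2 * + p * (+ p - 1ℤ))) (cong₂ _+_ (cong₂ _+_
                (Σₚ-ext (λ t → sym (defect²-orbit (s * s) t)))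
                (Σₚ-ext (λ t → trans (sym (defect²-orbit (s * s * (g * g)) t)) (square-resp (ℤₚ.*-assoc (s * s) (g * g) (t * t * t))))))
                (Σₚ-ext (λ t → trans (sym (defect²-orbit (s * s * (g * g * (g * g))) t)) (square-resp (ℤₚ.*-assoc (s * s) (g * g * (g * g)) (t * t * t)))))) ⟩
        Σₚ (λ t → φ (t * t * t)) + Σₚ (λ t → φ (g * g * (t * t * t))) + Σₚ (λ t → φ (g * g * (g * g) * (t * t * t))) - + 3 * (+ 2 * + p * (+ p - 1ℤ))
          ≡.≡⟨ cong (_- + 3 * (+ 2 * + p * (+ p - 1ℤ))) (trans (Σₚ-cosets φ φ-resp (g * g) (*-≉0 {g} {g} g≉0 g≉0) g²-nonCube g⁴-nonCube)
                (cong (+ 3 *_) (trans (Σₚ-scale (λ t → defect t * defect t) (s * s) (λ e → cong₂ _*_ (defect-resp e) (defect-resp e)) (*-≉0 {s} {s} s≉0 s≉0)) Σₚ-defect²))) ⟩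
        + 3 * (+ 2 * + p * (+ p - 1ℤ)) - + 3 * (+ 2 * + p * (+ p - 1ℤ))
          ≡.≡⟨ +-inverseʳ (+ 3 * (+ 2 * + p * (+ p - 1ℤ))) ⟩
        0ℤ ≡.∎)))
        where
        module ≡ = ≡-Reasoning
        φ : ℤ → ℤ
        φ t = defect (s * s * t) * defect (s * s * t)
        square-resp : ∀ {a b} → a ≡ b → defect a * defect a ≡ defect b * defect b
        square-resp = cong (λ a → defect a * defect a)
        φ-resp : Respects φ
        φ-resp e = cong₂ _*_ (defect-resp (*-≈ˡ (s * s) e)) (defect-resp (*-≈ˡ (s * s) e))
        lemma₃ : ∀ q a b c p → q * (a + b + c - + 6 * p) ≡ q * a + q * b + q * c - + 3 * (+ 2 * p * q)
        lemma₃ = solve-∀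
        cancel : + p - 1ℤ ≡ 0ℤ ⊎ A₀ * A₀ + A₁ * A₁ + A₂ * A₂ - + 6 * + p ≡ 0ℤ → A₀ * A₀ + A₁ * A₁ + A₂ * A₂ - + 6 * + p ≡ 0ℤ
        cancel (inj₁ e) = ⊥-elim (p-1≢0 e)
        cancel (inj₂ e) = e

      -- Substituting A₂ = -A₀ - A₁ turns twice the sum of squares into this form.
      defect-norm : (A₀ + + 2 * A₁) * (A₀ + + 2 * A₁) + + 3 * (A₀ * A₀) ≡ + 12 * + p
      defect-norm = trans (lemma₁ A₀ A₁ A₂) (trans (cong₂ (λ x y → + 2 * x + y * (+ 2 * A₀ + + 2 * A₁ - + 2 * A₂)) second-moment first-moment) (lemma₂ (+ p) (+ 2 * A₀ + + 2 * A₁ - + 2 * A₂)))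
        where
        lemma₁ : ∀ a b c → (a + + 2 * b) * (a + + 2 * b) + + 3 * (a * a) ≡ + 2 * (a * a + b * b + c * c) + (a + b + c) * (+ 2 * a + + 2 * b - + 2 * c)
        lemma₁ = solve-∀
        lemma₂ : ∀ p d → + 2 * (+ 6 * p) + 0ℤ * d ≡ + 12 * p
        lemma₂ = solve-∀

    -- Congruences for E(c) modulo p, 2, 3 and 9

    9m<2[p∸1] : 3 ℕ.* (3 ℕ.* m) ℕ.< (p ∸ 1) ℕ.+ (p ∸ 1)
    9m<2[p∸1] = subst (3 ℕ.* (3 ℕ.* m) ℕ.<_) (sym (trans (cong₂ ℕ._+_ p∸1≡6m p∸1≡6m) (arith m)))
      (ℕₚ.m<m+n (3 ℕ.* (3 ℕ.* m)) (ℕₚ.≤-trans 0<m (ℕₚ.m≤m+n m (m ℕ.+ (m ℕ.+ 0)))))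
      where
      arith : ∀ m → 6 ℕ.* m ℕ.+ 6 ℕ.* m ≡ 3 ℕ.* (3 ℕ.* m) ℕ.+ 3 ℕ.* m
      arith = ℕ-Solver.solve-∀

    -- By Euler's criterion E(c) is the sum of (x³ + c)^(3m) modulo p, and x^(p-1) = (x³)^(2m)
    -- occurs in it once.
    defect-≈ : ∀ c → defect c ≈ - (bin (3 ℕ.* m) (2 ℕ.* m) * c ^ m)
    defect-≈ c = begin
      points c - + p
        ≈⟨ Σₚ-≈ (λ x → ≈-trans (squareRoots-euler (3 ℕ.* m) p∸1≡2[3m] (x * x * x + c)) (≡⇒≈ (cong (λ z → 1ℤ + z) (trans (cong (_^ (3 ℕ.* m)) (lemma₁ x c)) (sym (*-identityˡ _)))))) ⟨-⟩ ≈-refl {+ p} ⟩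
      Σₚ (λ x → 1ℤ + x ^ 0 * (1ℤ * x ^ 3 + c) ^ (3 ℕ.* m)) - + p
        ≡⟨ trans (cong (_- + p) (trans (Σₚ-+ (λ _ → 1ℤ) (λ x → x ^ 0 * (1ℤ * x ^ 3 + c) ^ (3 ℕ.* m))) (cong (_+ Σₚ (λ x → x ^ 0 * (1ℤ * x ^ 3 + c) ^ (3 ℕ.* m))) Σₚ-1))) (lemma₂ (+ p) (Σₚ (λ x → x ^ 0 * (1ℤ * x ^ 3 + c) ^ (3 ℕ.* m)))) ⟩
      Σₚ (λ x → x ^ 0 * (1ℤ * x ^ 3 + c) ^ (3 ℕ.* m))
        ≈⟨ Σₚ-coefficient 0 3 (3 ℕ.* m) (2 ℕ.* m) 1ℤ c (ℕₚ.m≤n+m (2 ℕ.* m) m) (sym (trans p∸1≡6m (ℕₚ.*-assoc 3 2 m))) 9m<2[p∸1] ⟩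
      - (bin (3 ℕ.* m) (2 ℕ.* m) * (1ℤ ^ (2 ℕ.* m) * c ^ (3 ℕ.* m ∸ 2 ℕ.* m)))
        ≡⟨ cong₂ (λ u v → - (bin (3 ℕ.* m) (2 ℕ.* m) * (u * c ^ v))) (^-zeroˡ (2 ℕ.* m)) (ℕₚ.m+n∸n≡m m (2 ℕ.* m)) ⟩
      - (bin (3 ℕ.* m) (2 ℕ.* m) * (1ℤ * c ^ m))
        ≡⟨ cong (λ u → - (bin (3 ℕ.* m) (2 ℕ.* m) * u)) (*-identityˡ (c ^ m)) ⟩
      - (bin (3 ℕ.* m) (2 ℕ.* m) * c ^ m) ∎
      where
      lemma₁ : ∀ x c → x * x * x + c ≡ 1ℤ * (x * (x * (x * 1ℤ))) + c
      lemma₁ = solve-∀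
      lemma₂ : ∀ p s → p + s - p ≡ s
      lemma₂ = solve-∀

    inverse-cube : ∀ a b → a * b ≈ 1ℤ → ∀ {s} → s ≉ 0ℤ → s * s * s ≈ a → inv s * inv s * inv s ≈ b
    inverse-cube a b ab≈1 {s} s≉0 e = *-cancelˡ-≈ a (inverse-≉0 ab≈1) (begin
      a * (inv s * inv s * inv s) ≈⟨ *-≈ʳ (inv s * inv s * inv s) (≈-sym e) ⟩
      s * s * s * (inv s * inv s * inv s) ≡⟨ lemma s (inv s) ⟩
      s * inv s * (s * inv s) * (s * inv s) ≈⟨ cube-≈ (*-inv s≉0) ⟩
      1ℤ ≈⟨ ≈-sym ab≈1 ⟩
      a * b                              ∎)
      where
      lemma : ∀ s i → s * s * s * (i * i * i) ≡ s * i * (s * i) * (s * i)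
      lemma = solve-∀

    cubeRoots-inverse : ∀ a b → a * b ≈ 1ℤ → cubeRoots a ≡ cubeRoots b
    cubeRoots-inverse a b ab≈1 = compare (cubeRootCount a) (cubeRootCount b)
      where
      ba≈1 : b * a ≈ 1ℤ
      ba≈1 = ≈-trans (≡⇒≈ (ℤₚ.*-comm b a)) ab≈1
      compare : CubeRootCount a → CubeRootCount b → cubeRoots a ≡ cubeRoots b
      compare (one a≈0) _ = ⊥-elim (inverse-≉0 ab≈1 a≈0)
      compare _ (one b≈0) = ⊥-elim (inverse-≉0 ba≈1 b≈0)
      compare (none e) (none e′) = trans e (sym e′)
      compare (three s s≉0 e) _ = trans (cubeRoots-cube s≉0 e) (sym (cubeRoots-cube (inv-≉0 s≉0) (inverse-cube a b ab≈1 s≉0 e)))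
      compare _ (three s s≉0 e) = trans (cubeRoots-cube (inv-≉0 s≉0) (inverse-cube b a ba≈1 s≉0 e)) (sym (cubeRoots-cube s≉0 e))

    cubeRoots-∣3 : ∀ {a} → a ≉ 0ℤ → + 3 Signed.∣ cubeRoots a
    cubeRoots-∣3 {a} a≉0 with cubeRootCount a
    ... | none e = Signed.divides 0ℤ e
    ... | one a≈0 = ⊥-elim (a≉0 a≈0)
    ... | three s s≉0 e = Signed.divides 1ℤ (cubeRoots-cube s≉0 e)

    -- The automorphism x ↦ ω x moves every point in an orbit of size 3, except the points with x =
    -- 0.
    points-mod-3 : ∀ c → + 3 Signed.∣ points c - squareRoots c
    points-mod-3 c = subst (+ 3 Signed.∣_)
      (cong₂ _-_ (sym (Σₚ-cubes φ φ-resp)) (cong squareRoots (+-identityˡ c)))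
      (Σₚ-weighted-∣ cubeRoots φ φ-resp cubeRoots-0 cubeRoots-∣3)
      where
      φ : ℤ → ℤ
      φ a = squareRoots (a + c)
      φ-resp : Respects φ
      φ-resp e = squareRoots-resp (+-≈ʳ c e)

    -- The nonzero square c leaves two points over x = 0, and 2 - p ≡ 1 modulo 3.
    defect-mod-3 : ∀ {s c} → s ≉ 0ℤ → s * s ≈ c → + 3 Signed.∣ defect c - 1ℤ
    defect-mod-3 {s} {c} s≉0 e = subst (+ 3 Signed.∣_) eq (Signed.∣m∣n⇒∣m-n (points-mod-3 c) (Signed.divides (+ 2 * + m) (lemma (+ m))))
      where
      lemma : ∀ m → + 6 * m ≡ + 2 * m * + 3
      lemma = solve-∀
      lemma₂ : ∀ n m → n - + 2 - + 6 * m ≡ n - (1ℤ + + 6 * m) - 1ℤ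
      lemma₂ = solve-∀
      eq : points c - squareRoots c - + 6 * + m ≡ defect c - 1ℤ
      eq = trans (cong (λ z → points c - z - + 6 * + m) (squareRoots-square s≉0 e)) (trans (lemma₂ (points c) (+ m)) (cong (λ z → points c - z - 1ℤ) (sym p≡1+6m)))

    -- The involution y ↦ -y fixes only the points with y = 0, that is x³ = -c.
    points-mod-2 : ∀ c → + 2 Signed.∣ points c - cubeRoots (- c)
    points-mod-2 c = subst (+ 2 Signed.∣_)
      (cong₂ _-_ (sym points-by-cubeRoots) (cong cubeRoots (+-identityˡ (- c))))
      (Σₚ-weighted-∣ squareRoots φ φ-resp squareRoots-0 squareRoots-even)
      where
      φ : ℤ → ℤ
      φ d = cubeRoots (d - c)
      φ-resp : Respects φ
      φ-resp e = cubeRoots-resp (+-≈ʳ (- c) e)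
      lemma : ∀ x y c → x * x * x + c - y * y ≡ x * x * x - (y * y - c)
      lemma = solve-∀
      points-by-cubeRoots : points c ≡ Σₚ (λ d → squareRoots d * φ d)
      points-by-cubeRoots = trans (Σₚ-swap (λ x y → δ (y * y - (x * x * x + c))))
        (trans (Σₚ-ext (λ y → Σₚ-ext (λ x → trans (δ-neg (y * y) (x * x * x + c)) (δ-resp (≡⇒≈ (lemma x y c))))))
        (Σₚ-squares φ φ-resp))

    -- As -1 is the cube of -1, it has three cube roots, and 3 - p is even.
    defect-1-even : + 2 Signed.∣ defect 1ℤ
    defect-1-even = subst (+ 2 Signed.∣_) eq (Signed.∣m∣n⇒∣m-n (points-mod-2 1ℤ) (Signed.divides (+ 3 * + m - 1ℤ) (lemma (+ m))))
      where
      lemma : ∀ m → + 6 * m - + 2 ≡ (+ 3 * m - 1ℤ) * + 2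
      lemma = solve-∀
      lemma₂ : ∀ n m → n - + 3 - (+ 6 * m - + 2) ≡ n - (1ℤ + + 6 * m)
      lemma₂ = solve-∀
      eq : points 1ℤ - cubeRoots (- 1ℤ) - (+ 6 * + m - + 2) ≡ defect 1ℤ
      eq = trans (cong (λ z → points 1ℤ - z - (+ 6 * + m - + 2)) (cubeRoots-cube -1≉0 ≈-refl)) (trans (lemma₂ (points 1ℤ) (+ m)) (cong (_-_ (points 1ℤ)) (sym p≡1+6m)))

    fermatCubicPoints : ℤ
    fermatCubicPoints = Σₚ (λ x → cubeRoots (1ℤ - x * x * x))

    -- (x, y) with x y ≠ 0 on x³ + y³ = 1 come in orbits of size 9; three points each have x = 0 and y = 0.
    fermatCubicPoints-mod-9 : + 9 Signed.∣ fermatCubicPoints - + 6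
    fermatCubicPoints-mod-9 = subst (+ 9 Signed.∣_) total (Σₚ-∣ term)
      where
      term : ∀ a → + 9 Signed.∣ cubeRoots a * cubeRoots (1ℤ - a) + (- + 3 * δ a + - + 3 * δ (a - 1ℤ))
      term a = by-cases a
        (λ a≈0 → Signed.divides 0ℤ (cong₂ _+_
           (cong₂ _*_ (cubeRoots-0 a≈0) (trans (cubeRoots-resp (≈-refl {1ℤ} ⟨-⟩ a≈0)) cubeRoots-1))
           (cong₂ (λ x y → - + 3 * x + - + 3 * y) (δ-one a≈0) (δ-zero (λ e → 1≉0 (≈-trans (≈-sym (-≈0⇒≈ e)) a≈0))))))
        (λ a≉0 → by-cases (a - 1ℤ)
          (λ a≈1 → Signed.divides 0ℤ (cong₂ _+_
             (cong₂ _*_ (trans (cubeRoots-resp (-≈0⇒≈ a≈1)) cubeRoots-1) (cubeRoots-0 (≈⇒-≈0 (≈-sym (-≈0⇒≈ {a} {1ℤ} a≈1)))))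
             (cong₂ (λ x y → - + 3 * x + - + 3 * y) (δ-zero a≉0) (δ-one a≈1))))
          (λ a≉1 → subst (+ 9 Signed.∣_)
             (sym (trans (cong₂ (λ x y → cubeRoots a * cubeRoots (1ℤ - a) + (- + 3 * x + - + 3 * y)) (δ-zero a≉0) (δ-zero a≉1)) (+-identityʳ (cubeRoots a * cubeRoots (1ℤ - a)))))
             (product (cubeRoots-∣3 a≉0) (cubeRoots-∣3 (λ e → a≉1 (≈⇒-≈0 (≈-sym (-≈0⇒≈ {1ℤ} {a} e))))))))
        where
        lemma : ∀ k l → k * + 3 * (l * + 3) ≡ k * l * + 9
        lemma = solve-∀
        product : ∀ {x y} → + 3 Signed.∣ x → + 3 Signed.∣ y → + 9 Signed.∣ x * y
        product (Signed.divides k e) (Signed.divides l e′) = Signed.divides (k * l) (trans (cong₂ _*_ e e′) (lemma k l))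
      total : Σₚ (λ a → cubeRoots a * cubeRoots (1ℤ - a) + (- + 3 * δ a + - + 3 * δ (a - 1ℤ))) ≡ fermatCubicPoints - + 6
      total = trans (Σₚ-+ (λ a → cubeRoots a * cubeRoots (1ℤ - a)) (λ a → - + 3 * δ a + - + 3 * δ (a - 1ℤ)))
        (cong₂ _+_ (sym (Σₚ-cubes (λ a → cubeRoots (1ℤ - a)) (λ e → cubeRoots-resp (≈-refl {1ℤ} ⟨-⟩ e))))
          (trans (Σₚ-+ (λ a → - + 3 * δ a) (λ a → - + 3 * δ (a - 1ℤ)))
            (cong₂ _+_ (trans (Σₚ-*ˡ (- + 3) δ) (cong (- + 3 *_) Σₚ-δ0)) (trans (Σₚ-*ˡ (- + 3) (λ a → δ (a - 1ℤ))) (cong (- + 3 *_) (Σₚ-δ 1ℤ))))))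

    -- Equal to X³ + (1 - X)³, the norm of X + ω (1 - X) for a primitive cube root of unity ω.
    norm : ℤ → ℤ
    norm X = + 3 * (X * X) - + 3 * X + 1ℤ

    -- x = s X and y = s (1 − X) turn x³ + y³ into s³ norm X.
    fermatCubicPoints-norm : fermatCubicPoints ≡ Σₚ (λ X → Σₚ (λ s → δ (s * s * s * norm X - 1ℤ)))
    fermatCubicPoints-norm = ≡.begin
      Σₚ (λ x → Σₚ (λ y → δ (y * y * y - (1ℤ - x * x * x))))
        ≡.≡⟨ Σₚ-ext (λ x → sym (Σₚ-shift (λ y → δ (y * y * y - (1ℤ - x * x * x))) (- x) (λ e → δ-resp (+-≈ʳ (- (1ℤ - x * x * x)) (cube-≈ e))))) ⟩
      Σₚ (λ x → Σₚ (λ s → f x s))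
        ≡.≡⟨ Σₚ-swap f ⟩
      Σₚ (λ s → Σₚ (λ x → f x s))
        ≡.≡⟨ Σₚ-ext column ⟩
      Σₚ (λ s → Σₚ (λ X → δ (s * s * s * norm X - 1ℤ)))
        ≡.≡⟨ Σₚ-swap (λ s X → δ (s * s * s * norm X - 1ℤ)) ⟩
      Σₚ (λ X → Σₚ (λ s → δ (s * s * s * norm X - 1ℤ))) ≡.∎
      where
      module ≡ = ≡-Reasoning
      f : ℤ → ℤ → ℤ
      f x s = δ ((s + - x) * (s + - x) * (s + - x) - (1ℤ - x * x * x))
      lemma : ∀ s X → (s + - (s * X)) * (s + - (s * X)) * (s + - (s * X)) - (1ℤ - s * X * (s * X) * (s * X)) ≡ s * s * s * (+ 3 * (X * X) - + 3 * X + 1ℤ) - 1ℤ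
      lemma = solve-∀
      lemma₂ : ∀ s x → (s + - x) * (s + - x) * (s + - x) - (1ℤ - x * x * x) - - 1ℤ ≡ (s * s - + 3 * s * x + + 3 * x * x) * s
      lemma₂ = solve-∀
      lemma₃ : ∀ s n → s * s * s * n - 1ℤ - - 1ℤ ≡ (s * s * n) * s
      lemma₃ = solve-∀
      column : ∀ s → Σₚ (λ x → f x s) ≡ Σₚ (λ X → δ (s * s * s * norm X - 1ℤ))
      column s = by-cases s
        -- For s = x + y = 0 both columns are empty, as x³ + y³ is then 0 and not 1.
        (λ s≈0 → Σₚ-ext (λ x → trans (δ-zero (λ e → -1≉0 (≈-trans (≈-sym (≈-by (s * s - + 3 * s * x + + 3 * x * x) (lemma₂ s x) s≈0)) e)))
                        (sym (δ-zero (λ e → -1≉0 (≈-trans (≈-sym (≈-by (s * s * norm x) (lemma₃ s (norm x)) s≈0)) e))))))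
        (λ s≉0 → trans (sym (Σₚ-scale (λ x → f x s) s (λ {a} {b} e → δ-resp (cube-≈ (≈-refl {s} ⟨-⟩ e) ⟨-⟩ (≈-refl {1ℤ} ⟨-⟩ cube-≈ e))) s≉0))
                       (Σₚ-ext (λ X → δ-resp (≡⇒≈ (lemma s X)))))

    -- For a unit w the condition asks for cube roots of 1/w, which are as many as those of w. At w
    -- = 0 there is no solution although `cubeRoots` counts one; hence the correction.
    Σₚ-cubes-times : ∀ w → Σₚ (λ s → δ (s * s * s * w - 1ℤ)) ≡ cubeRoots w + - 1ℤ * δ w
    Σₚ-cubes-times w = by-cases w
      (λ w≈0 → trans (Σₚ-0 (λ s → δ-zero (λ e → 1≉0 (≈-trans (≈-sym (-≈0⇒≈ e)) (*-≈0ˡ (s * s * s) w≈0)))))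
                     (sym (cong₂ (λ x y → x + - 1ℤ * y) (cubeRoots-0 w≈0) (δ-one w≈0))))
      (λ w≉0 → trans (Σₚ-ext (λ s → trans (sym (δ-scale (inv w) (inv-≉0 w≉0))) (δ-resp (≈-by (s * s * s) (lemma (s * s * s) w (inv w)) (≈⇒-≈0 (*-inv w≉0))))))
                     (trans (sym (cubeRoots-inverse w (inv w) (*-inv w≉0)))
                            (sym (trans (cong (λ z → cubeRoots w + - 1ℤ * z) (δ-zero w≉0)) (+-identityʳ (cubeRoots w))))))
      where
      lemma : ∀ s w i → i * (s * w - 1ℤ) - (s - i) ≡ s * (w * i - 1ℤ)
      lemma = solve-∀

    6≉0 : + 6 ≉ 0ℤ
    6≉0 = *-≉0 {+ 2} {+ 3} 2≉0 3≉0

    12≉0 : + 12 ≉ 0ℤ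
    12≉0 = *-≉0 {+ 2} {+ 6} 2≉0 6≉0

    -- Completing the square gives 12 norm X = (6 X - 3)² + 3, and -3 is the square of the unit θ.
    norm-roots : Σₚ (λ X → δ (norm X)) ≡ + 2
    norm-roots = trans (Σₚ-ext (λ X → trans (sym (δ-scale (+ 12) 12≉0)) (δ-resp (≡⇒≈ (lemma X)))))
      (trans (Σₚ-affine (λ Y → δ (Y * Y - - + 3)) (+ 6) (- + 3) (λ e → δ-resp (+-≈ʳ (- - + 3) (e ⟨*⟩ e))) 6≉0)
             (squareRoots-square θ≉0 θ²))
      where
      lemma : ∀ X → + 12 * (+ 3 * (X * X) - + 3 * X + 1ℤ) ≡ (+ 6 * X + - + 3) * (+ 6 * X + - + 3) - - + 3
      lemma = solve-∀

    fermatCubicPoints-split : fermatCubicPoints ≡ Σₚ (λ X → cubeRoots (norm X)) - + 2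
    fermatCubicPoints-split = trans fermatCubicPoints-norm (trans (Σₚ-ext (λ X → Σₚ-cubes-times (norm X)))
      (trans (Σₚ-+ (λ X → cubeRoots (norm X)) (λ X → - 1ℤ * δ (norm X)))
             (cong (λ z → Σₚ (λ X → cubeRoots (norm X)) + z) (trans (Σₚ-*ˡ (- 1ℤ) (λ X → δ (norm X))) (cong (- 1ℤ *_) norm-roots)))))

    -- x = −4 s and y = 4 θ (2 X − 1) turn s³ = norm X into y² = x³ + 16.
    points-16 : points (+ 16) ≡ Σₚ (λ X → cubeRoots (norm X))
    points-16 = ≡.begin
      Σₚ (λ x → squareRoots (x * x * x + + 16))
        ≡.≡⟨ sym (Σₚ-scale (λ x → squareRoots (x * x * x + + 16)) (- + 4) (λ e → squareRoots-resp (+-≈ʳ (+ 16) (cube-≈ e))) -4≉0) ⟩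
      Σₚ (λ s → Σₚ (λ y → δ (y * y - (- + 4 * s * (- + 4 * s) * (- + 4 * s) + + 16))))
        ≡.≡⟨ Σₚ-ext (λ s → sym (Σₚ-affine (λ y → δ (y * y - (- + 4 * s * (- + 4 * s) * (- + 4 * s) + + 16))) (+ 8 * θ) (- (+ 4 * θ))
               (λ e → δ-resp (+-≈ʳ (- (- + 4 * s * (- + 4 * s) * (- + 4 * s) + + 16)) (e ⟨*⟩ e))) (*-≉0 {+ 8} {θ} 8≉0 θ≉0))) ⟩
      Σₚ (λ s → Σₚ (λ X → δ ((+ 8 * θ * X + - (+ 4 * θ)) * (+ 8 * θ * X + - (+ 4 * θ)) - (- + 4 * s * (- + 4 * s) * (- + 4 * s) + + 16))))
        ≡.≡⟨ Σₚ-ext (λ s → Σₚ-ext (λ X → trans (δ-resp (≈-by (+ 16 * ((+ 2 * X - 1ℤ) * (+ 2 * X - 1ℤ))) (lemma s X θ) (≈⇒-≈0 θ²))) (δ-scale (+ 64) (*-≉0 {+ 4} {+ 16} 4≉0 (*-≉0 {+ 4} {+ 4} 4≉0 4≉0))))) ⟩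
      Σₚ (λ s → Σₚ (λ X → δ (s * s * s - norm X)))
        ≡.≡⟨ Σₚ-swap (λ s X → δ (s * s * s - norm X)) ⟩
      Σₚ (λ X → cubeRoots (norm X)) ≡.∎
      where
      module ≡ = ≡-Reasoning
      -4≉0 : - + 4 ≉ 0ℤ
      -4≉0 e = 4≉0 (≈-neg e)
      lemma : ∀ s X t → (+ 8 * t * X + - (+ 4 * t)) * (+ 8 * t * X + - (+ 4 * t)) - (- + 4 * s * (- + 4 * s) * (- + 4 * s) + + 16) - + 64 * (s * s * s - (+ 3 * (X * X) - + 3 * X + 1ℤ))
        ≡ + 16 * ((+ 2 * X - 1ℤ) * (+ 2 * X - 1ℤ)) * (t * t - - + 3)
      lemma = solve-∀

    points-16-mod-9 : + 9 Signed.∣ points (+ 16) - + 8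
    points-16-mod-9 = subst (+ 9 Signed.∣_) (trans (cong (_- + 6) (trans fermatCubicPoints-split (cong (_- + 2) (sym points-16)))) (lemma (points (+ 16)))) fermatCubicPoints-mod-9
      where
      lemma : ∀ n → n - + 2 - + 6 ≡ n - + 8
      lemma = solve-∀

    -- A₀ and A₁ are both 1 modulo 3, so A₀ + 2 A₁ = 3 b, and `defect-norm` can be divided by 3.
    defect-eisenstein : ∀ s → s ≉ 0ℤ → ∃ λ b → defect (s * s) * defect (s * s) + + 3 * (b * b) ≡ + 4 * + p
    defect-eisenstein s s≉0 = from-divisor (subst (+ 3 Signed.∣_) (lemma₁ A′ B′) (Signed.∣m∣n⇒∣m+n (Signed.∣m∣n⇒∣m+n A-mod B-mod) (Signed.∣m∣n⇒∣m+n B-mod (Signed.divides 1ℤ refl))))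
      where
      A′ B′ : ℤ
      A′ = A₀ s s≉0
      B′ = A₁ s s≉0
      A-mod : + 3 Signed.∣ A′ - 1ℤ
      A-mod = defect-mod-3 s≉0 ≈-refl
      lemma₀ : ∀ s g → s * g * (s * g) ≡ s * s * (g * g)
      lemma₀ = solve-∀
      B-mod : + 3 Signed.∣ B′ - 1ℤ
      B-mod = defect-mod-3 (*-≉0 {s} {g} s≉0 g≉0) (≡⇒≈ (lemma₀ s g))
      lemma₁ : ∀ a b → a - 1ℤ + (b - 1ℤ) + (b - 1ℤ + + 3) ≡ a + + 2 * b
      lemma₁ = solve-∀
      lemma₂ : ∀ a b → + 3 * (a * a + + 3 * (b * b)) ≡ b * + 3 * (b * + 3) + + 3 * (a * a)
      lemma₂ = solve-∀
      from-divisor : + 3 Signed.∣ A′ + + 2 * B′ → ∃ λ b → A′ * A′ + + 3 * (b * b) ≡ + 4 * + p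
      from-divisor (Signed.divides b e) = b , ℤₚ.*-cancelˡ-≡ (+ 3) _ _
        (trans (lemma₂ A′ b) (trans (cong (λ z → z * z + + 3 * (A′ * A′)) (sym e)) (trans (defect-norm s s≉0) (ℤₚ.*-assoc (+ 3) (+ 4) (+ p)))))

  -- Hasse sums at 1/54, 1/24 and -1/216

  hasseSum : ℤ → ℤ
  hasseSum T = ∑ p (λ k → trinomial k * T ^ k)

  -- With 24 T = 1 the expansion of 4 (x + 2T)³ has the terms 24 T x² = x² and 48 T² x = 2 T x of (x
  -- + T)². Only the constants differ, by T² - 32 T³ = -8 T³.
  hasseSum-24 : ∀ h → p ∸ 1 ≡ 2 ℕ.* h → ∀ T → + 24 * T ≈ 1ℤ →
    hasseSum T ≈ - Σₚ (λ x → x ^ 0 * (+ 4 * x ^ 3 + - + 8 * (T * T * T)) ^ h)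
  hasseSum-24 h p∸1≡2h T 24T≈1 = begin
    hasseSum T
      ≈⟨ trinomial-cubic h p∸1≡2h T ⟩
    - Σₚ (λ x → (+ 4 * x ^ 3 + (x + T) ^ 2) ^ h)
      ≈⟨ ≈-neg (Σₚ-≈ (λ x → ≈-trans (≈-^ h (≈-by (- ((x + T) * (x + T))) (lemma x T) (≈⇒-≈0 24T≈1))) (≡⇒≈ (sym (*-identityˡ ((+ 4 * (1ℤ * x + + 2 * T) ^ 3 + - + 8 * (T * T * T)) ^ h)))))) ⟩
    - Σₚ (λ x → f (1ℤ * x + + 2 * T))
      ≈⟨ ≈-neg (Σₚ-affine-≈ f 1ℤ (+ 2 * T) (λ e → *-≈ˡ 1ℤ (≈-^ h (+-≈ʳ (- + 8 * (T * T * T)) (*-≈ˡ (+ 4) (≈-^ 3 e))))) 1≉0) ⟩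
    - Σₚ f ∎
    where
    f : ℤ → ℤ
    f x = x ^ 0 * (+ 4 * x ^ 3 + - + 8 * (T * T * T)) ^ h
    lemma : ∀ x T → + 4 * (x * (x * (x * 1ℤ))) + (x + T) * ((x + T) * 1ℤ)
      - (+ 4 * ((1ℤ * x + + 2 * T) * ((1ℤ * x + + 2 * T) * ((1ℤ * x + + 2 * T) * 1ℤ))) + - + 8 * (T * T * T)) ≡ - ((x + T) * (x + T)) * (+ 24 * T - 1ℤ)
    lemma = solve-∀

  module _ (n : ℕ) (n≤p∸1 : n ℕ.≤ p ∸ 1) (2n<p∸1 : 2 ℕ.* n ℕ.< p ∸ 1)
           (root : (1ℤ + + 3 * + n) * (+ 2 + + 3 * + n) ≈ 0ℤ) where

    hasseSum-reflect : ∀ T T′ → + 27 * T + + 27 * T′ ≈ 1ℤ → hasseSum T′ ≈ (- 1ℤ) ^ (p ∸ 1 ∸ n) * hasseSum T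
    hasseSum-reflect T T′ e = begin
      hasseSum T′ ≈⟨ trinomial-legendreSum n n≤p∸1 2n<p∸1 root T′ ⟩
      - R (+ 27 * T′) ≈⟨ ≈-neg (legendreSum-reflect n n≤p∸1 2n<p∸1 root e) ⟩
      - (s * R (+ 27 * T)) ≡⟨ ℤₚ.neg-distribʳ-* s (R (+ 27 * T)) ⟩
      s * - R (+ 27 * T) ≈⟨ *-≈ˡ s (≈-sym (trinomial-legendreSum n n≤p∸1 2n<p∸1 root T)) ⟩
      s * hasseSum T                      ∎
      where
      R : ℤ → ℤ
      R = legendreSum n n≤p∸1 2n<p∸1 root
      s : ℤ
      s = (- 1ℤ) ^ (p ∸ 1 ∸ n)

    hasseSum-54 : ∀ T → + 54 * T ≈ 1ℤ →
      hasseSum T ≈ - Σₚ (λ z → z ^ (p ∸ 1 ∸ n) * (- 1ℤ * z ^ 2 + + 27 * T * (+ 27 * T)) ^ n)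
    hasseSum-54 T e = ≈-trans (trinomial-legendreSum n n≤p∸1 2n<p∸1 root T)
      (≈-neg (legendreSum-half n n≤p∸1 2n<p∸1 root (≈-trans (≡⇒≈ (sym (ℤₚ.*-assoc (+ 2) (+ 27) T))) e)))

    -- 27/24 - 27/216 = 9/8 - 1/8 = 1, so the arguments are exchanged by y ↦ 1 - y.
    hasseSum-216 : ∀ T T′ → + 24 * T ≈ 1ℤ → - + 216 * T′ ≈ 1ℤ → hasseSum T′ ≈ (- 1ℤ) ^ (p ∸ 1 ∸ n) * hasseSum T
    hasseSum-216 T T′ e e′ = hasseSum-reflect T T′ (*-cancelˡ-≈ (+ 8) 8≉0 (-≈0⇒≈ (≈-trans (≡⇒≈ (lemma T T′))
      (≈-trans (*-≈ˡ (+ 9) (≈⇒-≈0 e) ⟨-⟩ ≈⇒-≈0 e′) ≈-refl))))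
      where
      lemma : ∀ T T′ → + 8 * (+ 27 * T + + 27 * T′) - + 8 * 1ℤ ≡ + 9 * (+ 24 * T - 1ℤ) - (- + 216 * T′ - 1ℤ)
      lemma = solve-∀

  -- Evaluation for p ≡ 1 modulo 3

  module ResidueOne (m : ℕ) (p∸1≡6m : p ∸ 1 ≡ 6 ℕ.* m) where
    open OneModSix m p∸1≡6m

    -- Since E(1) = 2a, the b in E(1)² + 3 b² = 4 p is even as well, so a belongs to a
    -- representation of p itself and a = ±u by uniqueness. The sign follows modulo 3 from 2a ≡ 1
    -- and u ≡ 1.
    defect-1 : ∀ u v → + p ≡ u * u + + 3 * (v * v) → + 3 Signed.∣ u - 1ℤ → defect 1ℤ ≡ - (+ 2 * u)
    defect-1 u v p≡ u-mod = even defect-1-even (defect-eisenstein 1ℤ 1≉0)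
      where
      lemma₁ : ∀ a b → + 3 * (b * b) ≡ a * + 2 * (a * + 2) + + 3 * (b * b) - + 4 * (a * a)
      lemma₁ = solve-∀
      lemma₂ : ∀ a p → + 4 * p - + 4 * (a * a) ≡ (+ 2 * p - + 2 * (a * a)) * + 2
      lemma₂ = solve-∀
      lemma₃ : ∀ a b → + 4 * (a * a + + 3 * (b * b)) ≡ a * + 2 * (a * + 2) + + 3 * (b * + 2 * (b * + 2))
      lemma₃ = solve-∀
      even-b : ∀ a b → a * + 2 * (a * + 2) + + 3 * (b * b) ≡ + 4 * + p → + 2 Signed.∣ b
      even-b a b e = [ (λ d → ⊥-elim (from-no (+ 2 Signed.∣? + 3) d)) , euclid-square prime[2] b ]′
        (euclid prime[2] (+ 3) (b * b) (Signed.divides (+ 2 * + p - + 2 * (a * a)) (trans (lemma₁ a b) (trans (cong (_- + 4 * (a * a)) e) (lemma₂ a (+ p))))))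
      sign-choice : ∀ a → defect 1ℤ ≡ a * + 2 → a ≡ u ⊎ a ≡ - u → defect 1ℤ ≡ - (+ 2 * u)
      sign-choice a e (inj₁ a≡u) = ⊥-elim (from-no (+ 3 Signed.∣? 1ℤ) (subst (+ 3 Signed.∣_) (lemma₅ u)
          (Signed.∣m∣n⇒∣m-n (subst (λ z → + 3 Signed.∣ z - 1ℤ) (trans e (cong (_* + 2) a≡u)) (defect-mod-3 1≉0 ≈-refl)) (Signed.∣n⇒∣m*n (+ 2) u-mod))))
        where
        lemma₅ : ∀ u → u * + 2 - 1ℤ - + 2 * (u - 1ℤ) ≡ 1ℤ
        lemma₅ = solve-∀
      sign-choice a e (inj₂ a≡-u) = trans e (trans (cong (_* + 2) a≡-u) (lemma₆ u))
        where
        lemma₆ : ∀ u → - u * + 2 ≡ - (+ 2 * u)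
        lemma₆ = solve-∀
      even : + 2 Signed.∣ defect 1ℤ → (∃ λ b → defect 1ℤ * defect 1ℤ + + 3 * (b * b) ≡ + 4 * + p) → defect 1ℤ ≡ - (+ 2 * u)
      even (Signed.divides a e) (b , eb) = halve (even-b a b eb′) eb′
        where
        eb′ : a * + 2 * (a * + 2) + + 3 * (b * b) ≡ + 4 * + p
        eb′ = trans (cong (λ z → z * z + + 3 * (b * b)) (sym e)) eb
        halve : ∀ {b} → + 2 Signed.∣ b → a * + 2 * (a * + 2) + + 3 * (b * b) ≡ + 4 * + p → defect 1ℤ ≡ - (+ 2 * u)
        halve (Signed.divides b′ refl) e′ = sign-choice a e (square-injective a u (norm-unique p-prime {1} {3} (s≤s (s≤s z≤n)) a b′ u v
          (trans (ℤₚ.*-cancelˡ-≡ (+ 4) _ _ (trans (lemma₃ a b′) e′)) (sym (*-identityˡ (+ p)))) (trans (sym p≡) (sym (*-identityˡ (+ p))))))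

    -- With p = 1 + 6m the count modulo 9 gives E(16) ≡ 7 - 6m, whence 9 divides 4 p - E(16)² = 3
    -- b². So 3 ∣ b, and the form A² + 3 B² becomes A² + 27 B², for which 4² < 27 ensures uniqueness
    -- at 4 p. The sign follows modulo 3.
    defect-16 : ∀ L M → + 4 * + p ≡ L * L + + 27 * (M * M) → + 3 Signed.∣ L - 1ℤ → defect (+ 16) ≡ L
    defect-16 L M 4p≡ L-mod = residue-nine points-16-mod-9 (defect-eisenstein (+ 4) 4≉0)
      where
      A′ : ℤ
      A′ = defect (+ 16)
      lemma₁ : ∀ a b → a * a + + 27 * (b * b) ≡ a * a + + 3 * (b * + 3 * (b * + 3))
      lemma₁ = solve-∀
      lemma₂ : ∀ n p k m → (n ≡ k * + 9 + + 8) → p ≡ 1ℤ + + 6 * m → n - p ≡ k * + 9 + + 7 - + 6 * m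
      lemma₂ n p k m refl refl = identity k m
        where
        identity : ∀ k m → k * + 9 + + 8 - (1ℤ + + 6 * m) ≡ k * + 9 + + 7 - + 6 * m
        identity = solve-∀
      lemma₃ : ∀ k m → + 4 * (1ℤ + + 6 * m) - (k * + 9 + + 7 - + 6 * m) * (k * + 9 + + 7 - + 6 * m)
        ≡ + 3 * ((+ 12 * m - + 5 - + 4 * (m * m) - + 9 * (k * k) - + 2 * k * (+ 7 - + 6 * m)) * + 3)
      lemma₃ = solve-∀
      lemma₄ : ∀ a c → c ≡ a + c - a
      lemma₄ = solve-∀
      lemma₅ : ∀ L → - L - 1ℤ + (L - 1ℤ) ≡ - + 2
      lemma₅ = solve-∀
      lemma₆ : ∀ n k → n - + 8 ≡ k → n ≡ k + + 8
      lemma₆ n k e = trans (identity n) (cong (_+ + 8) e)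
        where
        identity : ∀ n → n ≡ n - + 8 + + 8
        identity = solve-∀
      sign-choice : A′ ≡ L ⊎ A′ ≡ - L → A′ ≡ L
      sign-choice (inj₁ e) = e
      sign-choice (inj₂ e) = ⊥-elim (from-no (+ 3 Signed.∣? - + 2) (subst (+ 3 Signed.∣_) (lemma₅ L)
        (Signed.∣m∣n⇒∣m+n (subst (λ z → + 3 Signed.∣ z - 1ℤ) e (defect-mod-3 {+ 4} 4≉0 ≈-refl)) L-mod)))
      third : ∀ {b} → + 3 Signed.∣ b → A′ * A′ + + 3 * (b * b) ≡ + 4 * + p → A′ ≡ L
      third (Signed.divides b′ refl) e = sign-choice (square-injective A′ L (norm-unique p-prime {4} {27} 16<27 A′ b′ L M (trans (lemma₁ A′ b′) e) (sym 4p≡)))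
        where
        16<27 : 4 ℕ.* 4 ℕ.< 27
        16<27 = ℕₚ.m≤m+n 17 10
      residue-nine : + 9 Signed.∣ points (+ 16) - + 8 → (∃ λ b → A′ * A′ + + 3 * (b * b) ≡ + 4 * + p) → A′ ≡ L
      residue-nine (Signed.divides k e) (b , eb) = third (euclid-square prime[3] b (Signed.divides c (ℤₚ.*-cancelˡ-≡ (+ 3) (b * b) (c * + 3)
          (trans (lemma₄ (A′ * A′) (+ 3 * (b * b))) (trans (cong (_- A′ * A′) eb)
          (trans (cong₂ (λ x y → + 4 * x - y * y) p≡1+6m (lemma₂ (points (+ 16)) (+ p) k (+ m) (lemma₆ (points (+ 16)) (k * + 9) e) p≡1+6m)) (lemma₃ k (+ m)))))))) eb
        where
        c : ℤ
        c = + 12 * + m - + 5 - + 4 * (+ m * + m) - + 9 * (k * k) - + 2 * k * (+ 7 - + 6 * + m)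

    root : (1ℤ + + 3 * + (2 ℕ.* m)) * (+ 2 + + 3 * + (2 ℕ.* m)) ≈ 0ℤ
    root = *-≈ʳ (+ 2 + + 3 * + (2 ℕ.* m)) (≈-trans (≡⇒≈ (trans (cong (λ z → 1ℤ + + 3 * z) (pos-* 2 m)) (trans (lemma (+ m)) (sym p≡1+6m)))) M≈0)
      where
      lemma : ∀ m → 1ℤ + + 3 * (+ 2 * m) ≡ 1ℤ + + 6 * m
      lemma = solve-∀

    2m≤p∸1 : 2 ℕ.* m ℕ.≤ p ∸ 1
    2m≤p∸1 = ℕₚ.<⇒≤ 2m<p∸1

    6m≡4m+2m : 6 ℕ.* m ≡ 4 ℕ.* m ℕ.+ 2 ℕ.* m
    6m≡4m+2m = ℕₚ.*-distribʳ-+ m 4 2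

    p∸1∸2m : p ∸ 1 ∸ 2 ℕ.* m ≡ 4 ℕ.* m
    p∸1∸2m = trans (cong (_∸ 2 ℕ.* m) (trans p∸1≡6m 6m≡4m+2m)) (ℕₚ.m+n∸n≡m (4 ℕ.* m) (2 ℕ.* m))

    4m : 2 ℕ.* (2 ℕ.* m) ≡ 4 ℕ.* m
    4m = sym (ℕₚ.*-assoc 2 2 m)

    4m<p∸1 : 2 ℕ.* (2 ℕ.* m) ℕ.< p ∸ 1
    4m<p∸1 = subst₂ ℕ._<_ (sym 4m) (sym p∸1≡6m) (ℕₚ.*-monoˡ-< m {{ℕ.>-nonZero 0<m}} 4<6)
      where
      4<6 : 4 ℕ.< 6
      4<6 = ℕₚ.m≤m+n 5 1

    bin-3m : bin (3 ℕ.* m) (2 ℕ.* m) ≡ bin (3 ℕ.* m) m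
    bin-3m = trans (bin-sym (ℕₚ.m≤n+m (2 ℕ.* m) m)) (cong (bin (3 ℕ.* m)) (ℕₚ.m+n∸n≡m m (2 ℕ.* m)))

    m<p : m ℕ.< p
    m<p = ℕₚ.≤-<-trans (ℕₚ.m≤m+n m (m ℕ.+ 0)) (ℕₚ.<-trans 2m<p∸1 p∸1<p)

    -- The coefficient picked out is (-1)ᵐ C(2m, m) y^(2m) with y = 27 T. By `bin-half` for h = 3m
    -- it equals C(3m, m) (4 y²)ᵐ, and 2y ≡ 1; up to sign this is the binomial coefficient that
    -- gives E(1) modulo p.
    hasseSum-54-value : ∀ T → + 54 * T ≈ 1ℤ → hasseSum T ≈ - defect 1ℤ
    hasseSum-54-value T 54T≈1 = begin
      hasseSum T
        ≈⟨ hasseSum-54 (2 ℕ.* m) 2m≤p∸1 4m<p∸1 root T 54T≈1 ⟩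
      - Σₚ (λ z → z ^ (p ∸ 1 ∸ 2 ℕ.* m) * (- 1ℤ * z ^ 2 + y * y) ^ (2 ℕ.* m))
        ≈⟨ ≈-neg (Σₚ-coefficient (p ∸ 1 ∸ 2 ℕ.* m) 2 (2 ℕ.* m) m (- 1ℤ) (y * y) (ℕₚ.m≤m+n m (m ℕ.+ 0)) (ℕₚ.m∸n+n≡m 2m≤p∸1) bound) ⟩
      - - (bin (2 ℕ.* m) m * ((- 1ℤ) ^ m * (y * y) ^ (2 ℕ.* m ∸ m)))
        ≡⟨ trans (neg-involutive _) (trans (cong (λ k → bin (2 ℕ.* m) m * ((- 1ℤ) ^ m * (y * y) ^ k)) (trans (ℕₚ.m+n∸m≡n m (m ℕ.+ 0)) (ℕₚ.+-identityʳ m)))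
             (lemma₁ (bin (2 ℕ.* m) m) ((- 1ℤ) ^ m) ((y * y) ^ m))) ⟩
      (- 1ℤ) ^ m * bin (2 ℕ.* m) m * (y * y) ^ m
        ≈⟨ *-≈ʳ ((y * y) ^ m) (≈-sym (bin-half (3 ℕ.* m) p∸1≡2[3m] m m<p)) ⟩
      (+ 4) ^ m * bin (3 ℕ.* m) m * (y * y) ^ m
        ≡⟨ trans (lemma₂ ((+ 4) ^ m) (bin (3 ℕ.* m) m) ((y * y) ^ m)) (cong (bin (3 ℕ.* m) m *_) (sym (^-distribʳ-* (+ 4) (y * y) m))) ⟩
      bin (3 ℕ.* m) m * (+ 4 * (y * y)) ^ m
        ≈⟨ *-≈ˡ (bin (3 ℕ.* m) m) (≈-^ m (≈-by (+ 54 * T + 1ℤ) (lemma₃ T) (≈⇒-≈0 54T≈1))) ⟩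
      bin (3 ℕ.* m) m * 1ℤ ^ m
        ≡⟨ trans (sym (neg-involutive _)) (cong (λ b → - - (b * 1ℤ ^ m)) (sym bin-3m)) ⟩
      - - (bin (3 ℕ.* m) (2 ℕ.* m) * 1ℤ ^ m)
        ≈⟨ ≈-neg (≈-sym (defect-≈ 1ℤ)) ⟩
      - defect 1ℤ ∎
      where
      y : ℤ
      y = + 27 * T
      lemma₁ : ∀ a b c → a * (b * c) ≡ b * a * c
      lemma₁ = solve-∀
      lemma₂ : ∀ a b c → a * b * c ≡ b * (a * c)
      lemma₂ = solve-∀
      lemma₃ : ∀ T → + 4 * (+ 27 * T * (+ 27 * T)) - 1ℤ ≡ (+ 54 * T + 1ℤ) * (+ 54 * T - 1ℤ)
      lemma₃ = solve-∀
      bound : p ∸ 1 ∸ 2 ℕ.* m ℕ.+ 2 ℕ.* (2 ℕ.* m) ℕ.< (p ∸ 1) ℕ.+ (p ∸ 1)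
      bound = ℕₚ.+-mono-≤-< (ℕₚ.m∸n≤m (p ∸ 1) (2 ℕ.* m)) 4m<p∸1

    -- −8 T³ is the sixth power of 4 T θ.
    hasseSum-24-value : ∀ T → + 24 * T ≈ 1ℤ → hasseSum T ≈ - defect (+ 16)
    hasseSum-24-value T 24T≈1 = begin
      hasseSum T
        ≈⟨ hasseSum-24 (3 ℕ.* m) p∸1≡2[3m] T 24T≈1 ⟩
      - Σₚ (λ x → x ^ 0 * (+ 4 * x ^ 3 + c) ^ (3 ℕ.* m))
        ≈⟨ ≈-neg (Σₚ-coefficient 0 3 (3 ℕ.* m) (2 ℕ.* m) (+ 4) c (ℕₚ.m≤n+m (2 ℕ.* m) m) (sym (trans p∸1≡6m (ℕₚ.*-assoc 3 2 m))) 9m<2[p∸1]) ⟩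
      - - (b * ((+ 4) ^ (2 ℕ.* m) * c ^ (3 ℕ.* m ∸ 2 ℕ.* m)))
        -- The leading coefficient 4 enters with exponent 2m, and 4^(2m) = 16ᵐ: this is the origin
        -- of the curve y² = x³ + 16.
        ≡⟨ cong₂ (λ u k → - - (b * (u * c ^ k))) (sym (^-*-assoc (+ 4) 2 m)) (ℕₚ.m+n∸n≡m m (2 ℕ.* m)) ⟩
      - - (b * ((+ 16) ^ m * c ^ m))
        ≈⟨ ≈-neg (≈-neg (*-≈ˡ b (*-≈ˡ ((+ 16) ^ m) c^m≈1))) ⟩
      - - (b * ((+ 16) ^ m * 1ℤ))
        ≡⟨ cong (λ u → - - (b * u)) (*-identityʳ ((+ 16) ^ m)) ⟩
      - - (b * (+ 16) ^ m)
        ≈⟨ ≈-neg (≈-sym (defect-≈ (+ 16))) ⟩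
      - defect (+ 16) ∎
      where
      b c z : ℤ
      b = bin (3 ℕ.* m) (2 ℕ.* m)
      c = - + 8 * (T * T * T)
      z = + 4 * T * θ
      lemma₁ : ∀ T t → + 4 * T * t * (+ 4 * T * t) - - + 2 * T ≡ + 16 * T * T * (t * t - - + 3) + - + 2 * T * (+ 24 * T - 1ℤ)
      lemma₁ = solve-∀
      lemma₂ : ∀ T → - + 8 * (T * T * T) ≡ - + 2 * T * (- + 2 * T) * (- + 2 * T)
      lemma₂ = solve-∀
      lemma₃ : ∀ z → z * z * (z * z) * (z * z) ≡ z * (z * (z * (z * (z * (z * 1ℤ)))))
      lemma₃ = solve-∀
      zero-sum : ∀ a b → a * 0ℤ + b * 0ℤ ≡ 0ℤ
      zero-sum = solve-∀
      -- (4 T θ)² ≡ -48 T² ≡ -2 T by θ² ≡ -3 and 24 T ≡ 1, and the cube of -2 T is -8 T³.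
      z² : z * z ≈ - + 2 * T
      z² = -≈0⇒≈ (≈-trans (≡⇒≈ (lemma₁ T θ)) (≈-trans (*-≈ˡ (+ 16 * T * T) (≈⇒-≈0 θ²) ⟨+⟩ *-≈ˡ (- + 2 * T) (≈⇒-≈0 24T≈1)) (≡⇒≈ (zero-sum (+ 16 * T * T) (- + 2 * T)))))
      T≉0 : T ≉ 0ℤ
      T≉0 = inverse-≉0 (≈-trans (≡⇒≈ (ℤₚ.*-comm T (+ 24))) 24T≈1)
      z≉0 : z ≉ 0ℤ
      z≉0 = *-≉0 {+ 4 * T} {θ} (*-≉0 {+ 4} {T} 4≉0 T≉0) θ≉0
      c^m≈1 : c ^ m ≈ 1ℤ
      c^m≈1 = begin
        c ^ m ≈⟨ ≈-^ m (≈-trans (≡⇒≈ (lemma₂ T)) (≈-trans (≈-sym (cube-≈ z²)) (≡⇒≈ (lemma₃ z)))) ⟩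
        (z ^ 6) ^ m ≡⟨ trans (^-*-assoc z 6 m) (cong (z ^_) (sym p∸1≡6m)) ⟩
        z ^ (p ∸ 1) ≈⟨ fermat-unit z≉0 ⟩
        1ℤ             ∎

    hasseSum-216-value : ∀ T T′ → + 24 * T ≈ 1ℤ → - + 216 * T′ ≈ 1ℤ → hasseSum T′ ≈ hasseSum T
    hasseSum-216-value T T′ e e′ = ≈-trans (hasseSum-216 (2 ℕ.* m) 2m≤p∸1 4m<p∸1 root T T′ e e′)
      (≡⇒≈ (trans (cong (_* hasseSum T) (trans (cong ((- 1ℤ) ^_) (trans p∸1∸2m (sym 4m)))
        (trans (neg-^-even 1ℤ (2 ℕ.* m)) (^-zeroˡ (2 ℕ.* (2 ℕ.* m)))))) (*-identityˡ (hasseSum T))))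

  -- Vanishing for p ≡ 2 modulo 3

  module ResidueTwo (m : ℕ) (p∸1≡6m+4 : p ∸ 1 ≡ 6 ℕ.* m ℕ.+ 4) where

    -- Here p = 6m + 5, so n = (p - 2)/3 is odd and h = (p - 1)/2.
    n h : ℕ
    n = 2 ℕ.* m ℕ.+ 1
    h = 3 ℕ.* m ℕ.+ 2

    p∸1≡2h : p ∸ 1 ≡ 2 ℕ.* h
    p∸1≡2h = trans p∸1≡6m+4 (arith m)
      where
      arith : ∀ m → 6 ℕ.* m ℕ.+ 4 ≡ 2 ℕ.* (3 ℕ.* m ℕ.+ 2)
      arith = ℕ-Solver.solve-∀

    2n<p∸1 : 2 ℕ.* n ℕ.< p ∸ 1
    2n<p∸1 = subst₂ ℕ._<_ (ℕₚ.+-identityʳ (2 ℕ.* n)) (sym (trans p∸1≡6m+4 (arith m))) (ℕₚ.+-monoʳ-< (2 ℕ.* n) (s≤s z≤n))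
      where
      arith : ∀ m → 6 ℕ.* m ℕ.+ 4 ≡ 2 ℕ.* (2 ℕ.* m ℕ.+ 1) ℕ.+ suc (2 ℕ.* m ℕ.+ 1)
      arith = ℕ-Solver.solve-∀

    n≤p∸1 : n ℕ.≤ p ∸ 1
    n≤p∸1 = ℕₚ.≤-trans (ℕₚ.m≤m+n n (n ℕ.+ 0)) (ℕₚ.<⇒≤ 2n<p∸1)

    root : (1ℤ + + 3 * + n) * (+ 2 + + 3 * + n) ≈ 0ℤ
    root = *-≈0ˡ (1ℤ + + 3 * + n) (≈-trans (≡⇒≈ (trans (cong (λ z → + 2 + z) (sym (pos-* 3 n))) (cong +_ (trans (arith m) (sym (p≡1+ p∸1≡6m+4)))))) M≈0)
      where
      arith : ∀ m → 2 ℕ.+ 3 ℕ.* (2 ℕ.* m ℕ.+ 1) ≡ suc (6 ℕ.* m ℕ.+ 4)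
      arith = ℕ-Solver.solve-∀

    -- The exponent p - 1 - n = 2n + 1 is odd and the other factor is even in z, so the even
    -- exponent p - 1 never occurs. In other words, n is odd and Pₙ(0) = 0.
    hasseSum-54-zero : ∀ T → + 54 * T ≈ 1ℤ → hasseSum T ≈ 0ℤ
    hasseSum-54-zero T 54T≈1 = ≈-trans (hasseSum-54 n n≤p∸1 2n<p∸1 root T 54T≈1)
      (≈-neg (Σₚ-no-coefficient (p ∸ 1 ∸ n) 2 n (- 1ℤ) (+ 27 * T * (+ 27 * T)) (λ j _ e → odd-even j (trans (cong (ℕ._+ 2 ℕ.* j) (sym a≡)) (trans e p∸1≡2h)))
        (ℕₚ.+-mono-≤-< (ℕₚ.m∸n≤m (p ∸ 1) n) 2n<p∸1)))
      where
      arith : ∀ m → 6 ℕ.* m ℕ.+ 4 ≡ suc (2 ℕ.* (2 ℕ.* m ℕ.+ 1)) ℕ.+ (2 ℕ.* m ℕ.+ 1)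
      arith = ℕ-Solver.solve-∀
      a≡ : p ∸ 1 ∸ n ≡ suc (2 ℕ.* n)
      a≡ = trans (cong (_∸ n) (trans p∸1≡6m+4 (arith m))) (ℕₚ.m+n∸n≡m (suc (2 ℕ.* n)) n)
      odd-even : ∀ j → suc (2 ℕ.* n) ℕ.+ 2 ℕ.* j ≢ 2 ℕ.* h
      odd-even j e = ℕₚ.even≢odd h (n ℕ.+ j) (sym (trans (cong suc (ℕₚ.*-distribˡ-+ 2 n j)) e))

    -- Only powers of x³ occur, and 3 does not divide p - 1 = 6m + 4.
    hasseSum-24-zero : ∀ T → + 24 * T ≈ 1ℤ → hasseSum T ≈ 0ℤ
    hasseSum-24-zero T 24T≈1 = ≈-trans (hasseSum-24 h p∸1≡2h T 24T≈1)
      (≈-neg (Σₚ-no-coefficient 0 3 h (+ 4) (- + 8 * (T * T * T)) (λ j _ e → not-multiple j (trans e p∸1≡6m+4)) bound))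
      where
      not-multiple : ∀ j → 3 ℕ.* j ≢ 6 ℕ.* m ℕ.+ 4
      not-multiple j e = from-no (3 ℕd.∣? 4) (ℕd.∣m+n∣m⇒∣n (subst (3 ℕd.∣_) e (ℕd.m∣m*n j)) (subst (3 ℕd.∣_) (sym (ℕₚ.*-assoc 3 2 m)) (ℕd.m∣m*n (2 ℕ.* m))))
      arith : ∀ m → 6 ℕ.* m ℕ.+ 4 ℕ.+ (6 ℕ.* m ℕ.+ 4) ≡ 3 ℕ.* (3 ℕ.* m ℕ.+ 2) ℕ.+ suc (suc (3 ℕ.* m))
      arith = ℕ-Solver.solve-∀
      bound : 3 ℕ.* h ℕ.< (p ∸ 1) ℕ.+ (p ∸ 1)
      bound = subst (3 ℕ.* h ℕ.<_) (sym (trans (cong₂ ℕ._+_ p∸1≡6m+4 p∸1≡6m+4) (arith m))) (ℕₚ.m<m+n (3 ℕ.* h) (s≤s z≤n))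

    hasseSum-216-zero : ∀ T T′ → + 24 * T ≈ 1ℤ → - + 216 * T′ ≈ 1ℤ → hasseSum T′ ≈ 0ℤ
    hasseSum-216-zero T T′ e e′ = ≈-trans (hasseSum-216 n n≤p∸1 2n<p∸1 root T T′ e e′)
      (*-≈0ˡ ((- 1ℤ) ^ (p ∸ 1 ∸ n)) (hasseSum-24-zero T e))

  -- Reduction of rationals modulo p

  -- The rational q has denominator prime to p and the same residue as z. Carrying the unit
  -- condition along keeps all arithmetic inside the ring of such rationals.
  record _reducesTo_ (q : ℚ) (z : ℤ) : Set where
    constructor reduction
    field
      denominator-unit : ↧ q ≉ 0ℤ
      numerator : ↥ q ≈ z * ↧ q

  -- Operations on ℚ yield x / d after removal of a common factor g. As g divides d, it is prime to
  -- p and can be cancelled.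
  reduction-lift : ∀ q {z} g x d → ↥ q * g ≡ x → ↧ q * g ≡ d → d ≉ 0ℤ → x ≈ z * d → q reducesTo z
  reduction-lift q {z} g x d refl refl d≉0 e = reduction
    (λ e′ → d≉0 (≈-trans (*-≈ʳ g e′) (≡⇒≈ (*-zeroˡ g))))
    (*-cancelˡ-≈ g (λ e′ → d≉0 (*-≈0ˡ (↧ q) e′))
      (≈-trans (≡⇒≈ (ℤₚ.*-comm g (↥ q))) (≈-trans e (≡⇒≈ (lemma z (↧ q) g)))))
    where
    lemma : ∀ z d g → z * (d * g) ≡ g * (z * d)
    lemma = solve-∀

  reduction-/ : ∀ x d .{{_ : ℕ.NonZero d}} {z} → + d ≉ 0ℤ → x ≈ z * + d → (x ℚ./ d) reducesTo z
  reduction-/ x d d≉0 e = reduction-lift (x ℚ./ d) (gcd x (+ d)) x (+ d) (ℚₚ.↥-/ x d) (ℚₚ.↧-/ x d) d≉0 e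

  reduction-+ : ∀ {q r y z} → q reducesTo y → r reducesTo z → (q ℚ.+ r) reducesTo (y + z)
  reduction-+ {q} {r} {y} {z} (reduction u e) (reduction v f) =
    reduction-lift (q ℚ.+ r) _ _ _ (ℚₚ.↥-+ q r) (ℚₚ.↧-+ q r) (*-≉0 {↧ q} {↧ r} u v)
      (≈-trans (*-≈ʳ (↧ r) e ⟨+⟩ *-≈ʳ (↧ q) f) (≡⇒≈ (lemma y z (↧ q) (↧ r))))
    where
    lemma : ∀ y z a b → y * a * b + z * b * a ≡ (y + z) * (a * b)
    lemma = solve-∀

  reduction-neg : ∀ {q z} → q reducesTo z → (ℚ.- q) reducesTo (- z)
  reduction-neg {q} {z} (reduction u e) = reduction
    (λ e′ → u (≈-trans (≡⇒≈ (sym (ℚₚ.↧-neg q))) e′))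
    (≈-trans (≡⇒≈ (ℚₚ.↥-neg q)) (≈-trans (≈-neg e)
      (≡⇒≈ (trans (ℤₚ.neg-distribˡ-* z (↧ q)) (cong (- z *_) (sym (ℚₚ.↧-neg q)))))))

  reduction-congruent : ∀ {q r y z} → q reducesTo y → r reducesTo z → y ≈ z → q ≡ r [modℚ p ]
  reduction-congruent {q} {r} {y} {z} q↝y r↝z y≈z = Signed.∣⇒∣ᵤ (≈0⇒∣ (vanish (reduction-+ q↝y (reduction-neg r↝z))))
    where
    vanish : (q ℚ.- r) reducesTo (y - z) → ↥ (q ℚ.- r) ≈ 0ℤ
    vanish (reduction _ e) = ≈-trans e (≈-trans (*-≈ʳ (↧ (q ℚ.- r)) (≈⇒-≈0 y≈z)) (≡⇒≈ (*-zeroˡ (↧ (q ℚ.- r)))))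

  reduction-sum : ∀ n {f g} → (∀ i → f i reducesTo g i) → sumℚ n f reducesTo ∑ (suc n) g
  reduction-sum zero    {g = g} e = subst (_ reducesTo_) (sym (+-identityˡ (g 0))) (e 0)
  reduction-sum (suc n) e = reduction-+ (reduction-sum n e) (e (suc n))

  reduction-ι : ∀ z → ι z reducesTo z
  reduction-ι z = reduction-/ z 1 1≉0 (≡⇒≈ (sym (*-identityʳ z)))

  reduction-0 : 0ℚ reducesTo 0ℤ
  reduction-0 = reduction 1≉0 ≈-refl

  reduction-divPow : ∀ b .{{_ : ℕ.NonZero b}} J → + b * J ≈ 1ℤ → ∀ x n → divPow x b n reducesTo (x * J ^ n)
  reduction-divPow b J bJ≈1 x n = reduction-/ x (b ℕ.^ n) {{ℕₚ.m^n≢0 b n}}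
    (≉0-resp (≡⇒≈ (sym (pos-^ b n))) (^-≉0 n (inverse-≉0 bJ≈1)))
    (≈-sym (begin
      x * J ^ n * + (b ℕ.^ n) ≡⟨ cong (x * J ^ n *_) (pos-^ b n) ⟩
      x * J ^ n * (+ b) ^ n ≡⟨ trans (lemma x (J ^ n) ((+ b) ^ n)) (cong (x *_) (sym (^-distribʳ-* (+ b) J n))) ⟩
      x * (+ b * J) ^ n ≈⟨ *-≈ˡ x (≈-^ n bJ≈1) ⟩
      x * 1ℤ ^ n ≡⟨ trans (cong (x *_) (^-zeroˡ n)) (*-identityʳ x) ⟩
      x                             ∎))
    where
    lemma : ∀ x a b → x * a * b ≡ x * (b * a)
    lemma = solve-∀

  -- Evaluation of the sums for -27, 3 and 243

  -- Multiplied by M, the relation T (1 - 27 J) = -J required by `G3-sum` reads T (M - 27) = -1. It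
  -- also shows that 1 - 27 J is a unit, since J is one.
  hasseSum-G3 : ∀ M J T → M * J ≈ 1ℤ → (+ 27 - M) * T ≈ 1ℤ → ∑ (suc (p ∸ 1)) (λ n → G3 n * J ^ n) ≈ hasseSum T
  hasseSum-G3 M J T MJ≈1 unit = ≈-trans (≡⇒≈ (cong (λ k → ∑ k (λ n → G3 n * J ^ n)) (sym p≡1+[p∸1])))
    (G3-sum J T (λ e → J≉0 (≈-trans (≡⇒≈ (sym (neg-involutive J))) (≈-neg (≈-trans (≈-sym relation) (*-≈0ˡ T e))))) relation)
    where
    J≉0 : J ≉ 0ℤ
    J≉0 = inverse-≉0 (≈-trans (≡⇒≈ (ℤₚ.*-comm J M)) MJ≈1)
    lemma : ∀ M J T → M * (T * (1ℤ - + 27 * J)) - M * - J ≡ - 1ℤ * ((+ 27 - M) * T - 1ℤ) + (1ℤ - + 27 * T) * (M * J - 1ℤ)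
    lemma = solve-∀
    relation : T * (1ℤ - + 27 * J) ≈ - J
    relation = *-cancelˡ-≈ M (inverse-≉0 MJ≈1) (-≈0⇒≈ (≈-trans (≡⇒≈ (lemma M J T))
      (≈-trans (*-≈ˡ (- 1ℤ) (≈⇒-≈0 unit) ⟨+⟩ *-≈ˡ (1ℤ - + 27 * T) (≈⇒-≈0 MJ≈1)) (≡⇒≈ (trans (cong (λ z → - 1ℤ * 0ℤ + z) (*-zeroʳ (1ℤ - + 27 * T))) refl)))))

  24≉0 : + 24 ≉ 0ℤ
  24≉0 = *-≉0 {+ 8} {+ 3} 8≉0 3≉0

  27≉0 : + 27 ≉ 0ℤ
  27≉0 = *-≉0 {+ 9} {+ 3} 9≉0 3≉0

  T₅₄ T₂₄ T₂₁₆ : ℤ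
  T₅₄ = inv (+ 54)
  T₂₄ = inv (+ 24)
  T₂₁₆ = inv (- + 216)

  54T≈1 : + 54 * T₅₄ ≈ 1ℤ
  54T≈1 = *-inv (*-≉0 {+ 27} {+ 2} 27≉0 2≉0)

  24T≈1 : + 24 * T₂₄ ≈ 1ℤ
  24T≈1 = *-inv 24≉0

  216T≈1 : - + 216 * T₂₁₆ ≈ 1ℤ
  216T≈1 = *-inv (λ e → *-≉0 {+ 24} {+ 9} 24≉0 9≉0 (≈-neg e))

  S-27-sum : ∃ λ z → S-27 p reducesTo z × z ≈ hasseSum T₅₄
  S-27-sum = _ , reduction-sum (p ∸ 1) (λ n → subst (divNegPow (G3 n) 27 n reducesTo_) (sign n) (reduction-divPow 27 (inv (+ 27)) (*-inv 27≉0) (sgn n * G3 n) n))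
    -- The sign of `divNegPow` is absorbed into J = -1/27.
    , hasseSum-G3 (- + 27) (- inv (+ 27)) T₅₄ (≈-trans (≡⇒≈ (negate (inv (+ 27)))) (*-inv 27≉0)) 54T≈1
    where
    negate : ∀ i → - + 27 * - i ≡ + 27 * i
    negate = solve-∀
    lemma : ∀ s x y → s * x * y ≡ x * (s * y)
    lemma = solve-∀
    sign : ∀ n → sgn n * G3 n * inv (+ 27) ^ n ≡ G3 n * (- inv (+ 27)) ^ n
    sign n = trans (lemma (sgn n) (G3 n) (inv (+ 27) ^ n)) (cong (G3 n *_) (trans (sym (^-distribʳ-* (- 1ℤ) (inv (+ 27)) n)) (cong (_^ n) (-1*i≡-i (inv (+ 27))))))

  S3-sum : ∃ λ z → S3 p reducesTo z × z ≈ hasseSum T₂₄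
  S3-sum = _ , reduction-sum (p ∸ 1) (λ n → reduction-divPow 3 (inv (+ 3)) (*-inv 3≉0) (G3 n) n)
    , hasseSum-G3 (+ 3) (inv (+ 3)) T₂₄ (*-inv 3≉0) 24T≈1

  S243-sum : ∃ λ z → S243 p reducesTo z × z ≈ hasseSum T₂₁₆
  S243-sum = _ , reduction-sum (p ∸ 1) (λ n → reduction-divPow 243 (inv (+ 243)) 243-unit (G3 n) n)
    , hasseSum-G3 (+ 243) (inv (+ 243)) T₂₁₆ 243-unit 216T≈1
    where
    243-unit : + 243 * inv (+ 243) ≈ 1ℤ
    243-unit = *-inv (*-≉0 {+ 27} {+ 9} 27≉0 9≉0)

  congruent-by : ∀ {q r w z} → (∃ λ y → q reducesTo y × y ≈ w) → r reducesTo z → w ≈ z → q ≡ r [modℚ p ]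
  congruent-by (_ , q↝y , y≈w) r↝z w≈z = reduction-congruent q↝y r↝z (≈-trans y≈w w≈z)

  congruent-both : ∀ {q r w z} → (∃ λ y → q reducesTo y × y ≈ w) → (∃ λ y → r reducesTo y × y ≈ z) → w ≈ z → q ≡ r [modℚ p ]
  congruent-both e (_ , r↝y , y≈z) w≈z = congruent-by e r↝y (≈-trans w≈z (≈-sym y≈z))

  p-odd : ¬ 2 ℕd.∣ p
  p-odd d = [ (λ ()) , (λ 2≡p → ℕₚ.<⇒≢ (ℕₚ.<-trans (s≤s (s≤s (s≤s z≤n))) p>3) 2≡p) ]′ (prime⇒irreducible p-prime d)

  p-not-3 : ¬ 3 ℕd.∣ p
  p-not-3 d = [ (λ ()) , (λ 3≡p → ℕₚ.<⇒≢ p>3 3≡p) ]′ (prime⇒irreducible p-prime d)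

  parity : ∀ q → ∃ λ m → q ≡ 2 ℕ.* m ⊎ q ≡ suc (2 ℕ.* m)
  parity zero = 0 , inj₁ refl
  parity (suc q) with parity q
  ... | m , inj₁ e = m , inj₂ (cong suc e)
  ... | m , inj₂ e = suc m , inj₁ (trans (cong suc e) (sym (ℕₚ.*-suc 2 m)))

  one-mod-6 : p ℕ.% 3 ≡ 1 → ∃ λ m → p ∸ 1 ≡ 6 ℕ.* m
  one-mod-6 e = split (parity (p ℕ./ 3))
    where
    p-division : p ≡ 1 ℕ.+ p ℕ./ 3 ℕ.* 3
    p-division = trans (m≡m%n+[m/n]*n p 3) (cong (ℕ._+ p ℕ./ 3 ℕ.* 3) e)
    arith₁ : ∀ m → 2 ℕ.* m ℕ.* 3 ≡ 6 ℕ.* m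
    arith₁ = ℕ-Solver.solve-∀
    arith₂ : ∀ m → 1 ℕ.+ suc (2 ℕ.* m) ℕ.* 3 ≡ (3 ℕ.* m ℕ.+ 2) ℕ.* 2
    arith₂ = ℕ-Solver.solve-∀
    split : (∃ λ m → p ℕ./ 3 ≡ 2 ℕ.* m ⊎ p ℕ./ 3 ≡ suc (2 ℕ.* m)) → ∃ λ m → p ∸ 1 ≡ 6 ℕ.* m
    split (m , inj₁ q) = m , trans (cong (_∸ 1) p-division) (trans (cong (ℕ._* 3) q) (arith₁ m))
    split (m , inj₂ q) = ⊥-elim (p-odd (ℕd.divides (3 ℕ.* m ℕ.+ 2) (trans p-division (trans (cong (λ z → 1 ℕ.+ z ℕ.* 3) q) (arith₂ m)))))

  five-mod-6 : p ℕ.% 3 ≡ 2 → ∃ λ m → p ∸ 1 ≡ 6 ℕ.* m ℕ.+ 4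
  five-mod-6 e = split (parity (p ℕ./ 3))
    where
    p-division : p ≡ 2 ℕ.+ p ℕ./ 3 ℕ.* 3
    p-division = trans (m≡m%n+[m/n]*n p 3) (cong (ℕ._+ p ℕ./ 3 ℕ.* 3) e)
    arith₁ : ∀ m → 2 ℕ.+ 2 ℕ.* m ℕ.* 3 ≡ (3 ℕ.* m ℕ.+ 1) ℕ.* 2
    arith₁ = ℕ-Solver.solve-∀
    arith₂ : ∀ m → 1 ℕ.+ suc (2 ℕ.* m) ℕ.* 3 ≡ 6 ℕ.* m ℕ.+ 4
    arith₂ = ℕ-Solver.solve-∀
    split : (∃ λ m → p ℕ./ 3 ≡ 2 ℕ.* m ⊎ p ℕ./ 3 ≡ suc (2 ℕ.* m)) → ∃ λ m → p ∸ 1 ≡ 6 ℕ.* m ℕ.+ 4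
    split (m , inj₁ q) = ⊥-elim (p-odd (ℕd.divides (3 ℕ.* m ℕ.+ 1) (trans p-division (trans (cong (λ z → 2 ℕ.+ z ℕ.* 3) q) (arith₁ m)))))
    split (m , inj₂ q) = m , trans (cong (_∸ 1) p-division) (trans (cong (λ z → 1 ℕ.+ z ℕ.* 3) q) (arith₂ m))

  mod-3 : p ℕ.% 3 ≡ 1 ⊎ p ℕ.% 3 ≡ 2
  mod-3 = split (p ℕ.% 3) refl (m%n<n p 3)
    where
    split : ∀ r → p ℕ.% 3 ≡ r → r ℕ.< 3 → p ℕ.% 3 ≡ 1 ⊎ p ℕ.% 3 ≡ 2
    split 0 e _ = ⊥-elim (p-not-3 (ℕd.m%n≡0⇒n∣m p 3 e))
    split 1 e _ = inj₁ e
    split 2 e _ = inj₂ e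
    split (suc (suc (suc _))) _ (s≤s (s≤s (s≤s ())))

  3∣p∸1⇒one-mod-3 : 3 ℕd.∣ (p ∸ 1) → p ℕ.% 3 ≡ 1
  3∣p∸1⇒one-mod-3 (ℕd.divides q e) = trans (cong (ℕ._% 3) (p≡1+ e)) ([m+kn]%n≡m%n 1 q 3)

  S-27-one : ∀ u v → p ℕ.% 3 ≡ 1 → + p ≡ u * u + + 3 * (v * v) → + 3 ∣ (u - + 1) → S-27 p ≡ ι (+ 2 * u) [modℚ p ]
  S-27-one u v p-mod p≡ u-mod = value (one-mod-6 p-mod)
    where
    value : (∃ λ m → p ∸ 1 ≡ 6 ℕ.* m) → S-27 p ≡ ι (+ 2 * u) [modℚ p ]
    value (m , e) = congruent-by S-27-sum (reduction-ι (+ 2 * u)) (≈-trans (hasseSum-54-value T₅₄ 54T≈1)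
      (≡⇒≈ (trans (cong -_ (defect-1 u v p≡ (Signed.∣ᵤ⇒∣ u-mod))) (neg-involutive (+ 2 * u)))))
      where open ResidueOne m e

  S-27-two : p ℕ.% 3 ≡ 2 → S-27 p ≡ 0ℚ [modℚ p ]
  S-27-two p-mod = value (five-mod-6 p-mod)
    where
    value : (∃ λ m → p ∸ 1 ≡ 6 ℕ.* m ℕ.+ 4) → S-27 p ≡ 0ℚ [modℚ p ]
    value (m , e) = congruent-by S-27-sum reduction-0 (ResidueTwo.hasseSum-54-zero m e T₅₄ 54T≈1)

  S3-S243-one : ∀ L M → 3 ℕd.∣ (p ∸ 1) → + 4 * + p ≡ L * L + + 27 * (M * M) → + 3 ∣ (L - + 1) →
    (S3 p ≡ ι (- L) [modℚ p ]) × (S243 p ≡ ι (- L) [modℚ p ])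
  S3-S243-one L M p-mod 4p≡ L-mod = value (one-mod-6 (3∣p∸1⇒one-mod-3 p-mod))
    where
    value : (∃ λ m → p ∸ 1 ≡ 6 ℕ.* m) → (S3 p ≡ ι (- L) [modℚ p ]) × (S243 p ≡ ι (- L) [modℚ p ])
    value (m , e) = congruent-by S3-sum (reduction-ι (- L)) 24-value
      , congruent-by S243-sum (reduction-ι (- L)) (≈-trans (hasseSum-216-value T₂₄ T₂₁₆ 24T≈1 216T≈1) 24-value)
      where
      open ResidueOne m e
      24-value : hasseSum T₂₄ ≈ - L
      24-value = ≈-trans (hasseSum-24-value T₂₄ 24T≈1) (≡⇒≈ (cong -_ (defect-16 L M 4p≡ (Signed.∣ᵤ⇒∣ L-mod))))

  S3-S243-two : p ℕ.% 3 ≡ 2 → (S3 p ≡ 0ℚ [modℚ p ]) × (S243 p ≡ 0ℚ [modℚ p ])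
  S3-S243-two p-mod = value (five-mod-6 p-mod)
    where
    value : (∃ λ m → p ∸ 1 ≡ 6 ℕ.* m ℕ.+ 4) → (S3 p ≡ 0ℚ [modℚ p ]) × (S243 p ≡ 0ℚ [modℚ p ])
    value (m , e) = congruent-by S3-sum reduction-0 (ResidueTwo.hasseSum-24-zero m e T₂₄ 24T≈1)
      , congruent-by S243-sum reduction-0 (ResidueTwo.hasseSum-216-zero m e T₂₄ T₂₁₆ 24T≈1 216T≈1)

  -- The Hasse sums at 1/24 and -1/216 are compared directly: for p ≡ 1 modulo 3 the reflection has
  -- sign +1, and for p ≡ 2 both sums vanish.
  S3≡S243 : S3 p ≡ S243 p [modℚ p ]
  S3≡S243 = [ (λ e → case₁ (one-mod-6 e)) , (λ e → case₂ (five-mod-6 e)) ]′ mod-3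
    where
    case₁ : (∃ λ m → p ∸ 1 ≡ 6 ℕ.* m) → S3 p ≡ S243 p [modℚ p ]
    case₁ (m , e) = congruent-both S3-sum S243-sum (≈-sym (ResidueOne.hasseSum-216-value m e T₂₄ T₂₁₆ 24T≈1 216T≈1))
    case₂ : (∃ λ m → p ∸ 1 ≡ 6 ℕ.* m ℕ.+ 4) → S3 p ≡ S243 p [modℚ p ]
    case₂ (m , e) = congruent-both S3-sum S243-sum
      (≈-trans (ResidueTwo.hasseSum-24-zero m e T₂₄ 24T≈1) (≈-sym (ResidueTwo.hasseSum-216-zero m e T₂₄ T₂₁₆ 24T≈1 216T≈1)))

theorem3p8 : (p : ℕ) → Prime p → p > 3 →
    ((u v : ℤ) → p % 3 ≡ 1 → + p ≡ u * u + + 3 * (v * v) → + 3 ∣ (u - + 1) →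
    S-27 p ≡ ι (+ 2 * u) [modℚ p ])
    × (p % 3 ≡ 2 → S-27 p ≡ 0ℚ [modℚ p ])
    × (S3 p ≡ S243 p [modℚ p ])
    × ((L M : ℤ) → 3 ∣ℕ (p ∸ 1) → + 4 * + p ≡ L * L + + 27 * (M * M) → + 3 ∣ (L - + 1) →
    (S3 p ≡ ι (- L) [modℚ p ]) × (S243 p ≡ ι (- L) [modℚ p ]))
    × (p % 3 ≡ 2 → (S3 p ≡ 0ℚ [modℚ p ]) × (S243 p ≡ 0ℚ [modℚ p ]))
theorem3p8 p p-prime p>3 = S-27-one , S-27-two , S3≡S243 , S3-S243-one , S3-S243-two
  where open ModuloPrime p p-prime p>3
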